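{- For every integer $n\geq 0$, \begin{align*} ped(225n+43) &\equiv 0 \pmod{192},\\ ped(225n+88) &\equiv 0 \pmod{192},\\ ped(225n+133) &\equiv 0 \pmod{192},\\ ped(225n+223) &\equiv 0 \pmod{192}. \end{align*}
   Context: For an integer $n\ge 0$, $ped(n)$ denotes the number of partitions of $n$ in which the even parts are distinct and the odd parts are unrestricted, with $ped(0)=1$. Equivalently, $$\sum_{n=0}^{\infty} ped(n)q^n = \prod_{m=1}^{\infty}\frac{1-q^{4m}}{1-q^{m}}.$$ -}

module Defs where

open import Data.List using (List; []; _∷_; [_]; _++_; map; filter; length; sum)
open import Data.List.Membership.Propositional using (_∈_)
open import Data.List.Membership.Propositional.Properties
  using (∈-map⁺; ∈-map⁻; ∈-++⁺ˡ; ∈-++⁺ʳ; ∈-++⁻; ∈-filter⁺; ∈-filter⁻)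
open import Data.List.Properties using (∷-injectiveʳ)
open import Data.List.Relation.Unary.All as All using (All; []; _∷_)
import Data.List.Relation.Unary.AllPairs as AllPairs
open import Data.List.Relation.Unary.Any using (here)
open import Data.List.Relation.Unary.Linked as Linked using (Linked; []; [-]; _∷_)
open import Data.List.Relation.Unary.Unique.DecPropositional using (unique?)
open import Data.List.Relation.Unary.Unique.Propositional using (Unique)
import Data.List.Relation.Unary.Unique.Propositional.Properties as Unique
open import Data.Nat using (ℕ; zero; suc; _≤_; _<_; _≥_; _≟_; z≤n; s≤s)
open import Data.Nat.Divisibility using (_∣?_)
open import Data.Nat.Properties
open import Data.Product using (_×_; _,_; proj₁; proj₂)
open import Data.Sum using (inj₁; inj₂)
open import Function using (_⇔_; mk⇔)
open import Relation.Binary.PropositionalEquality using (_≡_; refl)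
open import Relation.Nullary using (¬_; contradiction)
open import Relation.Unary using (Decidable)

-- A partition is represented by its parts listed in weakly decreasing order.
record IsPartition (n : ℕ) (xs : List ℕ) : Set where
  constructor mkIsPartition
  field
    positive   : All (0 <_) xs
    decreasing : Linked _≥_ xs
    sums-to    : sum xs ≡ n

EvenPartsDistinct : List ℕ → Set
EvenPartsDistinct xs = Unique (filter (2 ∣?_) xs)

evenPartsDistinct? : Decidable EvenPartsDistinct
evenPartsDistinct? xs = unique? _≟_ (filter (2 ∣?_) xs)

-- All partitions, of any number, with at most ℓ parts, each at most k:
-- either suc k occurs, and is then the first part, or all parts are at most k.
box : (ℓ k : ℕ) → List (List ℕ)
box zero    _       = [ [] ]
box (suc ℓ) zero    = [ [] ]
box (suc ℓ) (suc k) = map (suc k ∷_) (box ℓ (suc k)) ++ box (suc ℓ) k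

-- A partition of n has at most n parts, each at most n, so nothing is lost by
-- searching the n × n box; see ∈-partitions and partitions-unique.
partitions : ℕ → List (List ℕ)
partitions n = filter (λ xs → sum xs ≟ n) (box n n)

ped : ℕ → ℕ
ped n = length (filter evenPartsDistinct? (partitions n))

private
  cons-decreasing : ∀ {k xs} → All (_≤ k) xs → Linked _≥_ xs → Linked _≥_ (k ∷ xs)
  cons-decreasing []      []  = [-]
  cons-decreasing (p ∷ _) lnk = p ∷ lnk

  head-bounds : ∀ {k xs} → Linked _≥_ (k ∷ xs) → All (_≤ k) xs
  head-bounds [-]       = []
  head-bounds (p ∷ lnk) = p ∷ All.map (λ q → ≤-trans q p) (head-bounds lnk)

  box-sound : ∀ ℓ k {xs} → xs ∈ box ℓ k →
              All (0 <_) xs × Linked _≥_ xs × All (_≤ k) xs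
  box-sound zero    k       (here refl) = [] , [] , []
  box-sound (suc ℓ) zero    (here refl) = [] , [] , []
  box-sound (suc ℓ) (suc k) xs∈
    with ∈-++⁻ (map (suc k ∷_) (box ℓ (suc k))) xs∈
  ... | inj₂ xs∈′ =
    let pos , dec , bnd = box-sound (suc ℓ) k xs∈′
    in  pos , dec , All.map m≤n⇒m≤1+n bnd
  ... | inj₁ xs∈′ with ∈-map⁻ (suc k ∷_) xs∈′
  ...   | ys , ys∈ , refl =
    let pos , dec , bnd = box-sound ℓ (suc k) ys∈
    in  s≤s z≤n ∷ pos , cons-decreasing bnd dec , ≤-refl ∷ bnd

  []∈box : ∀ ℓ k → [] ∈ box ℓ k
  []∈box zero    k       = here refl
  []∈box (suc ℓ) zero    = here refl
  []∈box (suc ℓ) (suc k) =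
    ∈-++⁺ʳ (map (suc k ∷_) (box ℓ (suc k))) ([]∈box (suc ℓ) k)

  box-complete : ∀ ℓ k {xs} → All (0 <_) xs → Linked _≥_ xs →
                 All (_≤ k) xs → length xs ≤ ℓ → xs ∈ box ℓ k
  box-complete ℓ       k       {[]}     _         _   _         _ = []∈box ℓ k
  box-complete (suc ℓ) zero    {x ∷ _}  (pos ∷ _) _   (x≤0 ∷ _) _ =
    contradiction (<-≤-trans pos x≤0) (n≮n 0)
  box-complete (suc ℓ) (suc k) {x ∷ xs} (pos ∷ ps) dec (x≤ ∷ bnd) (s≤s len)
    with m≤n⇒m<n∨m≡n x≤
  ... | inj₂ refl =
    ∈-++⁺ˡ (∈-map⁺ (suc k ∷_) (box-complete ℓ (suc k) ps (Linked.tail dec) bnd len))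
  ... | inj₁ (s≤s x≤k) =
    ∈-++⁺ʳ (map (suc k ∷_) (box ℓ (suc k)))
      (box-complete (suc ℓ) k (pos ∷ ps) dec
        (x≤k ∷ All.map (λ q → ≤-trans q x≤k) (head-bounds dec)) (s≤s len))

  box-unique : ∀ ℓ k → Unique (box ℓ k)
  box-unique zero    k       = [] AllPairs.∷ AllPairs.[]
  box-unique (suc ℓ) zero    = [] AllPairs.∷ AllPairs.[]
  box-unique (suc ℓ) (suc k) =
    Unique.++⁺ (Unique.map⁺ ∷-injectiveʳ (box-unique ℓ (suc k)))
               (box-unique (suc ℓ) k)
               λ (v∈₁ , v∈₂) → disjoint v∈₁ v∈₂
    where
    disjoint : ∀ {xs} → xs ∈ map (suc k ∷_) (box ℓ (suc k)) → ¬ xs ∈ box (suc ℓ) k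
    disjoint xs∈₁ xs∈₂ with ∈-map⁻ (suc k ∷_) xs∈₁
    ... | ys , _ , refl with proj₂ (proj₂ (box-sound (suc ℓ) k xs∈₂))
    ...   | k<k ∷ _ = n≮n k k<k

  length≤sum : ∀ {xs} → All (0 <_) xs → length xs ≤ sum xs
  length≤sum []         = z≤n
  length≤sum (pos ∷ ps) = +-mono-≤ pos (length≤sum ps)

  parts≤sum : ∀ xs → All (_≤ sum xs) xs
  parts≤sum []       = []
  parts≤sum (x ∷ xs) =
    m≤m+n x (sum xs) ∷ All.map (λ q → ≤-trans q (m≤n+m (sum xs) x)) (parts≤sum xs)

∈-partitions : ∀ n {xs} → xs ∈ partitions n ⇔ IsPartition n xs
∈-partitions n {xs} = mk⇔ to from
  where
  to : xs ∈ partitions n → IsPartition n xs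
  to xs∈ =
    let xs∈box , sum≡n = ∈-filter⁻ (λ ys → sum ys ≟ n) {xs = box n n} xs∈
        pos , dec , _  = box-sound n n xs∈box
    in  mkIsPartition pos dec sum≡n

  from : IsPartition n xs → xs ∈ partitions n
  from (mkIsPartition pos dec refl) =
    ∈-filter⁺ (λ ys → sum ys ≟ n)
      (box-complete n n pos dec (parts≤sum xs) (length≤sum pos)) refl

partitions-unique : ∀ n → Unique (partitions n)
partitions-unique n = Unique.filter⁺ (λ xs → sum xs ≟ n) (box-unique n n)

_ : map ped (0 ∷ 1 ∷ 2 ∷ 3 ∷ 4 ∷ 5 ∷ 6 ∷ 7 ∷ []) ≡ 1 ∷ 1 ∷ 2 ∷ 3 ∷ 4 ∷ 6 ∷ 9 ∷ 12 ∷ []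
_ = refl

{-# OPTIONS --safe #-}
module Submission where

-- Put φ = Σ q^(i²) over ℤ and ψ = Σ q^(j(j+1)/2) over ℕ. Gauss's product formulas turn the generating
-- function of ped into φ · Σ (−1)ⁿ ped(n) qⁿ = ψ, so everything is about ψ/φ.
--
-- Modulo 3, f(q)³ ≡ f(q³), and Σ (−1)ⁿ ped(3n + 1) qⁿ becomes a function of q³ times φ, which has no terms
-- in degrees 3n + 2. Hence 3 ∣ ped(9n + 7).
--
-- Modulo 64, ψ/φ is 2ψφ − ψφ³ plus 16 times a combination of ψ(q)φ(q^k) for k = 2, 4, 8. In our degrees n, the
-- number 8n + 1 = 15M has 3 and 5 as exact divisors, so it is not of the form x² + 8ky² for k = 1, 2, 4, 8, and only
-- −ψφ³ survives. Its coefficient is that of 8n + 1 = x² + 8(y² + z² + w²), which equals Σ (8/s) a over as = 8n + 1.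
-- The primes 3 and 5 contribute the factors 3 − 1 and 5 − 1 to this sum; since M ≡ 7 (mod 8), pairing complementary
-- divisors of M gives a factor 8.
--
-- The formula for ψφ³ comes from Liouville's identity for the solutions of Aα + Bβ = n, which evaluates products of
-- two Lambert series of weight one. That these series are φ(q)² and φ(q)φ(q²) is itself read off from their squares.

open import Defs
open import Algebra.Bundles using (CommutativeRing)
import Algebra.Solver.Ring as Ring
import Algebra.Solver.Ring.AlmostCommutativeRing as ACR
open import Data.Bool using (Bool; true; false; if_then_else_; _∧_; not) renaming (_≟_ to _≟ᵇ_)
open import Data.Fin as Fin using (Fin; toℕ; fromℕ<)
import Data.Fin.Properties as Finₚ
open import Data.Integer as ℤ using (ℤ; +_; -[1+_])
  renaming (_+_ to _+ᶻ_; _*_ to _*ᶻ_; -_ to -ᶻ_; _-_ to _-ᶻ_)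
import Data.Integer.Divisibility.Signed as Signed
import Data.Integer.Properties as ℤₚ
open import Data.Integer.Tactic.RingSolver using () renaming (solve-∀ to ℤ-ring)
open import Data.List
  using (List; []; _∷_; _++_; map; filter; upTo; allFin; tabulate; cartesianProduct; concatMap; length)
open import Data.List.Membership.Propositional using (_∈_)
open import Data.List.Membership.Propositional.Properties
open import Data.List.Membership.Propositional.Properties.WithK using (unique∧set⇒bag)
open import Data.List.Properties using (filter-accept; filter-reject; upTo-∷ʳ)
open import Data.List.Relation.Binary.BagAndSetEquality using (∼bag⇒↭)
open import Data.List.Relation.Binary.Permutation.Propositional as Perm using (_↭_)
open import Data.List.Relation.Unary.All as All using (All; []; _∷_)
open import Data.List.Relation.Unary.AllPairs as AllPairs using ([]; _∷_)
open import Data.List.Relation.Unary.Any using (here; there)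
open import Data.List.Relation.Unary.Unique.Propositional using (Unique)
import Data.List.Relation.Unary.Unique.Propositional.Properties as Unique
import Data.Maybe as Maybe
open import Data.Nat using (ℕ; zero; suc; pred; _+_; _*_; _∸_; _≤_; _<_; z≤n; s≤s; _/_; _%_; ∣_-_∣; NonZero; _≟_; _<?_; _≡ᵇ_)
open import Data.Nat.DivMod using (m≡m%n+[m/n]*n; m%n<n; m*n/n≡m; [m+kn]%n≡m%n)
open import Data.Nat.Divisibility using (_∣_; _∣?_; divides; ∣m+n∣m⇒∣n; n∣m*n; ∣m⇒∣m*n; n∣m⇒m%n≡0)
open import Data.Nat.Induction using (<-rec)
open import Data.Nat.LCM using (lcm-least)
open import Data.Nat.ListAction using () renaming (sum to sumℕ)
open import Data.Nat.Primality using (Prime; prime?; euclidsLemma)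
import Data.Nat.Properties as ℕₚ
open import Data.Nat.Tactic.RingSolver using () renaming (solve-∀ to ℕ-ring)
open import Data.Product using (Σ; ∃; _×_; _,_; proj₁; proj₂)
open import Data.Sum using (_⊎_; inj₁; inj₂)
open import Data.Empty using (⊥-elim)
open import Data.Unit using (⊤; tt)
open import Function using (_∘_; id; _$_; mk⇔)
open import Relation.Binary.Definitions using (tri<; tri≈; tri>)
open import Relation.Binary.PropositionalEquality
  using (_≡_; _≢_; refl; sym; trans; cong; cong₂; subst; module ≡-Reasoning)
import Relation.Binary.Reasoning.Setoid as SetoidReasoning
open import Relation.Nullary using (¬_; Dec; yes; no; does; contradiction)
open import Relation.Nullary.Decidable
  using (True; toWitness; from-yes; does-⇔; dec⇒maybe; dec-true; dec-false; ¬?)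

-- Formal power series over ℤ

-- The twist by (-1)ⁿ trades ψ(-q)/φ(-q) for ψ/φ, so that the coefficients of numerator and
-- denominator become counts of lattice points. Completing the square turns T(j) + ky² = n into x² +
-- 8ky² = 8n + 1 with x = 2j + 1. For k = 1, 4 the field is that of √-2, where 5 is inert; for k =
-- 2, 8 it is that of √-1, where 3 is inert. Each form is thus blocked by just one of the two
-- primes, and both are needed. The count behind ψφ³ is of weight two and is reached through
-- φ(q)φ(q²)³, whose coefficient at 8n + 1 is twice that of ψφ³ at n. It factors as φ(q)φ(q²) times
-- φ(q²)², two series of weight one. Liouville's method evaluates products of such Lambert series
-- but does not say that they are theta functions. Squares suffice for this, because even
-- coefficients are tied to those at half the degree, while an odd coefficient enters the square
-- linearly, with factor 2, next to lower ones.

Series : Set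
Series = ℕ → ℤ

infix 4 _≈_
record _≈_ (f g : Series) : Set where
  constructor pointwise
  field at : ∀ n → f n ≡ g n
open _≈_

tail : Series → Series
tail f = f ∘ suc

infixl 6 _+ˢ_ _-ˢ_
infixl 7 _*ˢ_ _•_
infix 8 -ˢ_

_+ˢ_ : Series → Series → Series
(f +ˢ g) n = f n +ᶻ g n

-ˢ_ : Series → Series
(-ˢ f) n = -ᶻ f n

_-ˢ_ : Series → Series → Series
f -ˢ g = f +ˢ -ˢ g

_•_ : ℤ → Series → Series
(c • f) n = c *ᶻ f n

-- The Cauchy product by Horner's rule, from f = f 0 + X · `tail f`. Recursion on the degree
-- replaces finite sums over k + l = n; products of graded families are enumerated by the same
-- recursion.
_*ˢ_ : Series → Series → Series
(f *ˢ g) zero    = f 0 *ᶻ g 0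
(f *ˢ g) (suc n) = f 0 *ᶻ g (suc n) +ᶻ (tail f *ˢ g) n

const : ℤ → Series
const c zero    = c
const c (suc n) = + 0

0ˢ 1ˢ X : Series
0ˢ = const (+ 0)
1ˢ = const (+ 1)
X zero    = + 0
X (suc n) = 1ˢ n

0ˢ≡0 : ∀ n → 0ˢ n ≡ + 0
0ˢ≡0 zero    = refl
0ˢ≡0 (suc n) = refl

≈-refl : ∀ {f} → f ≈ f
≈-refl = pointwise λ _ → refl

≈-sym : ∀ {f g} → f ≈ g → g ≈ f
≈-sym p = pointwise λ n → sym (at p n)

≈-trans : ∀ {f g h} → f ≈ g → g ≈ h → f ≈ h
≈-trans p q = pointwise λ n → trans (at p n) (at q n)

*ˢ-cong-at : ∀ n {f f′ g g′} → (∀ k → f k ≡ f′ k) → (∀ k → g k ≡ g′ k) → (f *ˢ g) n ≡ (f′ *ˢ g′) n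
*ˢ-cong-at zero    p q = cong₂ _*ᶻ_ (p 0) (q 0)
*ˢ-cong-at (suc n) p q = cong₂ _+ᶻ_ (cong₂ _*ᶻ_ (p 0) (q (suc n))) (*ˢ-cong-at n (p ∘ suc) q)

*ˢ-cong : ∀ {f f′ g g′} → f ≈ f′ → g ≈ g′ → f *ˢ g ≈ f′ *ˢ g′
*ˢ-cong p q = pointwise λ n → *ˢ-cong-at n (at p) (at q)

+ˢ-cong : ∀ {f f′ g g′} → f ≈ f′ → g ≈ g′ → f +ˢ g ≈ f′ +ˢ g′
+ˢ-cong p q = pointwise λ n → cong₂ _+ᶻ_ (at p n) (at q n)

-ˢ-cong : ∀ {f f′} → f ≈ f′ → -ˢ f ≈ -ˢ f′
-ˢ-cong p = pointwise λ n → cong -ᶻ_ (at p n)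

•-*ˢ : ∀ n c f g → ((c • f) *ˢ g) n ≡ c *ᶻ (f *ˢ g) n
•-*ˢ zero    c f g = ℤₚ.*-assoc c (f 0) (g 0)
•-*ˢ (suc n) c f g = trans (cong (c *ᶻ f 0 *ᶻ g (suc n) +ᶻ_) (•-*ˢ n c (tail f) g)) (lemma c (f 0) (g (suc n)) _)
  where
  lemma : ∀ c a b d → c *ᶻ a *ᶻ b +ᶻ c *ᶻ d ≡ c *ᶻ (a *ᶻ b +ᶻ d)
  lemma = ℤ-ring

*ˢ-distribʳ-at : ∀ n h f g → ((f +ˢ g) *ˢ h) n ≡ (f *ˢ h) n +ᶻ (g *ˢ h) n
*ˢ-distribʳ-at zero    h f g = ℤₚ.*-distribʳ-+ (h 0) (f 0) (g 0)
*ˢ-distribʳ-at (suc n) h f g = trans (cong ((f 0 +ᶻ g 0) *ᶻ h (suc n) +ᶻ_) (*ˢ-distribʳ-at n h (tail f) (tail g)))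
                                     (lemma (f 0) (g 0) (h (suc n)) _ _)
  where
  lemma : ∀ a b c d e → (a +ᶻ b) *ᶻ c +ᶻ (d +ᶻ e) ≡ a *ᶻ c +ᶻ d +ᶻ (b *ᶻ c +ᶻ e)
  lemma = ℤ-ring

-- The induction works because `tail (f *ˢ g)` unfolds to `f 0 • tail g +ˢ tail f *ˢ g`, to which
-- right distributivity applies.
*ˢ-assoc-at : ∀ n f g h → ((f *ˢ g) *ˢ h) n ≡ (f *ˢ (g *ˢ h)) n
*ˢ-assoc-at zero    f g h = ℤₚ.*-assoc (f 0) (g 0) (h 0)
*ˢ-assoc-at (suc n) f g h = begin
  a *ᶻ b *ᶻ c +ᶻ ((f 0 • tail g +ˢ tail f *ˢ g) *ˢ h) n
    ≡⟨ cong (a *ᶻ b *ᶻ c +ᶻ_) (*ˢ-distribʳ-at n h (f 0 • tail g) (tail f *ˢ g)) ⟩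
  a *ᶻ b *ᶻ c +ᶻ (((f 0 • tail g) *ˢ h) n +ᶻ ((tail f *ˢ g) *ˢ h) n)
    ≡⟨ cong₂ (λ u v → a *ᶻ b *ᶻ c +ᶻ (u +ᶻ v)) (•-*ˢ n (f 0) (tail g) h) (*ˢ-assoc-at n (tail f) g h) ⟩
  a *ᶻ b *ᶻ c +ᶻ (a *ᶻ (tail g *ˢ h) n +ᶻ (tail f *ˢ (g *ˢ h)) n)
    ≡⟨ lemma a b c _ _ ⟩
  a *ᶻ (b *ᶻ c +ᶻ (tail g *ˢ h) n) +ᶻ (tail f *ˢ (g *ˢ h)) n ∎
  where
  open ≡-Reasoning
  a = f 0
  b = g 0
  c = h (suc n)
  lemma : ∀ a b c d e → a *ᶻ b *ᶻ c +ᶻ (a *ᶻ d +ᶻ e) ≡ a *ᶻ (b *ᶻ c +ᶻ d) +ᶻ e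
  lemma = ℤ-ring

-- The product is defined by peeling the left factor; this is the recursion that peels the right
-- one. Commutativity is the agreement of the two.
*ˢ-suc : ∀ n f g → (f *ˢ g) (suc n) ≡ (f *ˢ tail g) n +ᶻ f (suc n) *ᶻ g 0
*ˢ-suc zero    f g = refl
*ˢ-suc (suc n) f g = trans (cong (f 0 *ᶻ g (suc (suc n)) +ᶻ_) (*ˢ-suc n (tail f) g)) (sym (ℤₚ.+-assoc (f 0 *ᶻ g (suc (suc n))) _ _))

*ˢ-comm-at : ∀ n f g → (f *ˢ g) n ≡ (g *ˢ f) n
*ˢ-comm-at zero    f g = ℤₚ.*-comm (f 0) (g 0)
*ˢ-comm-at (suc n) f g = begin
  f 0 *ᶻ g (suc n) +ᶻ (tail f *ˢ g) n ≡⟨ cong₂ _+ᶻ_ (ℤₚ.*-comm (f 0) (g (suc n))) (*ˢ-comm-at n (tail f) g) ⟩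
  g (suc n) *ᶻ f 0 +ᶻ (g *ˢ tail f) n ≡⟨ ℤₚ.+-comm _ ((g *ˢ tail f) n) ⟩
  (g *ˢ tail f) n +ᶻ g (suc n) *ᶻ f 0 ≡⟨ *ˢ-suc n g f ⟨
  (g *ˢ f) (suc n)                    ∎
  where open ≡-Reasoning

0-*ˢ : ∀ n f g → (∀ k → f k ≡ + 0) → (f *ˢ g) n ≡ + 0
0-*ˢ zero    f g z = trans (cong (_*ᶻ g 0) (z 0)) (ℤₚ.*-zeroˡ (g 0))
0-*ˢ (suc n) f g z = cong₂ _+ᶻ_ (trans (cong (_*ᶻ g (suc n)) (z 0)) (ℤₚ.*-zeroˡ (g (suc n)))) (0-*ˢ n (tail f) g (z ∘ suc))

const-*ˢ-at : ∀ n c f → (const c *ˢ f) n ≡ c *ᶻ f n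
const-*ˢ-at zero    c f = refl
const-*ˢ-at (suc n) c f = trans (cong (c *ᶻ f (suc n) +ᶻ_) (0-*ˢ n _ f λ _ → refl)) (ℤₚ.+-identityʳ _)

X-*ˢ-suc : ∀ f n → (X *ˢ f) (suc n) ≡ f n
X-*ˢ-suc f n = trans (ℤₚ.+-identityˡ _) (trans (const-*ˢ-at n (+ 1) f) (ℤₚ.*-identityˡ (f n)))

seriesRing : CommutativeRing _ _
seriesRing = record
  { Carrier = Series ; _≈_ = _≈_ ; _+_ = _+ˢ_ ; _*_ = _*ˢ_ ; -_ = -ˢ_ ; 0# = 0ˢ ; 1# = 1ˢ
  ; isCommutativeRing = record
    { isRing = record
      { +-isAbelianGroup = record
        { isGroup = record
          { isMonoid = record
            { isSemigroup = record
              { isMagma = record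
                { isEquivalence = record { refl = ≈-refl ; sym = ≈-sym ; trans = ≈-trans }
                ; ∙-cong = +ˢ-cong }
              ; assoc = λ f g h → pointwise λ n → ℤₚ.+-assoc (f n) (g n) (h n) }
            ; identity = (λ f → pointwise λ n → trans (cong (_+ᶻ f n) (0ˢ≡0 n)) (ℤₚ.+-identityˡ (f n)))
                       , (λ f → pointwise λ n → trans (cong (f n +ᶻ_) (0ˢ≡0 n)) (ℤₚ.+-identityʳ (f n))) }
          ; inverse = (λ f → pointwise λ n → trans (ℤₚ.+-inverseˡ (f n)) (sym (0ˢ≡0 n)))
                    , (λ f → pointwise λ n → trans (ℤₚ.+-inverseʳ (f n)) (sym (0ˢ≡0 n)))
          ; ⁻¹-cong = -ˢ-cong }
        ; comm = λ f g → pointwise λ n → ℤₚ.+-comm (f n) (g n) }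
      ; *-cong = *ˢ-cong
      ; *-assoc = λ f g h → pointwise λ n → *ˢ-assoc-at n f g h
      ; *-identity = 1-*ˢ , (λ f → ≈-trans (pointwise λ n → *ˢ-comm-at n f 1ˢ) (1-*ˢ f))
      ; distrib = (λ f g h → pointwise λ n → begin
          (f *ˢ (g +ˢ h)) n           ≡⟨ *ˢ-comm-at n f (g +ˢ h) ⟩
          ((g +ˢ h) *ˢ f) n           ≡⟨ *ˢ-distribʳ-at n f g h ⟩
          (g *ˢ f) n +ᶻ (h *ˢ f) n    ≡⟨ cong₂ _+ᶻ_ (*ˢ-comm-at n g f) (*ˢ-comm-at n h f) ⟩
          (f *ˢ g) n +ᶻ (f *ˢ h) n    ∎)
        , (λ f g h → pointwise λ n → *ˢ-distribʳ-at n f g h) }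
    ; *-comm = λ f g → pointwise λ n → *ˢ-comm-at n f g } }
  where
  open ≡-Reasoning
  1-*ˢ : ∀ f → 1ˢ *ˢ f ≈ f
  1-*ˢ f = pointwise λ n → trans (const-*ˢ-at n (+ 1) f) (ℤₚ.*-identityˡ (f n))

const-+ : ∀ a b → const (a +ᶻ b) ≈ const a +ˢ const b
const-+ a b = pointwise λ { zero → refl ; (suc n) → refl }

const-* : ∀ a b → const (a *ᶻ b) ≈ const a *ˢ const b
const-* a b = pointwise λ { zero → refl ; (suc n) → sym (trans (const-*ˢ-at (suc n) a (const b)) (ℤₚ.*-zeroʳ a)) }

const-neg : ∀ a → const (-ᶻ a) ≈ -ˢ const a
const-neg a = pointwise λ { zero → refl ; (suc n) → refl }

const-homo : CommutativeRing.rawRing ℤₚ.+-*-commutativeRing ACR.-Raw-AlmostCommutative⟶ ACR.fromCommutativeRing seriesRing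
const-homo = record { ⟦_⟧ = const ; +-homo = const-+ ; *-homo = const-* ; -‿homo = const-neg ; 0-homo = ≈-refl ; 1-homo = ≈-refl }

const-≟ : ∀ a b → Maybe.Maybe (const a ≈ const b)
const-≟ a b = Maybe.map (λ { refl → ≈-refl }) (dec⇒maybe (a ℤ.≟ b))

module SeriesSolver = Ring (CommutativeRing.rawRing ℤₚ.+-*-commutativeRing) (ACR.fromCommutativeRing seriesRing) const-homo const-≟
open SeriesSolver using (solve; _:+_; _:*_; _:-_; :-_; con; _:=_)

module ≈-Reasoning = SetoidReasoning (CommutativeRing.setoid seriesRing)

module SR = CommutativeRing seriesRing

infixr 8 _^ˢ_
_^ˢ_ : Series → ℕ → Series
f ^ˢ zero  = 1ˢ
f ^ˢ suc k = f *ˢ f ^ˢ k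

X^-*ˢ : ∀ k f n → (X ^ˢ k *ˢ f) (k + n) ≡ f n
X^-*ˢ zero    f n = at (SR.*-identityˡ f) n
X^-*ˢ (suc k) f n = trans (at (SR.*-assoc X (X ^ˢ k) f) (suc (k + n))) (trans (X-*ˢ-suc (X ^ˢ k *ˢ f) (k + n)) (X^-*ˢ k f n))

X^-*ˢ-below : ∀ k f n → n < k → (X ^ˢ k *ˢ f) n ≡ + 0
X^-*ˢ-below (suc k) f zero    n<k       = cong (_*ᶻ f 0) (ℤₚ.*-zeroˡ ((X ^ˢ k) 0))
X^-*ˢ-below (suc k) f (suc n) (s≤s n<k) =
  trans (at (SR.*-assoc X (X ^ˢ k) f) (suc n)) (trans (X-*ˢ-suc (X ^ˢ k *ˢ f) n) (X^-*ˢ-below k f n n<k))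

-- Order of vanishing

Below : ℕ → Series → Set
Below n f = ∀ {k} → k < n → f k ≡ + 0

Below-tail : ∀ {n f} → Below (suc n) f → Below n (tail f)
Below-tail b k<n = b (s≤s k<n)

Below-*ˢ-at : ∀ n {f} g → Below n f → (f *ˢ g) n ≡ f n *ᶻ g 0
Below-*ˢ-at zero        g b = refl
Below-*ˢ-at (suc n) {f} g b = begin
  f 0 *ᶻ g (suc n) +ᶻ (tail f *ˢ g) n  ≡⟨ cong₂ (λ u v → u *ᶻ g (suc n) +ᶻ v) (b (s≤s z≤n)) (Below-*ˢ-at n g (Below-tail {f = f} b)) ⟩
  + 0 *ᶻ g (suc n) +ᶻ f (suc n) *ᶻ g 0 ≡⟨ trans (cong (_+ᶻ f (suc n) *ᶻ g 0) (ℤₚ.*-zeroˡ (g (suc n)))) (ℤₚ.+-identityˡ (f (suc n) *ᶻ g 0)) ⟩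
  f (suc n) *ᶻ g 0                     ∎
  where open ≡-Reasoning

Below-≤ : ∀ {m n} → m ≤ n → ∀ {f} → Below n f → Below m f
Below-≤ m≤n b k<m = b (ℕₚ.<-≤-trans k<m m≤n)

Below-*ˢ : ∀ {n f} g → Below n f → Below n (f *ˢ g)
Below-*ˢ {n} {f} g b {k} k<n =
  trans (Below-*ˢ-at k g (Below-≤ (ℕₚ.<⇒≤ k<n) {f} b)) (trans (cong (_*ᶻ g 0) (b k<n)) (ℤₚ.*-zeroˡ (g 0)))

vanish : ∀ {K f} → (∀ {n} → n < K → Below n f → f n ≡ + 0) → Below K f
vanish {suc K} {f} step {k} (s≤s k≤K) with ℕₚ.m≤n⇒m<n∨m≡n k≤K
... | inj₁ k<K  = vanish {K} {f} (λ n<K → step (ℕₚ.m<n⇒m<1+n n<K)) k<K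
... | inj₂ refl = step ℕₚ.≤-refl (vanish {K} {f} (λ n<K → step (ℕₚ.m<n⇒m<1+n n<K)))

vanish-all : ∀ {f} → (∀ {n} → Below n f → f n ≡ + 0) → ∀ n → f n ≡ + 0
vanish-all {f} step n = vanish {suc n} {f} (λ _ → step) ℕₚ.≤-refl

-- A factor with constant term 1 preserves the lowest nonzero coefficient. Denominators can
-- therefore be cleared and cancelled again without inverting any series.
Below-cancel : ∀ {K} u f → u 0 ≡ + 1 → Below K (u *ˢ f) → Below K f
Below-cancel u f u0 b = vanish {f = f} λ {n} n<K bn → begin
  f n            ≡⟨ ℤₚ.*-identityʳ (f n) ⟨
  f n *ᶻ + 1     ≡⟨ cong (f n *ᶻ_) u0 ⟨
  f n *ᶻ u 0     ≡⟨ Below-*ˢ-at n u bn ⟨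
  (f *ˢ u) n     ≡⟨ *ˢ-comm-at n f u ⟩
  (u *ˢ f) n     ≡⟨ b n<K ⟩
  + 0            ∎
  where open ≡-Reasoning

-- The dilations q ↦ q² and q ↦ q³

d2 d3 : Series → Series
d2 f zero          = f 0
d2 f (suc zero)    = + 0
d2 f (suc (suc n)) = d2 (tail f) n
d3 f zero                = f 0
d3 f (suc zero)          = + 0
d3 f (suc (suc zero))    = + 0
d3 f (suc (suc (suc n))) = d3 (tail f) n

d2-at : ∀ n {f g} → (∀ k → f k ≡ g k) → d2 f n ≡ d2 g n
d2-at zero          p = p 0
d2-at (suc zero)    p = refl
d2-at (suc (suc n)) p = d2-at n (p ∘ suc)

d3-at : ∀ n {f g} → (∀ k → f k ≡ g k) → d3 f n ≡ d3 g n
d3-at zero                p = p 0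
d3-at (suc zero)          p = refl
d3-at (suc (suc zero))    p = refl
d3-at (suc (suc (suc n))) p = d3-at n (p ∘ suc)

d2-cong : ∀ {f g} → f ≈ g → d2 f ≈ d2 g
d2-cong p = pointwise λ n → d2-at n (at p)

d3-cong : ∀ {f g} → f ≈ g → d3 f ≈ d3 g
d3-cong p = pointwise λ n → d3-at n (at p)

d2-+-at : ∀ n f g → d2 (f +ˢ g) n ≡ d2 f n +ᶻ d2 g n
d2-+-at zero          f g = refl
d2-+-at (suc zero)    f g = refl
d2-+-at (suc (suc n)) f g = d2-+-at n (tail f) (tail g)

d3-+-at : ∀ n f g → d3 (f +ˢ g) n ≡ d3 f n +ᶻ d3 g n
d3-+-at zero                f g = refl
d3-+-at (suc zero)          f g = refl
d3-+-at (suc (suc zero))    f g = refl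
d3-+-at (suc (suc (suc n))) f g = d3-+-at n (tail f) (tail g)

d2-+ : ∀ f g → d2 (f +ˢ g) ≈ d2 f +ˢ d2 g
d2-+ f g = pointwise λ n → d2-+-at n f g

d3-+ : ∀ f g → d3 (f +ˢ g) ≈ d3 f +ˢ d3 g
d3-+ f g = pointwise λ n → d3-+-at n f g

d2-neg : ∀ f → d2 (-ˢ f) ≈ -ˢ d2 f
d2-neg f = pointwise λ n → go n f
  where
  go : ∀ n f → d2 (-ˢ f) n ≡ -ᶻ d2 f n
  go zero          f = refl
  go (suc zero)    f = refl
  go (suc (suc n)) f = go n (tail f)

-- Sections along residue classes of the degree

sec : ℕ → ℕ → Series → Series
sec k r f n = f (r + n * k)

private
  0-step : ∀ a b c → + 0 *ᶻ a +ᶻ (+ 0 *ᶻ b +ᶻ c) ≡ c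
  0-step = ℤ-ring
  0-step₁ : ∀ a b → a +ᶻ + 0 *ᶻ b ≡ a
  0-step₁ = ℤ-ring
  0-step₂ : ∀ a b c → a +ᶻ (+ 0 *ᶻ b +ᶻ + 0 *ᶻ c) ≡ a
  0-step₂ = ℤ-ring

d2-*-+2 : ∀ f g n → (d2 f *ˢ g) (suc (suc n)) ≡ f 0 *ᶻ g (suc (suc n)) +ᶻ (d2 (tail f) *ˢ g) n
d2-*-+2 f g n = lemma (f 0 *ᶻ g (suc (suc n))) (g (suc n)) ((d2 (tail f) *ˢ g) n)
  where
  lemma : ∀ a b c → a +ᶻ (+ 0 *ᶻ b +ᶻ c) ≡ a +ᶻ c
  lemma = ℤ-ring

d3-*-+3 : ∀ f g n → (d3 f *ˢ g) (suc (suc (suc n))) ≡ f 0 *ᶻ g (suc (suc (suc n))) +ᶻ (d3 (tail f) *ˢ g) n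
d3-*-+3 f g n = cong (f 0 *ᶻ g (suc (suc (suc n))) +ᶻ_) (0-step (g (suc (suc n))) (g (suc n)) ((d3 (tail f) *ˢ g) n))

-- A series in q² moves degrees by even amounts only, so it passes through the extraction of a
-- residue class and acts there as the undilated series.
d2-*-sec : ∀ r → r < 2 → ∀ n f g → (d2 f *ˢ g) (r + n * 2) ≡ (f *ˢ sec 2 r g) n
d2-*-sec 0 _ zero    f g = refl
d2-*-sec 1 _ zero    f g = 0-step₁ (f 0 *ᶻ g 1) (g 0)
d2-*-sec 0 p (suc n) f g = trans (d2-*-+2 f g (n * 2)) (cong (f 0 *ᶻ g (0 + suc n * 2) +ᶻ_) (d2-*-sec 0 p n (tail f) g))
d2-*-sec 1 p (suc n) f g = trans (d2-*-+2 f g (1 + n * 2)) (cong (f 0 *ᶻ g (1 + suc n * 2) +ᶻ_) (d2-*-sec 1 p n (tail f) g))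
d2-*-sec (suc (suc r)) (s≤s (s≤s ())) n f g

d3-*-sec : ∀ r → r < 3 → ∀ n f g → (d3 f *ˢ g) (r + n * 3) ≡ (f *ˢ sec 3 r g) n
d3-*-sec 0 _ zero    f g = refl
d3-*-sec 1 _ zero    f g = 0-step₁ (f 0 *ᶻ g 1) (g 0)
d3-*-sec 2 _ zero    f g = 0-step₂ (f 0 *ᶻ g 2) (g 1) (g 0)
d3-*-sec 0 p (suc n) f g = trans (d3-*-+3 f g (n * 3)) (cong (f 0 *ᶻ g (0 + suc n * 3) +ᶻ_) (d3-*-sec 0 p n (tail f) g))
d3-*-sec 1 p (suc n) f g = trans (d3-*-+3 f g (1 + n * 3)) (cong (f 0 *ᶻ g (1 + suc n * 3) +ᶻ_) (d3-*-sec 1 p n (tail f) g))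
d3-*-sec 2 p (suc n) f g = trans (d3-*-+3 f g (2 + n * 3)) (cong (f 0 *ᶻ g (2 + suc n * 3) +ᶻ_) (d3-*-sec 2 p n (tail f) g))
d3-*-sec (suc (suc (suc r))) (s≤s (s≤s (s≤s ()))) n f g

d2-* : ∀ f g → d2 (f *ˢ g) ≈ d2 f *ˢ d2 g
d2-* f g = pointwise λ n → go n f g
  where
  go : ∀ n f g → d2 (f *ˢ g) n ≡ (d2 f *ˢ d2 g) n
  go zero          f g = refl
  go (suc zero)    f g = sym (trans (cong (_+ᶻ + 0 *ᶻ g 0) (ℤₚ.*-zeroʳ (f 0))) (ℤₚ.*-zeroˡ (g 0)))
  go (suc (suc n)) f g = trans (d2-+-at n (f 0 • tail g) (tail f *ˢ g))
    (trans (cong₂ _+ᶻ_ (scale n (f 0) (tail g)) (go n (tail f) g)) (sym (d2-*-+2 f (d2 g) n)))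
    where
    scale : ∀ n c f → d2 (c • f) n ≡ c *ᶻ d2 f n
    scale zero          c f = refl
    scale (suc zero)    c f = sym (ℤₚ.*-zeroʳ c)
    scale (suc (suc n)) c f = scale n c (tail f)

d3-* : ∀ f g → d3 (f *ˢ g) ≈ d3 f *ˢ d3 g
d3-* f g = pointwise λ n → go n f g
  where
  scale : ∀ n c f → d3 (c • f) n ≡ c *ᶻ d3 f n
  scale zero                c f = refl
  scale (suc zero)          c f = sym (ℤₚ.*-zeroʳ c)
  scale (suc (suc zero))    c f = sym (ℤₚ.*-zeroʳ c)
  scale (suc (suc (suc n))) c f = scale n c (tail f)
  go : ∀ n f g → d3 (f *ˢ g) n ≡ (d3 f *ˢ d3 g) n
  go zero                f g = refl
  go (suc zero)          f g = sym (trans (0-step₁ (f 0 *ᶻ + 0) (g 0)) (ℤₚ.*-zeroʳ (f 0)))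
  go (suc (suc zero))    f g = sym (trans (0-step₂ (f 0 *ᶻ + 0) (+ 0) (g 0)) (ℤₚ.*-zeroʳ (f 0)))
  go (suc (suc (suc n))) f g = trans (d3-+-at n (f 0 • tail g) (tail f *ˢ g))
    (trans (cong₂ _+ᶻ_ (scale n (f 0) (tail g)) (go n (tail f) g)) (sym (d3-*-+3 f (d3 g) n)))

d2-even : ∀ n f → d2 f (n * 2) ≡ f n
d2-even zero    f = refl
d2-even (suc n) f = d2-even n (tail f)

d2-odd : ∀ n f → d2 f (1 + n * 2) ≡ + 0
d2-odd zero    f = refl
d2-odd (suc n) f = d2-odd n (tail f)

d3-0 : ∀ n f → d3 f (n * 3) ≡ f n
d3-0 zero    f = refl
d3-0 (suc n) f = d3-0 n (tail f)

d3-1 : ∀ n f → d3 f (1 + n * 3) ≡ + 0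
d3-1 zero    f = refl
d3-1 (suc n) f = d3-1 n (tail f)

d3-2 : ∀ n f → d3 f (2 + n * 3) ≡ + 0
d3-2 zero    f = refl
d3-2 (suc n) f = d3-2 n (tail f)

d2-const : ∀ c → d2 (const c) ≈ const c
d2-const c = pointwise λ { zero → refl ; (suc zero) → refl ; (suc (suc n)) → go n }
  where
  go : ∀ n → d2 (λ _ → + 0) n ≡ + 0
  go zero          = refl
  go (suc zero)    = refl
  go (suc (suc n)) = go n

d3-const : ∀ c → d3 (const c) ≈ const c
d3-const c = pointwise λ { zero → refl ; (suc zero) → refl ; (suc (suc zero)) → refl ; (suc (suc (suc n))) → go n }
  where
  go : ∀ n → d3 (λ _ → + 0) n ≡ + 0
  go zero                = refl
  go (suc zero)          = refl
  go (suc (suc zero))    = refl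
  go (suc (suc (suc n))) = go n

d2-X : d2 X ≈ X *ˢ X
d2-X = pointwise λ { zero → refl ; (suc zero) → refl ; (suc (suc n)) → trans (at (d2-const (+ 1)) n) (sym (X-*ˢ-suc X (suc n))) }

-- Twisting q ↦ −q

twist : Series → Series
twist f zero    = f 0
twist f (suc n) = -ᶻ twist (tail f) n

twist-at : ∀ n {f g} → (∀ k → f k ≡ g k) → twist f n ≡ twist g n
twist-at zero    p = p 0
twist-at (suc n) p = cong -ᶻ_ (twist-at n (p ∘ suc))

twist-+-at : ∀ n f g → twist (f +ˢ g) n ≡ twist f n +ᶻ twist g n
twist-+-at zero    f g = refl
twist-+-at (suc n) f g = trans (cong -ᶻ_ (twist-+-at n (tail f) (tail g))) (ℤₚ.neg-distrib-+ (twist (tail f) n) (twist (tail g) n))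

twist-• : ∀ n c f → twist (c • f) n ≡ c *ᶻ twist f n
twist-• zero    c f = refl
twist-• (suc n) c f = trans (cong -ᶻ_ (twist-• n c (tail f))) (ℤₚ.neg-distribʳ-* c (twist (tail f) n))

twist-* : ∀ f g → twist (f *ˢ g) ≈ twist f *ˢ twist g
twist-* f g = pointwise λ n → go n f g
  where
  neg-*ˢ : ∀ n f g → ((-ˢ f) *ˢ g) n ≡ -ᶻ (f *ˢ g) n
  neg-*ˢ n f g = at (solve 2 (λ f g → (:- f) :* g := :- (f :* g)) ≈-refl f g) n
  go : ∀ n f g → twist (f *ˢ g) n ≡ (twist f *ˢ twist g) n
  go zero    f g = refl
  go (suc n) f g = begin
    -ᶻ twist (f 0 • tail g +ˢ tail f *ˢ g) n
      ≡⟨ cong -ᶻ_ (twist-+-at n (f 0 • tail g) (tail f *ˢ g)) ⟩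
    -ᶻ (twist (f 0 • tail g) n +ᶻ twist (tail f *ˢ g) n)
      ≡⟨ cong₂ (λ u v → -ᶻ (u +ᶻ v)) (twist-• n (f 0) (tail g)) (go n (tail f) g) ⟩
    -ᶻ (f 0 *ᶻ twist (tail g) n +ᶻ (twist (tail f) *ˢ twist g) n)
      ≡⟨ lemma (f 0) (twist (tail g) n) ((twist (tail f) *ˢ twist g) n) ⟩
    f 0 *ᶻ -ᶻ twist (tail g) n +ᶻ -ᶻ (twist (tail f) *ˢ twist g) n
      ≡⟨ cong (f 0 *ᶻ -ᶻ twist (tail g) n +ᶻ_) (sym (neg-*ˢ n (twist (tail f)) (twist g))) ⟩
    (twist f *ˢ twist g) (suc n) ∎
    where
    open ≡-Reasoning
    lemma : ∀ a b c → -ᶻ (a *ᶻ b +ᶻ c) ≡ a *ᶻ -ᶻ b +ᶻ -ᶻ c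
    lemma = ℤ-ring

-- Congruences between series

infix 4 _≈_mod_
record _≈_mod_ (f g : Series) (m : ℤ) : Set where
  constructor by
  field
    quotient   : Series
    congruence : f ≈ g +ˢ const m *ˢ quotient
open _≈_mod_

≈⇒mod : ∀ {f g m} → f ≈ g → f ≈ g mod m
≈⇒mod {f} {g} {m} p = by 0ˢ $ ≈-trans p (solve 2 (λ g m → g := g :+ m :* con (+ 0)) ≈-refl g (const m))

mod-trans : ∀ {f g h m} → f ≈ g mod m → g ≈ h mod m → f ≈ h mod m
mod-trans {f} {g} {h} {m} (by a p) (by b q) = by (a +ˢ b) $ ≈-trans p (≈-trans (+ˢ-cong q ≈-refl)
  (solve 4 (λ h m a b → h :+ m :* b :+ m :* a := h :+ m :* (a :+ b)) ≈-refl h (const m) a b))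

mod-sym : ∀ {f g m} → f ≈ g mod m → g ≈ f mod m
mod-sym {f} {g} {m} (by a p) = by (-ˢ a) $ ≈-trans
  (solve 3 (λ g m a → g := g :+ m :* a :+ m :* (:- a)) ≈-refl g (const m) a) (+ˢ-cong (≈-sym p) ≈-refl)

mod-* : ∀ {f f′ g g′ m} → f ≈ f′ mod m → g ≈ g′ mod m → f *ˢ g ≈ f′ *ˢ g′ mod m
mod-* {f} {f′} {g} {g′} {m} (by a p) (by b q) = by (a *ˢ g′ +ˢ f′ *ˢ b +ˢ const m *ˢ a *ˢ b) $ ≈-trans (*ˢ-cong p q)
  (solve 5 (λ f g m a b → (f :+ m :* a) :* (g :+ m :* b) := f :* g :+ m :* (a :* g :+ f :* b :+ m :* a :* b)) ≈-refl f′ g′ (const m) a b)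

square-parity : ∀ a → ∃ λ c → a *ᶻ a ≡ a +ᶻ + 2 *ᶻ c
square-parity (+ n) = go n
  where
  step : ∀ a → (+ 1 +ᶻ a) *ᶻ (+ 1 +ᶻ a) ≡ a *ᶻ a +ᶻ (+ 2 *ᶻ a +ᶻ + 1)
  step = ℤ-ring
  collect : ∀ a c → a +ᶻ + 2 *ᶻ c +ᶻ (+ 2 *ᶻ a +ᶻ + 1) ≡ + 1 +ᶻ a +ᶻ + 2 *ᶻ (c +ᶻ a)
  collect = ℤ-ring
  go : ∀ n → ∃ λ c → + n *ᶻ + n ≡ + n +ᶻ + 2 *ᶻ c
  go zero    = + 0 , refl
  go (suc n) = let c , p = go n in c +ᶻ + n ,
    trans (step (+ n)) (trans (cong (_+ᶻ (+ 2 *ᶻ + n +ᶻ + 1)) p) (collect (+ n) c))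
square-parity -[1+ n ] = let c , p = square-parity (+ suc n) in c +ᶻ + suc n , trans p (collect (+ suc n) c)
  where
  collect : ∀ a c → a +ᶻ + 2 *ᶻ c ≡ -ᶻ a +ᶻ + 2 *ᶻ (c +ᶻ a)
  collect = ℤ-ring

cube-mod-3 : ∀ a → ∃ λ c → a *ᶻ a *ᶻ a ≡ a +ᶻ + 3 *ᶻ c
cube-mod-3 (+ n) = go n
  where
  step : ∀ a → (+ 1 +ᶻ a) *ᶻ (+ 1 +ᶻ a) *ᶻ (+ 1 +ᶻ a) ≡ a *ᶻ a *ᶻ a +ᶻ (+ 3 *ᶻ a *ᶻ a +ᶻ + 3 *ᶻ a +ᶻ + 1)
  step = ℤ-ring
  collect : ∀ a c → a +ᶻ + 3 *ᶻ c +ᶻ (+ 3 *ᶻ a *ᶻ a +ᶻ + 3 *ᶻ a +ᶻ + 1) ≡ + 1 +ᶻ a +ᶻ + 3 *ᶻ (c +ᶻ a *ᶻ a +ᶻ a)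
  collect = ℤ-ring
  go : ∀ n → ∃ λ c → + n *ᶻ + n *ᶻ + n ≡ + n +ᶻ + 3 *ᶻ c
  go zero    = + 0 , refl
  go (suc n) = let c , p = go n in c +ᶻ + n *ᶻ + n +ᶻ + n ,
    trans (step (+ n)) (trans (cong (_+ᶻ (+ 3 *ᶻ + n *ᶻ + n +ᶻ + 3 *ᶻ + n +ᶻ + 1)) p) (collect (+ n) c))
cube-mod-3 -[1+ n ] = let c , p = cube-mod-3 (+ suc n) in -ᶻ c ,
  trans (negate (+ suc n)) (trans (cong -ᶻ_ p) (collect (+ suc n) c))
  where
  negate : ∀ a → (-ᶻ a) *ᶻ (-ᶻ a) *ᶻ (-ᶻ a) ≡ -ᶻ (a *ᶻ a *ᶻ a)
  negate = ℤ-ring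
  collect : ∀ a c → -ᶻ (a +ᶻ + 3 *ᶻ c) ≡ -ᶻ a +ᶻ + 3 *ᶻ (-ᶻ c)
  collect = ℤ-ring

head-tail : ∀ f → f ≈ const (f 0) +ˢ X *ˢ tail f
head-tail f = pointwise λ { zero → sym (ℤₚ.+-identityʳ (f 0)) ; (suc n) → sym (trans (ℤₚ.+-identityˡ _) (X-*ˢ-suc (tail f) n)) }

-- Frobenius modulo 2. In the square of f 0 + X · `tail f` the mixed term is even, (f 0)² ≡ f 0, and
-- the square of `tail f` comes with X², so the induction drops the degree by two.
square≈d2 : ∀ f → f *ˢ f ≈ d2 f mod + 2
square≈d2 f = by (λ n → proj₁ (go n f)) $ pointwise λ n → trans (proj₂ (go n f)) (cong (d2 f n +ᶻ_) (sym (const-*ˢ-at n (+ 2) (λ n → proj₁ (go n f)))))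
  where
  R T : Series → Series
  R f = const (f 0) *ˢ (X *ˢ tail f)
  T f = tail f *ˢ tail f
  expand : ∀ f → f *ˢ f ≈ const (f 0 *ᶻ f 0) +ˢ const (+ 2) *ˢ R f +ˢ X *ˢ (X *ˢ T f)
  expand f = ≈-trans (*ˢ-cong (head-tail f) (head-tail f)) (≈-trans
    (solve 3 (λ a x t → (a :+ x :* t) :* (a :+ x :* t) := a :* a :+ con (+ 2) :* (a :* (x :* t)) :+ x :* (x :* (t :* t))) ≈-refl (const (f 0)) X (tail f))
    (+ˢ-cong (+ˢ-cong (≈-sym (const-* (f 0) (f 0))) ≈-refl) ≈-refl))
  expand-at : ∀ f n {a b} → const (f 0 *ᶻ f 0) n ≡ a → (X *ˢ (X *ˢ T f)) n ≡ b → (f *ˢ f) n ≡ a +ᶻ + 2 *ᶻ R f n +ᶻ b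
  expand-at f n p q = trans (at (expand f) n) (trans (cong (λ u → const (f 0 *ᶻ f 0) n +ᶻ u +ᶻ (X *ˢ (X *ˢ T f)) n) (const-*ˢ-at n (+ 2) (R f)))
    (cong₂ (λ u v → u +ᶻ + 2 *ᶻ R f n +ᶻ v) p q))
  collect : ∀ a c r → a +ᶻ + 2 *ᶻ c +ᶻ + 2 *ᶻ r +ᶻ + 0 ≡ a +ᶻ + 2 *ᶻ (c +ᶻ r)
  collect = ℤ-ring
  collect′ : ∀ a c r → + 0 +ᶻ + 2 *ᶻ r +ᶻ (a +ᶻ + 2 *ᶻ c) ≡ a +ᶻ + 2 *ᶻ (c +ᶻ r)
  collect′ = ℤ-ring
  go : ∀ n f → ∃ λ c → (f *ˢ f) n ≡ d2 f n +ᶻ + 2 *ᶻ c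
  go zero f = let c , p = square-parity (f 0) in c +ᶻ R f 0 , trans (expand-at f 0 p refl) (collect (f 0) c (R f 0))
  go (suc zero) f = + 0 +ᶻ R f 1 , trans (expand-at f 1 refl (X-*ˢ-suc (X *ˢ T f) 0)) (collect (+ 0) (+ 0) (R f 1))
  go (suc (suc n)) f = let c , p = go n (tail f) in c +ᶻ R f (suc (suc n)) ,
    trans (expand-at f (suc (suc n)) refl (trans (X-*ˢ-suc (X *ˢ T f) (suc n)) (trans (X-*ˢ-suc (T f) n) p)))
      (collect′ (d2 (tail f) n) c (R f (suc (suc n))))

cube≈d3 : ∀ f → f *ˢ f *ˢ f ≈ d3 f mod + 3
cube≈d3 f = by (λ n → proj₁ (go n f)) $ pointwise λ n → trans (proj₂ (go n f)) (cong (d3 f n +ᶻ_) (sym (const-*ˢ-at n (+ 3) (λ n → proj₁ (go n f)))))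
  where
  R T : Series → Series
  R f = const (f 0) *ˢ const (f 0) *ˢ (X *ˢ tail f) +ˢ const (f 0) *ˢ (X *ˢ tail f) *ˢ (X *ˢ tail f)
  T f = tail f *ˢ tail f *ˢ tail f
  expand : ∀ f → f *ˢ f *ˢ f ≈ const (f 0 *ᶻ f 0 *ᶻ f 0) +ˢ const (+ 3) *ˢ R f +ˢ X *ˢ (X *ˢ (X *ˢ T f))
  expand f = ≈-trans (*ˢ-cong (*ˢ-cong (head-tail f) (head-tail f)) (head-tail f)) (≈-trans
    (solve 3 (λ a x t → (a :+ x :* t) :* (a :+ x :* t) :* (a :+ x :* t) :=
       a :* a :* a :+ con (+ 3) :* (a :* a :* (x :* t) :+ a :* (x :* t) :* (x :* t)) :+ x :* (x :* (x :* (t :* t :* t)))) ≈-refl (const (f 0)) X (tail f))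
    (+ˢ-cong (+ˢ-cong (≈-sym (≈-trans (const-* (f 0 *ᶻ f 0) (f 0)) (*ˢ-cong (const-* (f 0) (f 0)) ≈-refl))) ≈-refl) ≈-refl))
  expand-at : ∀ f n {a b} → const (f 0 *ᶻ f 0 *ᶻ f 0) n ≡ a → (X *ˢ (X *ˢ (X *ˢ T f))) n ≡ b → (f *ˢ f *ˢ f) n ≡ a +ᶻ + 3 *ᶻ R f n +ᶻ b
  expand-at f n p q = trans (at (expand f) n) (trans (cong (λ u → const (f 0 *ᶻ f 0 *ᶻ f 0) n +ᶻ u +ᶻ (X *ˢ (X *ˢ (X *ˢ T f))) n) (const-*ˢ-at n (+ 3) (R f)))
    (cong₂ (λ u v → u +ᶻ + 3 *ᶻ R f n +ᶻ v) p q))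
  collect : ∀ a c r → a +ᶻ + 3 *ᶻ c +ᶻ + 3 *ᶻ r +ᶻ + 0 ≡ a +ᶻ + 3 *ᶻ (c +ᶻ r)
  collect = ℤ-ring
  collect′ : ∀ a c r → + 0 +ᶻ + 3 *ᶻ r +ᶻ (a +ᶻ + 3 *ᶻ c) ≡ a +ᶻ + 3 *ᶻ (c +ᶻ r)
  collect′ = ℤ-ring
  go : ∀ n f → ∃ λ c → (f *ˢ f *ˢ f) n ≡ d3 f n +ᶻ + 3 *ᶻ c
  go zero f = let c , p = cube-mod-3 (f 0) in c +ᶻ R f 0 , trans (expand-at f 0 p refl) (collect (f 0) c (R f 0))
  go (suc zero) f = + 0 +ᶻ R f 1 , trans (expand-at f 1 refl (X-*ˢ-suc (X *ˢ (X *ˢ T f)) 0)) (collect (+ 0) (+ 0) (R f 1))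
  go (suc (suc zero)) f = + 0 +ᶻ R f 2 , trans (expand-at f 2 refl (trans (X-*ˢ-suc (X *ˢ (X *ˢ T f)) 1) (X-*ˢ-suc (X *ˢ T f) 0))) (collect (+ 0) (+ 0) (R f 2))
  go (suc (suc (suc n))) f = let c , p = go n (tail f) in c +ᶻ R f (suc (suc (suc n))) ,
    trans (expand-at f (suc (suc (suc n))) refl (trans (X-*ˢ-suc (X *ˢ (X *ˢ T f)) (suc (suc n))) (trans (X-*ˢ-suc (X *ˢ T f) (suc n)) (trans (X-*ˢ-suc (T f) n) p))))
      (collect′ (d3 (tail f) n) c (R f (suc (suc (suc n)))))

-- Generating functions of graded families

private variable
  A B : Set

sumOver : List A → (A → ℤ) → ℤ
sumOver []       w = + 0
sumOver (x ∷ xs) w = w x +ᶻ sumOver xs w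

sumOver-cong : ∀ (xs : List A) {u v} → (∀ {x} → x ∈ xs → u x ≡ v x) → sumOver xs u ≡ sumOver xs v
sumOver-cong []       p = refl
sumOver-cong (x ∷ xs) p = cong₂ _+ᶻ_ (p (here refl)) (sumOver-cong xs (p ∘ there))

sumOver-++ : ∀ (xs ys : List A) w → sumOver (xs ++ ys) w ≡ sumOver xs w +ᶻ sumOver ys w
sumOver-++ []       ys w = sym (ℤₚ.+-identityˡ (sumOver ys w))
sumOver-++ (x ∷ xs) ys w = trans (cong (w x +ᶻ_) (sumOver-++ xs ys w)) (sym (ℤₚ.+-assoc (w x) (sumOver xs w) (sumOver ys w)))

sumOver-map : ∀ (f : A → B) xs w → sumOver (map f xs) w ≡ sumOver xs (w ∘ f)
sumOver-map f []       w = refl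
sumOver-map f (x ∷ xs) w = cong (w (f x) +ᶻ_) (sumOver-map f xs w)

sumOver-concatMap : ∀ (f : A → List B) xs w → sumOver (concatMap f xs) w ≡ sumOver xs (λ x → sumOver (f x) w)
sumOver-concatMap f []       w = refl
sumOver-concatMap f (x ∷ xs) w = trans (sumOver-++ (f x) (concatMap f xs) w) (cong (sumOver (f x) w +ᶻ_) (sumOver-concatMap f xs w))

sumOver-+ : ∀ (xs : List A) u v → sumOver xs (λ x → u x +ᶻ v x) ≡ sumOver xs u +ᶻ sumOver xs v
sumOver-+ []       u v = refl
sumOver-+ (x ∷ xs) u v = trans (cong (u x +ᶻ v x +ᶻ_) (sumOver-+ xs u v)) (lemma (u x) (v x) (sumOver xs u) (sumOver xs v))
  where
  lemma : ∀ a b c d → a +ᶻ b +ᶻ (c +ᶻ d) ≡ a +ᶻ c +ᶻ (b +ᶻ d)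
  lemma = ℤ-ring

sumOver-* : ∀ c (xs : List A) w → sumOver xs (λ x → c *ᶻ w x) ≡ c *ᶻ sumOver xs w
sumOver-* c []       w = sym (ℤₚ.*-zeroʳ c)
sumOver-* c (x ∷ xs) w = trans (cong (c *ᶻ w x +ᶻ_) (sumOver-* c xs w)) (sym (ℤₚ.*-distribˡ-+ c (w x) (sumOver xs w)))

sumOver-×-* : ∀ (xs : List A) (ys : List B) u v →
  sumOver (cartesianProduct xs ys) (λ (x , y) → u x *ᶻ v y) ≡ sumOver xs u *ᶻ sumOver ys v
sumOver-×-* []       ys u v = sym (ℤₚ.*-zeroˡ (sumOver ys v))
sumOver-×-* (x ∷ xs) ys u v = begin
  sumOver (map (x ,_) ys ++ cartesianProduct xs ys) uv            ≡⟨ sumOver-++ (map (x ,_) ys) (cartesianProduct xs ys) uv ⟩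
  sumOver (map (x ,_) ys) uv +ᶻ sumOver (cartesianProduct xs ys) uv
    ≡⟨ cong₂ _+ᶻ_ (trans (sumOver-map (x ,_) ys uv) (sumOver-* (u x) ys v)) (sumOver-×-* xs ys u v) ⟩
  u x *ᶻ sumOver ys v +ᶻ sumOver xs u *ᶻ sumOver ys v             ≡⟨ ℤₚ.*-distribʳ-+ (sumOver ys v) (u x) (sumOver xs u) ⟨
  (u x +ᶻ sumOver xs u) *ᶻ sumOver ys v                           ∎
  where
  open ≡-Reasoning
  uv = λ (x , y) → u x *ᶻ v y

sumOver-↭ : ∀ {xs ys : List A} w → xs ↭ ys → sumOver xs w ≡ sumOver ys w
sumOver-↭ w Perm.refl                  = refl
sumOver-↭ w (Perm.prep x p)            = cong (w x +ᶻ_) (sumOver-↭ w p)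
sumOver-↭ w (Perm.trans p q)           = trans (sumOver-↭ w p) (sumOver-↭ w q)
sumOver-↭ w (Perm.swap {xs} {ys} x y p) =
  trans (cong (λ s → w x +ᶻ (w y +ᶻ s)) (sumOver-↭ w p)) (lemma (w x) (w y) (sumOver ys w))
  where
  lemma : ∀ a b c → a +ᶻ (b +ᶻ c) ≡ b +ᶻ (a +ᶻ c)
  lemma = ℤ-ring

nonzero? : ∀ (w : A → ℤ) x → Dec (w x ≢ + 0)
nonzero? w x = ¬? (w x ℤ.≟ + 0)

sumOver-filter : ∀ (xs : List A) w → sumOver xs w ≡ sumOver (filter (nonzero? w) xs) w
sumOver-filter []       w = refl
sumOver-filter (x ∷ xs) w with w x ℤ.≟ + 0
... | yes z = trans (cong₂ _+ᶻ_ z (sumOver-filter xs w)) (ℤₚ.+-identityˡ (sumOver (filter (nonzero? w) xs) w))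
... | no  _ = cong (w x +ᶻ_) (sumOver-filter xs w)

map-unique : ∀ (f : A → B) {xs} → (∀ {x y} → x ∈ xs → y ∈ xs → f x ≡ f y → x ≡ y) → Unique xs → Unique (map f xs)
map-unique f inj []           = []
map-unique f {x ∷ xs} inj (x∉ ∷ u) =
  All.tabulate (λ z∈ fx≡z → let y , y∈ , z≡fy = ∈-map⁻ f z∈ in All.lookup x∉ y∈ (inj (here refl) (there y∈) (trans fx≡z z≡fy)))
  ∷ map-unique f (λ x∈ y∈ → inj (there x∈) (there y∈)) u

-- The maps have to be inverse to each other only where the weights do not vanish. This admits maps
-- such as division by a prime, which make sense only on the divisors that carry weight.
sumOver-reindex : ∀ {xs : List A} {ys : List B} (u : A → ℤ) (v : B → ℤ) (f : A → B) (g : B → A) → Unique xs → Unique ys →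
  (∀ {x} → x ∈ xs → u x ≢ + 0 → f x ∈ ys × g (f x) ≡ x × v (f x) ≡ u x) →
  (∀ {y} → y ∈ ys → v y ≢ + 0 → g y ∈ xs × f (g y) ≡ y × u (g y) ≡ v y) →
  sumOver xs u ≡ sumOver ys v
sumOver-reindex {xs = xs} {ys} u v f g uxs uys to from = begin
  sumOver xs u          ≡⟨ sumOver-filter xs u ⟩
  sumOver xs′ u         ≡⟨ sumOver-cong xs′ (λ x∈ → sym (proj₂ (proj₂ (to′ x∈)))) ⟩
  sumOver xs′ (v ∘ f)   ≡⟨ sumOver-map f xs′ v ⟨
  sumOver (map f xs′) v ≡⟨ sumOver-↭ v (∼bag⇒↭ (unique∧set⇒bag fxs-unique (Unique.filter⁺ (nonzero? v) uys) (mk⇔ into onto))) ⟩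
  sumOver ys′ v         ≡⟨ sumOver-filter ys v ⟨
  sumOver ys v          ∎
  where
  open ≡-Reasoning
  xs′ = filter (nonzero? u) xs
  ys′ = filter (nonzero? v) ys
  to′ : ∀ {x} → x ∈ xs′ → f x ∈ ys × g (f x) ≡ x × v (f x) ≡ u x
  to′ x∈ = let x∈xs , ux≢0 = ∈-filter⁻ (nonzero? u) {xs = xs} x∈ in to x∈xs ux≢0
  fxs-unique : Unique (map f xs′)
  fxs-unique = map-unique f
    (λ x∈ y∈ fx≡fy → trans (sym (proj₁ (proj₂ (to′ x∈)))) (trans (cong g fx≡fy) (proj₁ (proj₂ (to′ y∈)))))
    (Unique.filter⁺ (nonzero? u) uxs)
  into : ∀ {y} → y ∈ map f xs′ → y ∈ ys′
  into y∈ with ∈-map⁻ f y∈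
  ... | x , x∈ , refl = let fx∈ , _ , vfx = to′ x∈ in
    ∈-filter⁺ (nonzero? v) fx∈ (λ z → proj₂ (∈-filter⁻ (nonzero? u) {xs = xs} x∈) (trans (sym vfx) z))
  onto : ∀ {y} → y ∈ ys′ → y ∈ map f xs′
  onto {y} y∈ = let y∈ys , vy≢0 = ∈-filter⁻ (nonzero? v) {xs = ys} y∈
                    gy∈ , fgy , ugy = from y∈ys vy≢0
    in subst (_∈ map f xs′) fgy (∈-map⁺ f (∈-filter⁺ (nonzero? u) gy∈ (λ z → vy≢0 (trans (sym ugy) z))))

-- A graded set with finite fibres. Identities between series are obtained from bijections that
-- respect the grading; the duplicate-free enumerations make the coefficients finite sums.
record Family : Set₁ where
  field
    Index    : Set
    size     : Index → ℕ
    support  : ℕ → List Index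
    unique   : ∀ n → Unique (support n)
    sound    : ∀ {n x} → x ∈ support n → size x ≡ n
    complete : ∀ x → x ∈ support (size x)
open Family

gen : (F : Family) → (Index F → ℤ) → Series
gen F w n = sumOver (support F n) w

gf : Family → Series
gf F = gen F (λ _ → + 1)

complete′ : ∀ F {x n} → size F x ≡ n → x ∈ support F n
complete′ F {x} refl = complete F x

gen-reindex : ∀ F G u v n m (f : Index F → Index G) (g : Index G → Index F) →
  (∀ x → size F x ≡ n → u x ≢ + 0 → size G (f x) ≡ m × g (f x) ≡ x × v (f x) ≡ u x) →
  (∀ y → size G y ≡ m → v y ≢ + 0 → size F (g y) ≡ n × f (g y) ≡ y × u (g y) ≡ v y) →
  gen F u n ≡ gen G v m
gen-reindex F G u v n m f g to from = sumOver-reindex u v f g (unique F n) (unique G m)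
  (λ {x} x∈ ux → let s , r = to x (sound F x∈) ux in complete′ G s , r)
  (λ {y} y∈ vy → let s , r = from y (sound G y∈) vy in complete′ F s , r)

gen-cong-at : ∀ F {u v} n → (∀ x → size F x ≡ n → u x ≡ v x) → gen F u n ≡ gen F v n
gen-cong-at F n p = sumOver-cong (support F n) (λ {x} x∈ → p x (sound F x∈))

gen-cong : ∀ F {u v} → (∀ x → u x ≡ v x) → gen F u ≈ gen F v
gen-cong F p = pointwise λ n → gen-cong-at F n (λ x _ → p x)

gen-+ : ∀ F u v → gen F (λ x → u x +ᶻ v x) ≈ gen F u +ˢ gen F v
gen-+ F u v = pointwise λ n → sumOver-+ (support F n) u v

gen-* : ∀ F c w → gen F (λ x → c *ᶻ w x) ≈ const c *ˢ gen F w
gen-* F c w = pointwise λ n → trans (sumOver-* c (support F n) w) (sym (const-*ˢ-at n c (gen F w)))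

gen-empty : ∀ F w n → (∀ x → size F x ≢ n) → gen F w n ≡ + 0
gen-empty F w n e with support F n in eq
... | []     = refl
... | x ∷ xs = ⊥-elim (e x (sound F (subst (x ∈_) (sym eq) (here refl))))

record _≅_ (F G : Family) : Set where
  field
    to      : Index F → Index G
    from    : Index G → Index F
    size-to : ∀ x → size G (to x) ≡ size F x
    from-to : ∀ x → from (to x) ≡ x
    to-from : ∀ y → to (from y) ≡ y

module _ {F G} (i : F ≅ G) where
  open _≅_ i

  gen-≅ : ∀ w → gen F (w ∘ to) ≈ gen G w
  gen-≅ w = pointwise λ n → gen-reindex F G (w ∘ to) w n n to from
    (λ x s _ → trans (size-to x) s , from-to x , refl)
    (λ y s _ → trans (trans (sym (size-to (from y))) (cong (size G) (to-from y))) s , to-from y , cong w (to-from y))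

  gf-≅ : gf F ≈ gf G
  gf-≅ = gen-≅ (λ _ → + 1)

-- Constructions of families

finitely : (A : Set) (e : A → ℕ) (box : ℕ → List A) → (∀ n → Unique (box n)) → (∀ x → x ∈ box (e x)) → Family
finitely A e box u c = record
  { Index    = A
  ; size     = e
  ; support  = λ n → filter (λ x → e x ≟ n) (box n)
  ; unique   = λ n → Unique.filter⁺ (λ x → e x ≟ n) (u n)
  ; sound    = λ {n} x∈ → proj₂ (∈-filter⁻ (λ x → e x ≟ n) {xs = box n} x∈)
  ; complete = λ x → ∈-filter⁺ (λ y → e y ≟ e x) (c x) refl }

overℕ : (e : ℕ → ℕ) → (∀ i → i ≤ e i) → Family
overℕ e b = finitely ℕ e (upTo ∘ suc) (Unique.upTo⁺ ∘ suc) (λ i → ∈-upTo⁺ (s≤s (b i)))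

interval : ℕ → List ℤ
interval n = map +_ (upTo (suc n)) ++ map -[1+_] (upTo n)

interval-unique : ∀ n → Unique (interval n)
interval-unique n = Unique.++⁺ (Unique.map⁺ ℤₚ.+-injective (Unique.upTo⁺ (suc n))) (Unique.map⁺ ℤₚ.-[1+-injective (Unique.upTo⁺ n)) disjoint
  where
  disjoint : ∀ {x} → ¬ (x ∈ map +_ (upTo (suc n)) × x ∈ map -[1+_] (upTo n))
  disjoint (p , q) with ∈-map⁻ +_ p | ∈-map⁻ -[1+_] q
  ... | _ , _ , refl | _ , _ , ()

∈-interval : ∀ i n → ℤ.∣ i ∣ ≤ n → i ∈ interval n
∈-interval (+ m)    n p = ∈-++⁺ˡ (∈-map⁺ +_ (∈-upTo⁺ (s≤s p)))
∈-interval -[1+ m ] n p = ∈-++⁺ʳ (map +_ (upTo (suc n))) (∈-map⁺ -[1+_] (∈-upTo⁺ p))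

overℤ : (e : ℤ → ℕ) → (∀ i → ℤ.∣ i ∣ ≤ e i) → Family
overℤ e b = finitely ℤ e interval interval-unique (λ i → ∈-interval i (e i) (b i))

-- The enumeration follows the recursion of `_*ˢ_`, so that `gen-⊗` is a single induction without
-- any rearrangement of sums.
prodSupport : (ℕ → List A) → (ℕ → List B) → ℕ → List (A × B)
prodSupport s t zero    = cartesianProduct (s 0) (t 0)
prodSupport s t (suc n) = cartesianProduct (s 0) (t (suc n)) ++ prodSupport (s ∘ suc) t n

∈-prodSupport⁻ : ∀ (s : ℕ → List A) (t : ℕ → List B) n {x y} → (x , y) ∈ prodSupport s t n → ∃ λ k → ∃ λ l → k + l ≡ n × x ∈ s k × y ∈ t l
∈-prodSupport⁻ s t zero p = let x∈ , y∈ = ∈-cartesianProduct⁻ (s 0) (t 0) p in 0 , 0 , refl , x∈ , y∈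
∈-prodSupport⁻ s t (suc n) p with ∈-++⁻ (cartesianProduct (s 0) (t (suc n))) p
... | inj₁ q = let x∈ , y∈ = ∈-cartesianProduct⁻ (s 0) (t (suc n)) q in 0 , suc n , refl , x∈ , y∈
... | inj₂ q = let k , l , eq , x∈ , y∈ = ∈-prodSupport⁻ (s ∘ suc) t n q in suc k , l , cong suc eq , x∈ , y∈

∈-prodSupport⁺ : ∀ (s : ℕ → List A) (t : ℕ → List B) k l {x y} → x ∈ s k → y ∈ t l → (x , y) ∈ prodSupport s t (k + l)
∈-prodSupport⁺ s t zero    zero    x∈ y∈ = ∈-cartesianProduct⁺ x∈ y∈
∈-prodSupport⁺ s t zero    (suc l) x∈ y∈ = ∈-++⁺ˡ (∈-cartesianProduct⁺ x∈ y∈)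
∈-prodSupport⁺ s t (suc k) l       x∈ y∈ = ∈-++⁺ʳ (cartesianProduct (s 0) (t (suc (k + l)))) (∈-prodSupport⁺ (s ∘ suc) t k l x∈ y∈)

prodSupport-unique : ∀ (s : ℕ → List A) (t : ℕ → List B) n → (∀ k → Unique (s k)) → (∀ k → Unique (t k)) →
  (∀ {x k l} → x ∈ s k → x ∈ s l → k ≡ l) → Unique (prodSupport s t n)
prodSupport-unique s t zero    us ut d = Unique.cartesianProduct⁺ (us 0) (ut 0)
prodSupport-unique s t (suc n) us ut d = Unique.++⁺ (Unique.cartesianProduct⁺ (us 0) (ut (suc n)))
  (prodSupport-unique (s ∘ suc) t n (us ∘ suc) ut (λ p q → ℕₚ.suc-injective (d p q)))
  λ { {x , y} (p , q) → let k , l , _ , x∈k , _ = ∈-prodSupport⁻ (s ∘ suc) t n q in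
        contradiction (d (proj₁ (∈-cartesianProduct⁻ (s 0) (t (suc n)) p)) x∈k) λ () }

infixr 7 _⊗_
_⊗_ : Family → Family → Family
F ⊗ G = record
  { Index    = Index F × Index G
  ; size     = λ (x , y) → size F x + size G y
  ; support  = prodSupport (support F) (support G)
  ; unique   = λ n → prodSupport-unique (support F) (support G) n (unique F) (unique G) (λ p q → trans (sym (sound F p)) (sound F q))
  ; sound    = λ {n} p → let k , l , eq , x∈ , y∈ = ∈-prodSupport⁻ (support F) (support G) n p in
                 trans (cong₂ _+_ (sound F x∈) (sound G y∈)) eq
  ; complete = λ (x , y) → ∈-prodSupport⁺ (support F) (support G) (size F x) (size G y) (complete F x) (complete G y) }

gen-⊗ : ∀ F G u v → gen (F ⊗ G) (λ (x , y) → u x *ᶻ v y) ≈ gen F u *ˢ gen G v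
gen-⊗ F G u v = pointwise λ n → go n (support F) (support G)
  where
  go : ∀ n s t → sumOver (prodSupport s t n) (λ (x , y) → u x *ᶻ v y) ≡ ((λ k → sumOver (s k) u) *ˢ (λ k → sumOver (t k) v)) n
  go zero    s t = sumOver-×-* (s 0) (t 0) u v
  go (suc n) s t = trans (sumOver-++ (cartesianProduct (s 0) (t (suc n))) (prodSupport (s ∘ suc) t n) (λ (x , y) → u x *ᶻ v y))
    (cong₂ _+ᶻ_ (sumOver-×-* (s 0) (t (suc n)) u v) (go n (s ∘ suc) t))

gf-⊗ : ∀ F G → gf (F ⊗ G) ≈ gf F *ˢ gf G
gf-⊗ F G = gen-⊗ F G (λ _ → + 1) (λ _ → + 1)

infixr 6 _⊞_
_⊞_ : Family → Family → Family
F ⊞ G = record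
  { Index    = Index F ⊎ Index G
  ; size     = λ { (inj₁ x) → size F x ; (inj₂ y) → size G y }
  ; support  = λ n → map inj₁ (support F n) ++ map inj₂ (support G n)
  ; unique   = λ n → Unique.++⁺ (Unique.map⁺ (λ { refl → refl }) (unique F n)) (Unique.map⁺ (λ { refl → refl }) (unique G n)) (disjoint n)
  ; sound    = λ {n} → sound′ n
  ; complete = λ { (inj₁ x) → ∈-++⁺ˡ (∈-map⁺ inj₁ (complete F x))
                 ; (inj₂ y) → ∈-++⁺ʳ (map inj₁ (support F (size G y))) (∈-map⁺ inj₂ (complete G y)) } }
  where
  disjoint : ∀ n {z} → ¬ (z ∈ map inj₁ (support F n) × z ∈ map inj₂ (support G n))
  disjoint n (p , q) with ∈-map⁻ inj₁ p | ∈-map⁻ inj₂ q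
  ... | _ , _ , refl | _ , _ , ()
  sound′ : ∀ n {z} → z ∈ map inj₁ (support F n) ++ map inj₂ (support G n) → _ ≡ n
  sound′ n p with ∈-++⁻ (map inj₁ (support F n)) p
  ... | inj₁ q with ∈-map⁻ inj₁ q
  ...   | _ , x∈ , refl = sound F x∈
  sound′ n p | inj₂ q with ∈-map⁻ inj₂ q
  ...   | _ , y∈ , refl = sound G y∈

gen-⊞ : ∀ F G w → gen (F ⊞ G) w ≈ gen F (w ∘ inj₁) +ˢ gen G (w ∘ inj₂)
gen-⊞ F G w = pointwise λ n → trans (sumOver-++ (map inj₁ (support F n)) (map inj₂ (support G n)) w)
  (cong₂ _+ᶻ_ (sumOver-map inj₁ (support F n) w) (sumOver-map inj₂ (support G n) w))

gf-⊞ : ∀ F G → gf (F ⊞ G) ≈ gf F +ˢ gf G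
gf-⊞ F G = gen-⊞ F G (λ _ → + 1)

shift : Family → Family
shift F = record
  { Index = Index F ; size = suc ∘ size F ; support = s
  ; unique = λ { zero → [] ; (suc n) → unique F n }
  ; sound = λ { {suc n} p → cong suc (sound F p) }
  ; complete = complete F }
  where
  s : ℕ → List (Index F)
  s zero    = []
  s (suc n) = support F n

gf-shift : ∀ F → gf (shift F) ≈ X *ˢ gf F
gf-shift F = pointwise λ { zero → refl ; (suc n) → sym (X-*ˢ-suc (gf F) n) }

spread2 : (ℕ → List A) → ℕ → List A
spread2 t zero = t 0
spread2 t (suc zero) = []
spread2 t (suc (suc n)) = spread2 (t ∘ suc) n

dilate2 : Family → Family
dilate2 F = record
  { Index = Index F ; size = λ x → size F x * 2 ; support = spread2 (support F)
  ; unique = λ n → s-unique n (support F) (unique F)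
  ; sound = λ {n} p → let k , eq , x∈ = s⁻ n (support F) p in trans (cong (_* 2) (sound F x∈)) eq
  ; complete = λ x → s⁺ (size F x) (support F) (complete F x) }
  where
  s-unique : ∀ n t → (∀ n → Unique (t n)) → Unique (spread2 t n)
  s-unique zero t u = u 0
  s-unique (suc zero) t u = []
  s-unique (suc (suc n)) t u = s-unique n (t ∘ suc) (u ∘ suc)
  s⁻ : ∀ n t {x} → x ∈ spread2 t n → ∃ λ k → k * 2 ≡ n × x ∈ t k
  s⁻ zero t p = 0 , refl , p
  s⁻ (suc (suc n)) t p = let k , eq , x∈ = s⁻ n (t ∘ suc) p in suc k , cong (λ m → suc (suc m)) eq , x∈
  s⁺ : ∀ k t {x} → x ∈ t k → x ∈ spread2 t (k * 2)
  s⁺ zero    t p = p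
  s⁺ (suc k) t p = s⁺ k (t ∘ suc) p

gen-dilate2 : ∀ F w → gen (dilate2 F) w ≈ d2 (gen F w)
gen-dilate2 F w = pointwise λ n → go n (support F)
  where
  go : ∀ n t → sumOver (spread2 t n) w ≡ d2 (λ m → sumOver (t m) w) n
  go zero t = refl
  go (suc zero) t = refl
  go (suc (suc n)) t = go n (t ∘ suc)

spread3 : (ℕ → List A) → ℕ → List A
spread3 t zero = t 0
spread3 t (suc zero) = []
spread3 t (suc (suc zero)) = []
spread3 t (suc (suc (suc n))) = spread3 (t ∘ suc) n

dilate3 : Family → Family
dilate3 F = record
  { Index = Index F ; size = λ x → size F x * 3 ; support = spread3 (support F)
  ; unique = λ n → s-unique n (support F) (unique F)
  ; sound = λ {n} p → let k , eq , x∈ = s⁻ n (support F) p in trans (cong (_* 3) (sound F x∈)) eq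
  ; complete = λ x → s⁺ (size F x) (support F) (complete F x) }
  where
  s-unique : ∀ n t → (∀ n → Unique (t n)) → Unique (spread3 t n)
  s-unique zero t u = u 0
  s-unique (suc zero) t u = []
  s-unique (suc (suc zero)) t u = []
  s-unique (suc (suc (suc n))) t u = s-unique n (t ∘ suc) (u ∘ suc)
  s⁻ : ∀ n t {x} → x ∈ spread3 t n → ∃ λ k → k * 3 ≡ n × x ∈ t k
  s⁻ zero t p = 0 , refl , p
  s⁻ (suc (suc (suc n))) t p = let k , eq , x∈ = s⁻ n (t ∘ suc) p in suc k , cong (λ m → suc (suc (suc m))) eq , x∈
  s⁺ : ∀ k t {x} → x ∈ t k → x ∈ spread3 t (k * 3)
  s⁺ zero    t p = p
  s⁺ (suc k) t p = s⁺ k (t ∘ suc) p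

gen-dilate3 : ∀ F w → gen (dilate3 F) w ≈ d3 (gen F w)
gen-dilate3 F w = pointwise λ n → go n (support F)
  where
  go : ∀ n t → sumOver (spread3 t n) w ≡ d3 (λ m → sumOver (t m) w) n
  go zero t = refl
  go (suc zero) t = refl
  go (suc (suc zero)) t = refl
  go (suc (suc (suc n))) t = go n (t ∘ suc)

-- Gives x the multiplicity `k x`. In Liouville's identity the labels over a divisor are the ways to
-- split it into two positive summands.
labelled : (F : Family) → (Index F → ℕ) → Family
labelled F k = record
  { Index    = Σ (Index F) (Fin ∘ k)
  ; size     = size F ∘ proj₁
  ; support  = λ n → concatMap labels (support F n)
  ; unique   = λ n → labels-unique (unique F n)
  ; sound    = λ {n} p → let x , x∈ , q = labels⁻ (support F n) p in trans (cong (size F) q) (sound F x∈)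
  ; complete = λ (x , l) → labels⁺ (complete F x) }
  where
  labels : (x : Index F) → List (Σ (Index F) (Fin ∘ k))
  labels x = map (x ,_) (allFin (k x))
  labels⁻ : ∀ xs {z} → z ∈ concatMap labels xs → ∃ λ x → x ∈ xs × proj₁ z ≡ x
  labels⁻ (x ∷ xs) p with ∈-++⁻ (labels x) p
  ... | inj₁ q with ∈-map⁻ (x ,_) q
  ...   | _ , _ , refl = x , here refl , refl
  labels⁻ (x ∷ xs) p | inj₂ q = let y , y∈ , r = labels⁻ xs q in y , there y∈ , r
  labels⁺ : ∀ {xs x} {l : Fin (k x)} → x ∈ xs → (x , l) ∈ concatMap labels xs
  labels⁺ {l = l} (here refl) = ∈-++⁺ˡ (∈-map⁺ _ (∈-allFin l))
  labels⁺ {y ∷ _} (there x∈)  = ∈-++⁺ʳ (labels y) (labels⁺ x∈)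
  labels-unique : ∀ {xs} → Unique xs → Unique (concatMap labels xs)
  labels-unique []                = []
  labels-unique {x ∷ xs} (x∉ ∷ u) = Unique.++⁺ (Unique.map⁺ (λ { refl → refl }) (Unique.allFin⁺ (k x))) (labels-unique u)
    λ (p , q) → let _ , _ , eq = ∈-map⁻ (x ,_) p ; _ , y∈ , eq′ = labels⁻ xs q in
      All.lookup x∉ y∈ (trans (sym (cong proj₁ eq)) eq′)

gen-labelled : ∀ F k w → gen (labelled F k) w ≈ gen F (λ x → sumOver (allFin (k x)) (λ l → w (x , l)))
gen-labelled F k w = pointwise λ n → trans (sumOver-concatMap _ (support F n) w)
  (sumOver-cong (support F n) (λ {x} _ → sumOver-map (x ,_) (allFin (k x)) w))

-- Theta functions

sq tri : ℕ → ℕ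
sq n = n * n
tri zero    = 0
tri (suc n) = suc n + tri n

-- `triℤ j` is j(j + 1)/2 for every integer j. The reflection j ↦ -1 - j preserves it, so every
-- triangular number is taken exactly twice.
sqℤ triℤ : ℤ → ℕ
sqℤ i = sq ℤ.∣ i ∣
triℤ (+ n)    = tri n
triℤ -[1+ n ] = tri n

n≤sq : ∀ n → n ≤ sq n
n≤sq zero    = z≤n
n≤sq (suc n) = ℕₚ.m≤m+n (suc n) (n * suc n)

n≤sq-suc : ∀ n → n ≤ sq (suc n)
n≤sq-suc n = ℕₚ.≤-trans (ℕₚ.n≤1+n n) (n≤sq (suc n))

n≤tri : ∀ n → n ≤ tri n
n≤tri zero    = z≤n
n≤tri (suc n) = ℕₚ.m≤m+n (suc n) (tri n)

∣j∣≤1+tri : ∀ j → ℤ.∣ j ∣ ≤ suc (triℤ j)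
∣j∣≤1+tri (+ n)    = ℕₚ.m≤n⇒m≤1+n (n≤tri n)
∣j∣≤1+tri -[1+ n ] = s≤s (n≤tri n)

+sq : ∀ i → + sqℤ i ≡ i *ᶻ i
+sq (+ n)    = ℤₚ.pos-* n n
+sq -[1+ n ] = refl

2*tri : ∀ n → tri n * 2 ≡ n * suc n
2*tri zero    = refl
2*tri (suc n) = trans (ℕₚ.*-distribʳ-+ 2 (suc n) (tri n)) (trans (cong (λ t → suc n * 2 + t) (2*tri n)) (lemma n))
  where
  lemma : ∀ n → suc n * 2 + n * suc n ≡ suc n * suc (suc n)
  lemma = ℕ-ring

+tri : ∀ j → + triℤ j *ᶻ + 2 ≡ j *ᶻ (j +ᶻ + 1)
+tri (+ n) = trans (sym (ℤₚ.pos-* (tri n) 2)) (trans (cong +_ (trans (2*tri n) (cong (n *_) (ℕₚ.+-comm 1 n)))) (ℤₚ.pos-* n (n + 1)))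
+tri -[1+ n ] = trans (sym (ℤₚ.pos-* (tri n) 2)) (trans (cong +_ (2*tri n)) (trans (ℤₚ.pos-* n (suc n)) (lemma (+ n))))
  where
  lemma : ∀ a → a *ᶻ (+ 1 +ᶻ a) ≡ (-ᶻ (+ 1 +ᶻ a)) *ᶻ (-ᶻ (+ 1 +ᶻ a) +ᶻ + 1)
  lemma = ℤ-ring

halve : ∀ {a b} → + a *ᶻ + 2 ≡ + b *ᶻ + 2 → a ≡ b
halve {a} {b} p = ℤₚ.+-injective (ℤₚ.*-cancelʳ-≡ (+ a) (+ b) (+ 2) p)

Squares Triangles Triangles⁺ Squares⁺ : Family
Squares    = overℤ sqℤ (λ i → n≤sq ℤ.∣ i ∣)
Squares⁺   = overℕ (sq ∘ suc) n≤sq-suc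
-- The size 0 is also attained at -1, which the interval of radius 0 misses; hence the radius n + 1.
Triangles  = finitely ℤ triℤ (interval ∘ suc) (interval-unique ∘ suc) (λ j → ∈-interval j (suc (triℤ j)) (∣j∣≤1+tri j))
Triangles⁺ = overℕ tri n≤tri

-- The two parts of ψ and φ off the multiples of 3; their exponents are n(3n+1)/2 and m(3m+2).
ThirdsOfTriangles ThirdsOfSquares : Family
ThirdsOfTriangles = overℤ (λ n → triℤ n + sqℤ n) (λ n → ℕₚ.≤-trans (n≤sq ℤ.∣ n ∣) (ℕₚ.m≤n+m (sqℤ n) (triℤ n)))
ThirdsOfSquares   = overℤ (λ m → triℤ m * 4 + sqℤ m) (λ m → ℕₚ.≤-trans (n≤sq ℤ.∣ m ∣) (ℕₚ.m≤n+m (sqℤ m) (triℤ m * 4)))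

Unit : Family
Unit = finitely ⊤ (λ _ → 0) (λ _ → tt ∷ []) (λ _ → [] ∷ []) (λ _ → here refl)

φ ψ S : Series
φ = gf Squares
ψ = gf Triangles⁺
S = gf Squares⁺

gf-Unit : gf Unit ≈ 1ˢ
gf-Unit = pointwise λ { zero → refl ; (suc n) → refl }

double : ∀ f → f +ˢ f ≈ const (+ 2) *ˢ f
double = solve 1 (λ f → f :+ f := con (+ 2) :* f) ≈-refl

const-cancel : ∀ c .{{_ : ℤ.NonZero c}} f g → const c *ˢ f ≈ const c *ˢ g → f ≈ g
const-cancel c f g p = pointwise λ n → ℤₚ.*-cancelˡ-≡ c (f n) (g n)
  (trans (sym (const-*ˢ-at n c f)) (trans (at p n) (const-*ˢ-at n c g)))

triangles-two-sided : gf Triangles ≈ const (+ 2) *ˢ ψ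
triangles-two-sided = ≈-trans (gf-≅ iso) (≈-trans (gf-⊞ Triangles⁺ Triangles⁺) (double ψ))
  where
  iso : Triangles ≅ (Triangles⁺ ⊞ Triangles⁺)
  iso = record
    { to = λ { (+ n) → inj₁ n ; -[1+ n ] → inj₂ n } ; from = λ { (inj₁ n) → + n ; (inj₂ n) → -[1+ n ] }
    ; size-to = λ { (+ n) → refl ; -[1+ n ] → refl } ; from-to = λ { (+ n) → refl ; -[1+ n ] → refl }
    ; to-from = λ { (inj₁ n) → refl ; (inj₂ n) → refl } }

φ≈1+2S : φ ≈ 1ˢ +ˢ const (+ 2) *ˢ S
φ≈1+2S = ≈-trans (gf-≅ iso) (≈-trans (gf-⊞ Unit (Squares⁺ ⊞ Squares⁺))
  (+ˢ-cong gf-Unit (≈-trans (gf-⊞ Squares⁺ Squares⁺) (double S))))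
  where
  iso : Squares ≅ (Unit ⊞ Squares⁺ ⊞ Squares⁺)
  iso = record
    { to = λ { (+ zero) → inj₁ tt ; (+ suc n) → inj₂ (inj₁ n) ; -[1+ n ] → inj₂ (inj₂ n) }
    ; from = λ { (inj₁ tt) → + 0 ; (inj₂ (inj₁ n)) → + suc n ; (inj₂ (inj₂ n)) → -[1+ n ] }
    ; size-to = λ { (+ zero) → refl ; (+ suc n) → refl ; -[1+ n ] → refl }
    ; from-to = λ { (+ zero) → refl ; (+ suc n) → refl ; -[1+ n ] → refl }
    ; to-from = λ { (inj₁ tt) → refl ; (inj₂ (inj₁ n)) → refl ; (inj₂ (inj₂ n)) → refl } }

-- Residues of integers modulo 2 and 3

halfℕ : ℕ → ℕ ⊎ ℕ
halfℕ zero          = inj₁ 0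
halfℕ (suc zero)    = inj₂ 0
halfℕ (suc (suc n)) with halfℕ n
... | inj₁ k = inj₁ (suc k)
... | inj₂ k = inj₂ (suc k)

unhalfℕ : ℕ ⊎ ℕ → ℕ
unhalfℕ (inj₁ k) = k * 2
unhalfℕ (inj₂ k) = suc (k * 2)

unhalf-half : ∀ n → unhalfℕ (halfℕ n) ≡ n
unhalf-half zero          = refl
unhalf-half (suc zero)    = refl
unhalf-half (suc (suc n)) with halfℕ n | unhalf-half n
... | inj₁ k | p = cong (suc ∘ suc) p
... | inj₂ k | p = cong (suc ∘ suc) p

half-even : ∀ k → halfℕ (k * 2) ≡ inj₁ k
half-even zero    = refl
half-even (suc k) rewrite half-even k = refl

half-odd : ∀ k → halfℕ (suc (k * 2)) ≡ inj₂ k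
half-odd zero    = refl
half-odd (suc k) rewrite half-odd k = refl

parity : ℤ → ℤ ⊎ ℤ
parity (+ n) with halfℕ n
... | inj₁ k = inj₁ (+ k)
... | inj₂ k = inj₂ (+ k)
parity -[1+ n ] with halfℕ n
... | inj₁ k = inj₂ -[1+ k ]
... | inj₂ k = inj₁ -[1+ k ]

unparity : ℤ ⊎ ℤ → ℤ
unparity (inj₁ i) = i *ᶻ + 2
unparity (inj₂ i) = i *ᶻ + 2 +ᶻ + 1

+-*-pos : ∀ k c → + k *ᶻ + c ≡ + (k * c)
+-*-pos k c = sym (ℤₚ.pos-* k c)

unparity-parity : ∀ i → unparity (parity i) ≡ i
unparity-parity (+ n) with halfℕ n | unhalf-half n
... | inj₁ k | refl = +-*-pos k 2
... | inj₂ k | refl = trans (cong (_+ᶻ + 1) (+-*-pos k 2)) (cong +_ (ℕₚ.+-comm (k * 2) 1))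
unparity-parity -[1+ n ] with halfℕ n | unhalf-half n
... | inj₁ k | refl = refl
... | inj₂ k | refl = refl

parity-unparity : ∀ x → parity (unparity x) ≡ x
parity-unparity (inj₁ (+ k)) rewrite +-*-pos k 2 | half-even k = refl
parity-unparity (inj₁ -[1+ k ]) rewrite half-odd k = refl
parity-unparity (inj₂ (+ k)) rewrite +-*-pos k 2 | ℕₚ.+-comm (k * 2) 1 | half-odd k = refl
parity-unparity (inj₂ -[1+ k ]) rewrite half-even k = refl

thirdℕ : ℕ → ℕ ⊎ ℕ ⊎ ℕ
thirdℕ zero                = inj₁ 0
thirdℕ (suc zero)          = inj₂ (inj₁ 0)
thirdℕ (suc (suc zero))    = inj₂ (inj₂ 0)
thirdℕ (suc (suc (suc n))) with thirdℕ n
... | inj₁ k        = inj₁ (suc k)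
... | inj₂ (inj₁ k) = inj₂ (inj₁ (suc k))
... | inj₂ (inj₂ k) = inj₂ (inj₂ (suc k))

unthirdℕ : ℕ ⊎ ℕ ⊎ ℕ → ℕ
unthirdℕ (inj₁ k)        = k * 3
unthirdℕ (inj₂ (inj₁ k)) = 1 + k * 3
unthirdℕ (inj₂ (inj₂ k)) = 2 + k * 3

unthird-third : ∀ n → unthirdℕ (thirdℕ n) ≡ n
unthird-third zero                = refl
unthird-third (suc zero)          = refl
unthird-third (suc (suc zero))    = refl
unthird-third (suc (suc (suc n))) with thirdℕ n | unthird-third n
... | inj₁ k        | p = cong (suc ∘ suc ∘ suc) p
... | inj₂ (inj₁ k) | p = cong (suc ∘ suc ∘ suc) p
... | inj₂ (inj₂ k) | p = cong (suc ∘ suc ∘ suc) p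

third-0 : ∀ k → thirdℕ (k * 3) ≡ inj₁ k
third-0 zero    = refl
third-0 (suc k) rewrite third-0 k = refl

third-1 : ∀ k → thirdℕ (1 + k * 3) ≡ inj₂ (inj₁ k)
third-1 zero    = refl
third-1 (suc k) rewrite third-1 k = refl

third-2 : ∀ k → thirdℕ (2 + k * 3) ≡ inj₂ (inj₂ k)
third-2 zero    = refl
third-2 (suc k) rewrite third-2 k = refl

-- The residue class 2 modulo 3 is described as that of −(3m + 1).
residue₃ : ℤ → ℤ ⊎ ℤ ⊎ ℤ
residue₃ (+ n) with thirdℕ n
... | inj₁ k        = inj₁ (+ k)
... | inj₂ (inj₁ k) = inj₂ (inj₁ (+ k))
... | inj₂ (inj₂ k) = inj₂ (inj₂ -[1+ k ])
residue₃ -[1+ n ] with thirdℕ n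
... | inj₁ k        = inj₂ (inj₂ (+ k))
... | inj₂ (inj₁ k) = inj₂ (inj₁ -[1+ k ])
... | inj₂ (inj₂ k) = inj₁ -[1+ k ]

unresidue₃ : ℤ ⊎ ℤ ⊎ ℤ → ℤ
unresidue₃ (inj₁ i)        = i *ᶻ + 3
unresidue₃ (inj₂ (inj₁ i)) = i *ᶻ + 3 +ᶻ + 1
unresidue₃ (inj₂ (inj₂ i)) = -ᶻ (i *ᶻ + 3 +ᶻ + 1)

unresidue-residue : ∀ i → unresidue₃ (residue₃ i) ≡ i
unresidue-residue (+ n) with thirdℕ n | unthird-third n
... | inj₁ k        | refl = +-*-pos k 3
... | inj₂ (inj₁ k) | refl = trans (cong (_+ᶻ + 1) (+-*-pos k 3)) (cong +_ (ℕₚ.+-comm (k * 3) 1))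
... | inj₂ (inj₂ k) | refl = refl
unresidue-residue -[1+ n ] with thirdℕ n | unthird-third n
... | inj₁ k        | refl = trans (cong (λ a → -ᶻ (a +ᶻ + 1)) (+-*-pos k 3)) (cong (λ a → -ᶻ (+ a)) (ℕₚ.+-comm (k * 3) 1))
... | inj₂ (inj₁ k) | refl = refl
... | inj₂ (inj₂ k) | refl = refl

residue-unresidue : ∀ x → residue₃ (unresidue₃ x) ≡ x
residue-unresidue (inj₁ (+ k)) rewrite +-*-pos k 3 | third-0 k = refl
residue-unresidue (inj₁ -[1+ k ]) rewrite third-2 k = refl
residue-unresidue (inj₂ (inj₁ (+ k))) rewrite +-*-pos k 3 | ℕₚ.+-comm (k * 3) 1 | third-1 k = refl
residue-unresidue (inj₂ (inj₁ -[1+ k ])) rewrite third-1 k = refl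
residue-unresidue (inj₂ (inj₂ (+ k))) rewrite +-*-pos k 3 | ℕₚ.+-comm (k * 3) 1 | third-0 k = refl
residue-unresidue (inj₂ (inj₂ -[1+ k ])) rewrite third-2 k = refl

-- Theta identities from substitutions of lattice points

infixl 6 _⊕_
infixl 7 _⊙_

-- Doubling clears the denominators of the triangular numbers, so that sizes compare by polynomial identities.
record Twice (a : ℕ) (x : ℤ) : Set where
  constructor twice
  field untwice : + a *ᶻ + 2 ≡ x
open Twice

_⊕_ : ∀ {a b x y} → Twice a x → Twice b y → Twice (a + b) (x +ᶻ y)
_⊕_ {a} {b} (twice p) (twice q) = twice (trans (ℤₚ.*-distribʳ-+ (+ 2) (+ a) (+ b)) (cong₂ _+ᶻ_ p q))

_⊙_ : ∀ {a x} → Twice a x → ∀ c → Twice (a * c) (x *ᶻ + c)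
_⊙_ {a} {x} (twice p) c = twice (trans (cong (_*ᶻ + 2) (ℤₚ.pos-* a c)) (trans (lemma (+ a) (+ c)) (cong (_*ᶻ + c) p)))
  where
  lemma : ∀ a c → a *ᶻ c *ᶻ + 2 ≡ a *ᶻ + 2 *ᶻ c
  lemma = ℤ-ring

2sq : ∀ i → Twice (sqℤ i) (i *ᶻ i *ᶻ + 2)
2sq i = twice (cong (_*ᶻ + 2) (+sq i))

2tri′ : ∀ j → Twice (triℤ j) (j *ᶻ (j +ᶻ + 1))
2tri′ j = twice (+tri j)

one : ∀ n → Twice n (+ n *ᶻ + 2)
one n = twice refl

same : ∀ {a b x y} → Twice a x → x ≡ y → Twice b y → a ≡ b
same (twice p) e (twice q) = halve (trans p (trans e (sym q)))

mk≅ : ∀ {F G} (to : Index F → Index G) (from : Index G → Index F) →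
  (∀ x → from (to x) ≡ x) → (∀ y → to (from y) ≡ y) → (∀ y → size F (from y) ≡ size G y) → F ≅ G
mk≅ {F} to from from-to to-from s = record
  { to = to ; from = from ; from-to = from-to ; to-from = to-from
  ; size-to = λ x → trans (sym (s (to x))) (cong (size F) (from-to x)) }

gf-dilate2 : ∀ F → gf (dilate2 F) ≈ d2 (gf F)
gf-dilate2 F = gen-dilate2 F (λ _ → + 1)

gf-dilate3 : ∀ F → gf (dilate3 F) ≈ d3 (gf F)
gf-dilate3 F = gen-dilate3 F (λ _ → + 1)

d2-2* : ∀ f → d2 (const (+ 2) *ˢ f) ≈ const (+ 2) *ˢ d2 f
d2-2* f = ≈-trans (d2-* (const (+ 2)) f) (*ˢ-cong (d2-const (+ 2)) ≈-refl)

d3-2* : ∀ f → d3 (const (+ 2) *ˢ f) ≈ const (+ 2) *ˢ d3 f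
d3-2* f = ≈-trans (d3-* (const (+ 2)) f) (*ˢ-cong (d3-const (+ 2)) ≈-refl)

-- φ(q) = φ(q⁴) + 2qψ(q⁸), since an odd square is (2l + 1)² = 1 + 8 · l(l + 1)/2.
φ-by-parity : φ ≈ d2 (d2 φ) +ˢ X *ˢ (const (+ 2) *ˢ d2 (d2 (d2 ψ)))
φ-by-parity = ≈-trans (gf-≅ iso) (≈-trans (gf-⊞ E (shift O)) (+ˢ-cong
  (≈-trans (gf-dilate2 (dilate2 Squares)) (d2-cong (gf-dilate2 Squares)))
  (≈-trans (gf-shift O) (*ˢ-cong ≈-refl (≈-trans (gf-dilate2 (dilate2 (dilate2 Triangles)))
    (≈-trans (d2-cong (≈-trans (gf-dilate2 (dilate2 Triangles)) (d2-cong (≈-trans (gf-dilate2 Triangles) (d2-cong triangles-two-sided)))))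
      (≈-trans (d2-cong (≈-trans (d2-cong (d2-2* ψ)) (d2-2* (d2 ψ)))) (d2-2* (d2 (d2 ψ))))))))))
  where
  E = dilate2 (dilate2 Squares)
  O = dilate2 (dilate2 (dilate2 Triangles))
  even : ∀ i → i *ᶻ + 2 *ᶻ (i *ᶻ + 2) *ᶻ + 2 ≡ i *ᶻ i *ᶻ + 2 *ᶻ + 2 *ᶻ + 2
  even = ℤ-ring
  odd : ∀ l → (l *ᶻ + 2 +ᶻ + 1) *ᶻ (l *ᶻ + 2 +ᶻ + 1) *ᶻ + 2 ≡ + 1 *ᶻ + 2 +ᶻ l *ᶻ (l +ᶻ + 1) *ᶻ + 2 *ᶻ + 2 *ᶻ + 2
  odd = ℤ-ring
  iso : Squares ≅ (E ⊞ shift O)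
  iso = mk≅ parity unparity unparity-parity parity-unparity
    λ { (inj₁ i) → same ((2sq (i *ᶻ + 2))) (even i) ((2sq i ⊙ 2 ⊙ 2))
      ; (inj₂ l) → same ((2sq (l *ᶻ + 2 +ᶻ + 1))) (odd l) ((one 1 ⊕ (2tri′ l ⊙ 2 ⊙ 2 ⊙ 2))) }

-- Σ q^(2a²+2b²) = Σ q^((a+b)²+(a−b)²), split by the parity of a + b.
d2-φ² : d2 (φ *ˢ φ) ≈ d2 (d2 φ) *ˢ d2 (d2 φ) +ˢ X *ˢ (X *ˢ d2 (d2 (d2 (const (+ 4) *ˢ (ψ *ˢ ψ)))))
d2-φ² = begin
  d2 (φ *ˢ φ)                                                        ≈⟨ d2-cong (gf-⊗ Squares Squares) ⟨
  d2 (gf (Squares ⊗ Squares))                                        ≈⟨ gf-dilate2 (Squares ⊗ Squares) ⟨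
  gf (dilate2 (Squares ⊗ Squares))                                   ≈⟨ gf-≅ iso ⟩
  gf (E ⊗ E ⊞ shift (shift O))                                       ≈⟨ gf-⊞ (E ⊗ E) (shift (shift O)) ⟩
  gf (E ⊗ E) +ˢ gf (shift (shift O))                                 ≈⟨ +ˢ-cong (≈-trans (gf-⊗ E E) (*ˢ-cong gfE gfE))
    (≈-trans (gf-shift (shift O)) (*ˢ-cong ≈-refl (≈-trans (gf-shift O) (*ˢ-cong ≈-refl gfO)))) ⟩
  d2 (d2 φ) *ˢ d2 (d2 φ) +ˢ X *ˢ (X *ˢ d2 (d2 (d2 (const (+ 4) *ˢ (ψ *ˢ ψ))))) ∎
  where
  open ≈-Reasoning
  E = dilate2 (dilate2 Squares)
  O = dilate2 (dilate2 (dilate2 (Triangles ⊗ Triangles)))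
  gfE : gf E ≈ d2 (d2 φ)
  gfE = ≈-trans (gf-dilate2 (dilate2 Squares)) (d2-cong (gf-dilate2 Squares))
  gfO : gf O ≈ d2 (d2 (d2 (const (+ 4) *ˢ (ψ *ˢ ψ))))
  gfO = ≈-trans (gf-dilate2 (dilate2 (dilate2 (Triangles ⊗ Triangles)))) (d2-cong
    (≈-trans (gf-dilate2 (dilate2 (Triangles ⊗ Triangles))) (d2-cong
      (≈-trans (gf-dilate2 (Triangles ⊗ Triangles)) (d2-cong
        (≈-trans (gf-⊗ Triangles Triangles) (≈-trans (*ˢ-cong triangles-two-sided triangles-two-sided)
          (solve 1 (λ f → con (+ 2) :* f :* (con (+ 2) :* f) := con (+ 4) :* (f :* f)) ≈-refl ψ))))))))
  to : ℤ × ℤ → (ℤ × ℤ) ⊎ (ℤ × ℤ)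
  to (a , b) with parity (a +ᶻ b)
  ... | inj₁ i = inj₁ (i , i -ᶻ b)
  ... | inj₂ i = inj₂ (i , i -ᶻ b)
  from : (ℤ × ℤ) ⊎ (ℤ × ℤ) → ℤ × ℤ
  from (inj₁ (i , c)) = i +ᶻ c , i -ᶻ c
  from (inj₂ (i , c)) = i +ᶻ c +ᶻ + 1 , i -ᶻ c
  e₁ : ∀ i b → i +ᶻ (i -ᶻ b) ≡ i *ᶻ + 2 -ᶻ b
  e₁ = ℤ-ring
  e₂ : ∀ i b → i -ᶻ (i -ᶻ b) ≡ b
  e₂ = ℤ-ring
  e₃ : ∀ a b → a +ᶻ b -ᶻ b ≡ a
  e₃ = ℤ-ring
  e₄ : ∀ i b → i +ᶻ (i -ᶻ b) +ᶻ + 1 ≡ i *ᶻ + 2 +ᶻ + 1 -ᶻ b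
  e₄ = ℤ-ring
  e₅ : ∀ i c → i +ᶻ c +ᶻ (i -ᶻ c) ≡ i *ᶻ + 2
  e₅ = ℤ-ring
  e₆ : ∀ i c → i +ᶻ c +ᶻ + 1 +ᶻ (i -ᶻ c) ≡ i *ᶻ + 2 +ᶻ + 1
  e₆ = ℤ-ring
  from-to : ∀ x → from (to x) ≡ x
  from-to (a , b) with parity (a +ᶻ b) | unparity-parity (a +ᶻ b)
  ... | inj₁ i | p = cong₂ _,_ (trans (e₁ i b) (trans (cong (_-ᶻ b) p) (e₃ a b))) (e₂ i b)
  ... | inj₂ i | p = cong₂ _,_ (trans (e₄ i b) (trans (cong (_-ᶻ b) p) (e₃ a b))) (e₂ i b)
  to-from : ∀ y → to (from y) ≡ y
  to-from (inj₁ (i , c)) rewrite e₅ i c | parity-unparity (inj₁ i) = cong (λ d → inj₁ (i , d)) (e₂ i c)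
  to-from (inj₂ (i , c)) rewrite e₆ i c | parity-unparity (inj₂ i) = cong (λ d → inj₂ (i , d)) (e₂ i c)
  s₁ : ∀ i c → ((i +ᶻ c) *ᶻ (i +ᶻ c) *ᶻ + 2 +ᶻ (i -ᶻ c) *ᶻ (i -ᶻ c) *ᶻ + 2) *ᶻ + 2
             ≡ i *ᶻ i *ᶻ + 2 *ᶻ + 2 *ᶻ + 2 +ᶻ c *ᶻ c *ᶻ + 2 *ᶻ + 2 *ᶻ + 2
  s₁ = ℤ-ring
  s₂ : ∀ i c → ((i +ᶻ c +ᶻ + 1) *ᶻ (i +ᶻ c +ᶻ + 1) *ᶻ + 2 +ᶻ (i -ᶻ c) *ᶻ (i -ᶻ c) *ᶻ + 2) *ᶻ + 2
             ≡ + 2 *ᶻ + 2 +ᶻ (i *ᶻ (i +ᶻ + 1) +ᶻ c *ᶻ (c +ᶻ + 1)) *ᶻ + 2 *ᶻ + 2 *ᶻ + 2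
  s₂ = ℤ-ring
  iso : dilate2 (Squares ⊗ Squares) ≅ (E ⊗ E ⊞ shift (shift O))
  iso = mk≅ to from from-to to-from
    λ { (inj₁ (i , c)) → same (((2sq (i +ᶻ c) ⊕ 2sq (i -ᶻ c)) ⊙ 2)) (s₁ i c) ((2sq i ⊙ 2 ⊙ 2 ⊕ 2sq c ⊙ 2 ⊙ 2))
      ; (inj₂ (i , c)) → same (((2sq (i +ᶻ c +ᶻ + 1) ⊕ 2sq (i -ᶻ c)) ⊙ 2)) (s₂ i c) ((one 2 ⊕ ((2tri′ i ⊕ 2tri′ c) ⊙ 2 ⊙ 2 ⊙ 2))) }

-- Over all integers, a pair (j, k) with j - k = 2i has the form (l + i, l - i), and its triangular
-- numbers add up to i² + l(l + 1). The reflection k ↦ -1 - k carries the pairs of odd difference to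
-- those of even difference, hence two equal copies of `G`.
ψ² : ψ *ˢ ψ ≈ φ *ˢ d2 ψ
ψ² = const-cancel (+ 4) _ _ (begin
  const (+ 4) *ˢ (ψ *ˢ ψ)                            ≈⟨ solve 1 (λ f → con (+ 4) :* (f :* f) := con (+ 2) :* f :* (con (+ 2) :* f)) ≈-refl ψ ⟩
  const (+ 2) *ˢ ψ *ˢ (const (+ 2) *ˢ ψ)             ≈⟨ *ˢ-cong triangles-two-sided triangles-two-sided ⟨
  gf Triangles *ˢ gf Triangles                       ≈⟨ gf-⊗ Triangles Triangles ⟨
  gf (Triangles ⊗ Triangles)                         ≈⟨ gf-≅ iso ⟩
  gf (G ⊞ G)                                         ≈⟨ ≈-trans (gf-⊞ G G) (double (gf G)) ⟩
  const (+ 2) *ˢ gf G                                ≈⟨ *ˢ-cong ≈-refl (≈-trans (gf-⊗ Squares (dilate2 Triangles)) (*ˢ-cong ≈-refl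
     (≈-trans (gf-dilate2 Triangles) (≈-trans (d2-cong triangles-two-sided) (d2-2* ψ))))) ⟩
  const (+ 2) *ˢ (φ *ˢ (const (+ 2) *ˢ d2 ψ))        ≈⟨ solve 2 (λ f g → con (+ 2) :* (f :* (con (+ 2) :* g)) := con (+ 4) :* (f :* g)) ≈-refl φ (d2 ψ) ⟩
  const (+ 4) *ˢ (φ *ˢ d2 ψ)                         ∎)
  where
  open ≈-Reasoning
  G = Squares ⊗ dilate2 Triangles
  to : ℤ × ℤ → (ℤ × ℤ) ⊎ (ℤ × ℤ)
  to (j , k) with parity (j -ᶻ k)
  ... | inj₁ i = inj₁ (i , k +ᶻ i)
  ... | inj₂ l = inj₂ (k +ᶻ l +ᶻ + 1 , l)
  from : (ℤ × ℤ) ⊎ (ℤ × ℤ) → ℤ × ℤ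
  from (inj₁ (i , l)) = l +ᶻ i , l -ᶻ i
  from (inj₂ (i , l)) = l +ᶻ i , i -ᶻ l -ᶻ + 1
  e₁ : ∀ i k → k +ᶻ i +ᶻ i ≡ i *ᶻ + 2 +ᶻ k
  e₁ = ℤ-ring
  e₂ : ∀ i k → k +ᶻ i -ᶻ i ≡ k
  e₂ = ℤ-ring
  e₃ : ∀ j k → j -ᶻ k +ᶻ k ≡ j
  e₃ = ℤ-ring
  e₄ : ∀ l k → l +ᶻ (k +ᶻ l +ᶻ + 1) ≡ l *ᶻ + 2 +ᶻ + 1 +ᶻ k
  e₄ = ℤ-ring
  e₅ : ∀ l k → k +ᶻ l +ᶻ + 1 -ᶻ l -ᶻ + 1 ≡ k
  e₅ = ℤ-ring
  e₆ : ∀ i l → l +ᶻ i -ᶻ (l -ᶻ i) ≡ i *ᶻ + 2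
  e₆ = ℤ-ring
  e₇ : ∀ i l → l -ᶻ i +ᶻ i ≡ l
  e₇ = ℤ-ring
  e₈ : ∀ i l → l +ᶻ i -ᶻ (i -ᶻ l -ᶻ + 1) ≡ l *ᶻ + 2 +ᶻ + 1
  e₈ = ℤ-ring
  e₉ : ∀ i l → i -ᶻ l -ᶻ + 1 +ᶻ l +ᶻ + 1 ≡ i
  e₉ = ℤ-ring
  from-to : ∀ x → from (to x) ≡ x
  from-to (j , k) with parity (j -ᶻ k) | unparity-parity (j -ᶻ k)
  ... | inj₁ i | p = cong₂ _,_ (trans (e₁ i k) (trans (cong (_+ᶻ k) p) (e₃ j k))) (e₂ i k)
  ... | inj₂ l | p = cong₂ _,_ (trans (e₄ l k) (trans (cong (_+ᶻ k) p) (e₃ j k))) (e₅ l k)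
  to-from : ∀ y → to (from y) ≡ y
  to-from (inj₁ (i , l)) rewrite e₆ i l | parity-unparity (inj₁ i) = cong (λ d → inj₁ (i , d)) (e₇ i l)
  to-from (inj₂ (i , l)) rewrite e₈ i l | parity-unparity (inj₂ l) = cong (λ d → inj₂ (d , l)) (e₉ i l)
  s₁ : ∀ i l → (l +ᶻ i) *ᶻ (l +ᶻ i +ᶻ + 1) +ᶻ (l -ᶻ i) *ᶻ (l -ᶻ i +ᶻ + 1) ≡ i *ᶻ i *ᶻ + 2 +ᶻ l *ᶻ (l +ᶻ + 1) *ᶻ + 2
  s₁ = ℤ-ring
  s₂ : ∀ i l → (l +ᶻ i) *ᶻ (l +ᶻ i +ᶻ + 1) +ᶻ (i -ᶻ l -ᶻ + 1) *ᶻ (i -ᶻ l -ᶻ + 1 +ᶻ + 1) ≡ i *ᶻ i *ᶻ + 2 +ᶻ l *ᶻ (l +ᶻ + 1) *ᶻ + 2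
  s₂ = ℤ-ring
  iso : (Triangles ⊗ Triangles) ≅ (G ⊞ G)
  iso = mk≅ to from from-to to-from
    λ { (inj₁ (i , l)) → same ((2tri′ (l +ᶻ i) ⊕ 2tri′ (l -ᶻ i))) (s₁ i l) ((2sq i ⊕ 2tri′ l ⊙ 2))
      ; (inj₂ (i , l)) → same ((2tri′ (l +ᶻ i) ⊕ 2tri′ (i -ᶻ l -ᶻ + 1))) (s₂ i l) ((2sq i ⊕ 2tri′ l ⊙ 2)) }

-- Dissections of ψ and φ modulo 3

A₃ B₃ : Series
A₃ = gf ThirdsOfTriangles
B₃ = gf ThirdsOfSquares

-- The reflection j ↦ -1 - j exchanges the residues 0 and 2 modulo 3, which share the series A₃(q³),
-- and preserves the residue 1, where T(3k + 1) = 1 + 9T(k).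
ψ-by-residue : ψ ≈ d3 A₃ +ˢ X *ˢ d3 (d3 ψ)
ψ-by-residue = const-cancel (+ 2) _ _ (begin
  const (+ 2) *ˢ ψ                                      ≈⟨ triangles-two-sided ⟨
  gf Triangles                                          ≈⟨ gf-≅ iso ⟩
  gf (T ⊞ shift O ⊞ T)                                  ≈⟨ ≈-trans (gf-⊞ T (shift O ⊞ T)) (+ˢ-cong (gf-dilate3 ThirdsOfTriangles)
      (≈-trans (gf-⊞ (shift O) T) (+ˢ-cong (≈-trans (gf-shift O) (*ˢ-cong ≈-refl gfO)) (gf-dilate3 ThirdsOfTriangles)))) ⟩
  d3 A₃ +ˢ (X *ˢ (const (+ 2) *ˢ d3 (d3 ψ)) +ˢ d3 A₃)   ≈⟨ solve 3 (λ a x f → a :+ (x :* (con (+ 2) :* f) :+ a) := con (+ 2) :* (a :+ x :* f)) ≈-refl (d3 A₃) X (d3 (d3 ψ)) ⟩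
  const (+ 2) *ˢ (d3 A₃ +ˢ X *ˢ d3 (d3 ψ))              ∎)
  where
  open ≈-Reasoning
  T = dilate3 ThirdsOfTriangles
  O = dilate3 (dilate3 Triangles)
  gfO : gf O ≈ const (+ 2) *ˢ d3 (d3 ψ)
  gfO = ≈-trans (gf-dilate3 (dilate3 Triangles)) (≈-trans (d3-cong (≈-trans (gf-dilate3 Triangles) (≈-trans (d3-cong triangles-two-sided) (d3-2* ψ)))) (d3-2* (d3 ψ)))
  s₀ : ∀ n → n *ᶻ + 3 *ᶻ (n *ᶻ + 3 +ᶻ + 1) ≡ (n *ᶻ (n +ᶻ + 1) +ᶻ n *ᶻ n *ᶻ + 2) *ᶻ + 3
  s₀ = ℤ-ring
  s₁ : ∀ k → (k *ᶻ + 3 +ᶻ + 1) *ᶻ (k *ᶻ + 3 +ᶻ + 1 +ᶻ + 1) ≡ + 1 *ᶻ + 2 +ᶻ k *ᶻ (k +ᶻ + 1) *ᶻ + 3 *ᶻ + 3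
  s₁ = ℤ-ring
  s₂ : ∀ n → (-ᶻ (n *ᶻ + 3 +ᶻ + 1)) *ᶻ (-ᶻ (n *ᶻ + 3 +ᶻ + 1) +ᶻ + 1) ≡ (n *ᶻ (n +ᶻ + 1) +ᶻ n *ᶻ n *ᶻ + 2) *ᶻ + 3
  s₂ = ℤ-ring
  iso : Triangles ≅ (T ⊞ shift O ⊞ T)
  iso = mk≅ residue₃ unresidue₃ unresidue-residue residue-unresidue
    λ { (inj₁ n)        → same ((2tri′ (n *ᶻ + 3))) (s₀ n) (((2tri′ n ⊕ 2sq n) ⊙ 3))
      ; (inj₂ (inj₁ k)) → same ((2tri′ (k *ᶻ + 3 +ᶻ + 1))) (s₁ k) ((one 1 ⊕ (2tri′ k ⊙ 3 ⊙ 3)))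
      ; (inj₂ (inj₂ n)) → same ((2tri′ (-ᶻ (n *ᶻ + 3 +ᶻ + 1)))) (s₂ n) (((2tri′ n ⊕ 2sq n) ⊙ 3)) }

-- The two residues prime to 3 are exchanged by i ↦ -i, and (3m + 1)² = 1 + 3 · m(3m + 2).
φ-by-residue : φ ≈ d3 (d3 φ) +ˢ X *ˢ (const (+ 2) *ˢ d3 B₃)
φ-by-residue = begin
  φ                                                          ≈⟨ gf-≅ iso ⟩
  gf (Z ⊞ shift T ⊞ shift T)                                 ≈⟨ ≈-trans (gf-⊞ Z (shift T ⊞ shift T)) (+ˢ-cong
     (≈-trans (gf-dilate3 (dilate3 Squares)) (d3-cong (gf-dilate3 Squares)))
     (≈-trans (gf-⊞ (shift T) (shift T)) (+ˢ-cong gfT gfT))) ⟩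
  d3 (d3 φ) +ˢ (X *ˢ d3 B₃ +ˢ X *ˢ d3 B₃)                    ≈⟨ solve 3 (λ f x b → f :+ (x :* b :+ x :* b) := f :+ x :* (con (+ 2) :* b)) ≈-refl (d3 (d3 φ)) X (d3 B₃) ⟩
  d3 (d3 φ) +ˢ X *ˢ (const (+ 2) *ˢ d3 B₃)                   ∎
  where
  open ≈-Reasoning
  Z = dilate3 (dilate3 Squares)
  T = dilate3 ThirdsOfSquares
  gfT : gf (shift T) ≈ X *ˢ d3 B₃
  gfT = ≈-trans (gf-shift T) (*ˢ-cong ≈-refl (gf-dilate3 ThirdsOfSquares))
  s₀ : ∀ i → i *ᶻ + 3 *ᶻ (i *ᶻ + 3) *ᶻ + 2 ≡ i *ᶻ i *ᶻ + 2 *ᶻ + 3 *ᶻ + 3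
  s₀ = ℤ-ring
  s₁ : ∀ m → (m *ᶻ + 3 +ᶻ + 1) *ᶻ (m *ᶻ + 3 +ᶻ + 1) *ᶻ + 2 ≡ + 1 *ᶻ + 2 +ᶻ (m *ᶻ (m +ᶻ + 1) *ᶻ + 4 +ᶻ m *ᶻ m *ᶻ + 2) *ᶻ + 3
  s₁ = ℤ-ring
  s₂ : ∀ m → (-ᶻ (m *ᶻ + 3 +ᶻ + 1)) *ᶻ (-ᶻ (m *ᶻ + 3 +ᶻ + 1)) *ᶻ + 2 ≡ + 1 *ᶻ + 2 +ᶻ (m *ᶻ (m +ᶻ + 1) *ᶻ + 4 +ᶻ m *ᶻ m *ᶻ + 2) *ᶻ + 3
  s₂ = ℤ-ring
  iso : Squares ≅ (Z ⊞ shift T ⊞ shift T)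
  iso = mk≅ residue₃ unresidue₃ unresidue-residue residue-unresidue
    λ { (inj₁ i)        → same ((2sq (i *ᶻ + 3))) (s₀ i) ((2sq i ⊙ 3 ⊙ 3))
      ; (inj₂ (inj₁ m)) → same ((2sq (m *ᶻ + 3 +ᶻ + 1))) (s₁ m) ((one 1 ⊕ ((2tri′ m ⊙ 4 ⊕ 2sq m) ⊙ 3)))
      ; (inj₂ (inj₂ m)) → same ((2sq (-ᶻ (m *ᶻ + 3 +ᶻ + 1)))) (s₂ m) ((one 1 ⊕ ((2tri′ m ⊙ 4 ⊕ 2sq m) ⊙ 3))) }

-- Multiplication by 1 + √−2 carries the odd points (x, y) of x² + 2y² to the points (X, Y) of X² + 8Y² with 3 ∣ X + Y.
ψψ₂ : const (+ 2) *ˢ (ψ *ˢ d2 ψ) ≈ d3 (φ *ˢ ψ) +ˢ A₃ *ˢ B₃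
ψψ₂ = const-cancel (+ 2) _ _ (begin
  const (+ 2) *ˢ (const (+ 2) *ˢ (ψ *ˢ d2 ψ))        ≈⟨ solve 2 (λ f g → con (+ 2) :* (con (+ 2) :* (f :* g)) := con (+ 2) :* f :* (con (+ 2) :* g)) ≈-refl ψ (d2 ψ) ⟩
  const (+ 2) *ˢ ψ *ˢ (const (+ 2) *ˢ d2 ψ)          ≈⟨ *ˢ-cong triangles-two-sided (≈-trans (gf-dilate2 Triangles) (≈-trans (d2-cong triangles-two-sided) (d2-2* ψ))) ⟨
  gf Triangles *ˢ gf (dilate2 Triangles)             ≈⟨ gf-⊗ Triangles (dilate2 Triangles) ⟨
  gf (Triangles ⊗ dilate2 Triangles)                 ≈⟨ gf-≅ iso ⟩
  gf (Z ⊞ P ⊞ P)                                     ≈⟨ ≈-trans (gf-⊞ Z (P ⊞ P)) (+ˢ-cong gfZ (≈-trans (gf-⊞ P P) (+ˢ-cong gfP gfP))) ⟩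
  const (+ 2) *ˢ d3 (φ *ˢ ψ) +ˢ (A₃ *ˢ B₃ +ˢ A₃ *ˢ B₃) ≈⟨ solve 2 (λ f g → con (+ 2) :* f :+ (g :+ g) := con (+ 2) :* (f :+ g)) ≈-refl (d3 (φ *ˢ ψ)) (A₃ *ˢ B₃) ⟩
  const (+ 2) *ˢ (d3 (φ *ˢ ψ) +ˢ A₃ *ˢ B₃)           ∎)
  where
  open ≈-Reasoning
  Z = dilate3 (Squares ⊗ Triangles)
  P = ThirdsOfTriangles ⊗ ThirdsOfSquares
  gfP : gf P ≈ A₃ *ˢ B₃
  gfP = gf-⊗ ThirdsOfTriangles ThirdsOfSquares
  gfZ : gf Z ≈ const (+ 2) *ˢ d3 (φ *ˢ ψ)
  gfZ = ≈-trans (gf-dilate3 (Squares ⊗ Triangles)) (≈-trans (d3-cong (≈-trans (gf-⊗ Squares Triangles) (≈-trans (*ˢ-cong ≈-refl triangles-two-sided)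
    (solve 2 (λ f g → f :* (con (+ 2) :* g) := con (+ 2) :* (f :* g)) ≈-refl φ ψ)))) (d3-2* (φ *ˢ ψ)))
  to : ℤ × ℤ → (ℤ × ℤ) ⊎ (ℤ × ℤ) ⊎ (ℤ × ℤ)
  to (j , k) with residue₃ (j +ᶻ k +ᶻ + 1)
  ... | inj₁ i        = inj₁ (i , j -ᶻ i *ᶻ + 2)
  ... | inj₂ (inj₁ m) = inj₂ (inj₁ (m *ᶻ + 2 -ᶻ j , m))
  ... | inj₂ (inj₂ m) = inj₂ (inj₂ (j +ᶻ m *ᶻ + 2 +ᶻ + 1 , m))
  from : (ℤ × ℤ) ⊎ (ℤ × ℤ) ⊎ (ℤ × ℤ) → ℤ × ℤ
  from (inj₁ (i , l))        = l +ᶻ i *ᶻ + 2 , i -ᶻ l -ᶻ + 1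
  from (inj₂ (inj₁ (n , m))) = m *ᶻ + 2 -ᶻ n , m +ᶻ n
  from (inj₂ (inj₂ (n , m))) = n -ᶻ m *ᶻ + 2 -ᶻ + 1 , -ᶻ m -ᶻ n -ᶻ + 1
  a₀ : ∀ j i → j -ᶻ i *ᶻ + 2 +ᶻ i *ᶻ + 2 ≡ j
  a₀ = ℤ-ring
  b₀ : ∀ j i → i -ᶻ (j -ᶻ i *ᶻ + 2) -ᶻ + 1 ≡ i *ᶻ + 3 -ᶻ j -ᶻ + 1
  b₀ = ℤ-ring
  c₀ : ∀ j k → j +ᶻ k +ᶻ + 1 -ᶻ j -ᶻ + 1 ≡ k
  c₀ = ℤ-ring
  a₁ : ∀ j m → m *ᶻ + 2 -ᶻ (m *ᶻ + 2 -ᶻ j) ≡ j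
  a₁ = ℤ-ring
  b₁ : ∀ j m → m +ᶻ (m *ᶻ + 2 -ᶻ j) ≡ m *ᶻ + 3 +ᶻ + 1 -ᶻ j -ᶻ + 1
  b₁ = ℤ-ring
  a₂ : ∀ j m → j +ᶻ m *ᶻ + 2 +ᶻ + 1 -ᶻ m *ᶻ + 2 -ᶻ + 1 ≡ j
  a₂ = ℤ-ring
  b₂ : ∀ j m → -ᶻ m -ᶻ (j +ᶻ m *ᶻ + 2 +ᶻ + 1) -ᶻ + 1 ≡ -ᶻ (m *ᶻ + 3 +ᶻ + 1) -ᶻ j -ᶻ + 1
  b₂ = ℤ-ring
  from-to : ∀ x → from (to x) ≡ x
  from-to (j , k) with residue₃ (j +ᶻ k +ᶻ + 1) | unresidue-residue (j +ᶻ k +ᶻ + 1)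
  ... | inj₁ i        | p = cong₂ _,_ (a₀ j i) (trans (b₀ j i) (trans (cong (λ y → y -ᶻ j -ᶻ + 1) p) (c₀ j k)))
  ... | inj₂ (inj₁ m) | p = cong₂ _,_ (a₁ j m) (trans (b₁ j m) (trans (cong (λ y → y -ᶻ j -ᶻ + 1) p) (c₀ j k)))
  ... | inj₂ (inj₂ m) | p = cong₂ _,_ (a₂ j m) (trans (b₂ j m) (trans (cong (λ y → y -ᶻ j -ᶻ + 1) p) (c₀ j k)))
  r₀ : ∀ i l → l +ᶻ i *ᶻ + 2 +ᶻ (i -ᶻ l -ᶻ + 1) +ᶻ + 1 ≡ i *ᶻ + 3
  r₀ = ℤ-ring
  r₁ : ∀ n m → m *ᶻ + 2 -ᶻ n +ᶻ (m +ᶻ n) +ᶻ + 1 ≡ m *ᶻ + 3 +ᶻ + 1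
  r₁ = ℤ-ring
  r₂ : ∀ n m → n -ᶻ m *ᶻ + 2 -ᶻ + 1 +ᶻ (-ᶻ m -ᶻ n -ᶻ + 1) +ᶻ + 1 ≡ -ᶻ (m *ᶻ + 3 +ᶻ + 1)
  r₂ = ℤ-ring
  t₀ : ∀ i l → l +ᶻ i *ᶻ + 2 -ᶻ i *ᶻ + 2 ≡ l
  t₀ = ℤ-ring
  t₁ : ∀ n m → m *ᶻ + 2 -ᶻ (m *ᶻ + 2 -ᶻ n) ≡ n
  t₁ = ℤ-ring
  t₂ : ∀ n m → n -ᶻ m *ᶻ + 2 -ᶻ + 1 +ᶻ m *ᶻ + 2 +ᶻ + 1 ≡ n
  t₂ = ℤ-ring
  to-from : ∀ y → to (from y) ≡ y
  to-from (inj₁ (i , l)) rewrite r₀ i l | residue-unresidue (inj₁ i) = cong (λ d → inj₁ (i , d)) (t₀ i l)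
  to-from (inj₂ (inj₁ (n , m))) rewrite r₁ n m | residue-unresidue (inj₂ (inj₁ m)) = cong (λ d → inj₂ (inj₁ (d , m))) (t₁ n m)
  to-from (inj₂ (inj₂ (n , m))) rewrite r₂ n m | residue-unresidue (inj₂ (inj₂ m)) = cong (λ d → inj₂ (inj₂ (d , m))) (t₂ n m)
  s₀ : ∀ i l → (l +ᶻ i *ᶻ + 2) *ᶻ (l +ᶻ i *ᶻ + 2 +ᶻ + 1) +ᶻ (i -ᶻ l -ᶻ + 1) *ᶻ (i -ᶻ l -ᶻ + 1 +ᶻ + 1) *ᶻ + 2 ≡ (i *ᶻ i *ᶻ + 2 +ᶻ l *ᶻ (l +ᶻ + 1)) *ᶻ + 3
  s₀ = ℤ-ring
  s₁ : ∀ n m → (m *ᶻ + 2 -ᶻ n) *ᶻ (m *ᶻ + 2 -ᶻ n +ᶻ + 1) +ᶻ (m +ᶻ n) *ᶻ (m +ᶻ n +ᶻ + 1) *ᶻ + 2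
    ≡ n *ᶻ (n +ᶻ + 1) +ᶻ n *ᶻ n *ᶻ + 2 +ᶻ (m *ᶻ (m +ᶻ + 1) *ᶻ + 4 +ᶻ m *ᶻ m *ᶻ + 2)
  s₁ = ℤ-ring
  s₂ : ∀ n m → (n -ᶻ m *ᶻ + 2 -ᶻ + 1) *ᶻ (n -ᶻ m *ᶻ + 2 -ᶻ + 1 +ᶻ + 1) +ᶻ (-ᶻ m -ᶻ n -ᶻ + 1) *ᶻ (-ᶻ m -ᶻ n -ᶻ + 1 +ᶻ + 1) *ᶻ + 2
    ≡ n *ᶻ (n +ᶻ + 1) +ᶻ n *ᶻ n *ᶻ + 2 +ᶻ (m *ᶻ (m +ᶻ + 1) *ᶻ + 4 +ᶻ m *ᶻ m *ᶻ + 2)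
  s₂ = ℤ-ring
  iso : (Triangles ⊗ dilate2 Triangles) ≅ (Z ⊞ P ⊞ P)
  iso = mk≅ to from from-to to-from
    λ { (inj₁ (i , l))        → same ((2tri′ (l +ᶻ i *ᶻ + 2) ⊕ 2tri′ (i -ᶻ l -ᶻ + 1) ⊙ 2)) (s₀ i l) (((2sq i ⊕ 2tri′ l) ⊙ 3))
      ; (inj₂ (inj₁ (n , m))) → same ((2tri′ (m *ᶻ + 2 -ᶻ n) ⊕ 2tri′ (m +ᶻ n) ⊙ 2)) (s₁ n m) ((2tri′ n ⊕ 2sq n ⊕ (2tri′ m ⊙ 4 ⊕ 2sq m)))
      ; (inj₂ (inj₂ (n , m))) → same ((2tri′ (n -ᶻ m *ᶻ + 2 -ᶻ + 1) ⊕ 2tri′ (-ᶻ m -ᶻ n -ᶻ + 1) ⊙ 2)) (s₂ n m) ((2tri′ n ⊕ 2sq n ⊕ (2tri′ m ⊙ 4 ⊕ 2sq m))) }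

-- Gauss's product formulas, by Shanks's telescoping sums

≡⇒≈ : ∀ {f g} → f ≡ g → f ≈ g
≡⇒≈ refl = ≈-refl

^ˢ-cong : ∀ {f g} k → f ≈ g → f ^ˢ k ≈ g ^ˢ k
^ˢ-cong zero    p = ≈-refl
^ˢ-cong (suc k) p = *ˢ-cong p (^ˢ-cong k p)

^ˢ-distrib-* : ∀ f g k → (f *ˢ g) ^ˢ k ≈ f ^ˢ k *ˢ g ^ˢ k
^ˢ-distrib-* f g zero    = ≈-sym (SR.*-identityˡ 1ˢ)
^ˢ-distrib-* f g (suc k) = ≈-trans (*ˢ-cong ≈-refl (^ˢ-distrib-* f g k))
  (solve 4 (λ f g a b → f :* g :* (a :* b) := f :* a :* (g :* b)) ≈-refl f g (f ^ˢ k) (g ^ˢ k))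

^ˢ-+ : ∀ f a b → f ^ˢ (a + b) ≈ f ^ˢ a *ˢ f ^ˢ b
^ˢ-+ f zero    b = ≈-sym (SR.*-identityˡ (f ^ˢ b))
^ˢ-+ f (suc a) b = ≈-trans (*ˢ-cong ≈-refl (^ˢ-+ f a b)) (≈-sym (SR.*-assoc f (f ^ˢ a) (f ^ˢ b)))

^ˢ-* : ∀ f a b → (f ^ˢ a) ^ˢ b ≈ f ^ˢ (b * a)
^ˢ-* f a zero    = ≈-refl
^ˢ-* f a (suc b) = ≈-trans (*ˢ-cong ≈-refl (^ˢ-* f a b)) (≈-sym (^ˢ-+ f a (b * a)))

-- A finite form of Gauss's 1 + 2 Σ (-1)^s q^(s²) = ∏ (1 - q^k)/(1 + q^k), cleared of denominators.
-- The base is a parameter because the identity is needed at -X, where the signs of the sum cancel.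
module SquareSum (q : Series) where

  factorsFrom : ℕ → ℕ → Series
  factorsFrom t zero    = 1ˢ
  factorsFrom t (suc m) = (1ˢ -ˢ q ^ˢ suc t) *ˢ factorsFrom (suc t) m

  factorsFrom-last : ∀ t m → factorsFrom t (suc m) ≈ factorsFrom t m *ˢ (1ˢ -ˢ q ^ˢ suc (t + m))
  factorsFrom-last t zero rewrite ℕₚ.+-identityʳ t = SR.*-comm (1ˢ -ˢ q ^ˢ suc t) 1ˢ
  factorsFrom-last t (suc m) rewrite ℕₚ.+-suc t m = ≈-trans (*ˢ-cong ≈-refl (factorsFrom-last (suc t) m))
    (≈-sym (SR.*-assoc (1ˢ -ˢ q ^ˢ suc t) (factorsFrom (suc t) m) (1ˢ -ˢ q ^ˢ suc (suc t + m))))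

  plusFactors : ℕ → Series
  plusFactors zero    = 1ˢ
  plusFactors (suc n) = plusFactors n *ˢ (1ˢ +ˢ q ^ˢ suc n)

  coeff : ℕ → Series
  coeff zero    = const (+ 2)
  coeff (suc s) = -ˢ coeff s

  sum : ℕ → Series
  sum zero    = 1ˢ
  sum (suc n) = sum n +ˢ coeff (suc n) *ˢ (q ^ˢ suc n) ^ˢ suc n

  -- Along t + m + 1 = n every term contains the factor q^(n + 1). For q without constant term the
  -- remainder is therefore invisible up to degree n.
  term : ℕ → ℕ → Series
  term t m = coeff (suc t) *ˢ (q ^ˢ suc (t + suc m)) ^ˢ suc t *ˢ factorsFrom (suc t) m *ˢ plusFactors t

  remainder : ℕ → ℕ → Series
  remainder t zero    = 0ˢ
  remainder t (suc m) = term t m +ˢ remainder (suc t) m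

  edge : ℕ → ℕ → Series
  edge t m = coeff (suc t) *ˢ (q ^ˢ suc (t + m)) ^ˢ suc t *ˢ plusFactors t *ˢ factorsFrom t m

  new : ℕ → Series
  new n = coeff (suc n) *ˢ (q ^ˢ suc n) ^ˢ suc n *ˢ plusFactors (suc n)

  -- Raising n = t + m + 1 by one multiplies a term by the next factor 1 + q^(n + 1), up to a
  -- difference of two consecutive values of `edge`. Summation over t telescopes these, leaving only
  -- the two ends.
  term-step : ∀ t m → term t (suc m) ≈ (1ˢ +ˢ q ^ˢ suc (t + suc m)) *ˢ term t m +ˢ edge (suc t) m -ˢ edge t (suc m)
  term-step t m rewrite ℕₚ.+-suc t (suc m) | ℕₚ.+-suc t m = begin
    c *ˢ (q *ˢ v) ^ˢ suc t *ˢ factorsFrom (suc t) (suc m) *ˢ p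
      ≈⟨ *ˢ-cong (*ˢ-cong (*ˢ-cong ≈-refl (^ˢ-distrib-* q v (suc t))) (factorsFrom-last (suc t) m)) ≈-refl ⟩
    c *ˢ (u *ˢ e) *ˢ (r *ˢ (1ˢ -ˢ v)) *ˢ p
      ≈⟨ solve 6 (λ c u v e r p → c :* (u :* e) :* (r :* (con (+ 1) :- v)) :* p :=
           (con (+ 1) :+ v) :* (c :* e :* r :* p) :+ (:- c) :* (v :* e) :* (p :* (con (+ 1) :+ u)) :* r :- c :* e :* p :* ((con (+ 1) :- u) :* r))
           ≈-refl c u v e r p ⟩
    (1ˢ +ˢ v) *ˢ (c *ˢ e *ˢ r *ˢ p) +ˢ (-ˢ c) *ˢ (v *ˢ e) *ˢ (p *ˢ (1ˢ +ˢ u)) *ˢ r -ˢ c *ˢ e *ˢ p *ˢ ((1ˢ -ˢ u) *ˢ r) ∎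
    where
    open ≈-Reasoning
    c = coeff (suc t)
    u = q ^ˢ suc t
    v = q ^ˢ suc (suc (t + m))
    e = v ^ˢ suc t
    r = factorsFrom (suc t) m
    p = plusFactors t

  remainder-step : ∀ t m → remainder t (suc m) ≈ (1ˢ +ˢ q ^ˢ suc (t + m)) *ˢ remainder t m +ˢ new (t + m) -ˢ edge t m
  remainder-step t zero rewrite ℕₚ.+-suc t 0 | ℕₚ.+-identityʳ t = begin
    c *ˢ (q *ˢ u) ^ˢ suc t *ˢ 1ˢ *ˢ p +ˢ 0ˢ
      ≈⟨ +ˢ-cong (*ˢ-cong (*ˢ-cong (*ˢ-cong ≈-refl (^ˢ-distrib-* q u (suc t))) ≈-refl) ≈-refl) ≈-refl ⟩
    c *ˢ (u *ˢ e) *ˢ 1ˢ *ˢ p +ˢ 0ˢ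
      ≈⟨ solve 4 (λ c u e p → c :* (u :* e) :* con (+ 1) :* p :+ con (+ 0) :=
           (con (+ 1) :+ u) :* con (+ 0) :+ c :* e :* (p :* (con (+ 1) :+ u)) :- c :* e :* p :* con (+ 1)) ≈-refl c u e p ⟩
    (1ˢ +ˢ u) *ˢ 0ˢ +ˢ c *ˢ e *ˢ (p *ˢ (1ˢ +ˢ u)) -ˢ c *ˢ e *ˢ p *ˢ 1ˢ ∎
    where
    open ≈-Reasoning
    c = coeff (suc t)
    u = q ^ˢ suc t
    e = u ^ˢ suc t
    p = plusFactors t
  remainder-step t (suc m) = begin
    term t (suc m) +ˢ remainder (suc t) (suc m)
      ≈⟨ +ˢ-cong (term-step t m) (remainder-step (suc t) m) ⟩
    (1ˢ +ˢ q ^ˢ suc (t + suc m)) *ˢ term t m +ˢ edge (suc t) m -ˢ edge t (suc m)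
      +ˢ ((1ˢ +ˢ q ^ˢ suc (suc t + m)) *ˢ remainder (suc t) m +ˢ new (suc t + m) -ˢ edge (suc t) m)
      ≈⟨ ≡⇒≈ (cong (λ n → (1ˢ +ˢ q ^ˢ suc (t + suc m)) *ˢ term t m +ˢ edge (suc t) m -ˢ edge t (suc m) +ˢ ((1ˢ +ˢ q ^ˢ suc n) *ˢ remainder (suc t) m +ˢ new n -ˢ edge (suc t) m)) (sym (ℕₚ.+-suc t m))) ⟩
    (1ˢ +ˢ q ^ˢ suc (t + suc m)) *ˢ term t m +ˢ edge (suc t) m -ˢ edge t (suc m)
      +ˢ ((1ˢ +ˢ q ^ˢ suc (t + suc m)) *ˢ remainder (suc t) m +ˢ new (t + suc m) -ˢ edge (suc t) m)
      ≈⟨ solve 6 (λ v a e e′ z n → (con (+ 1) :+ v) :* a :+ e :- e′ :+ ((con (+ 1) :+ v) :* z :+ n :- e) :=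
           (con (+ 1) :+ v) :* (a :+ z) :+ n :- e′) ≈-refl (q ^ˢ suc (t + suc m)) (term t m) (edge (suc t) m) (edge t (suc m)) (remainder (suc t) m) (new (t + suc m)) ⟩
    (1ˢ +ˢ q ^ˢ suc (t + suc m)) *ˢ (term t m +ˢ remainder (suc t) m) +ˢ new (t + suc m) -ˢ edge t (suc m) ∎
    where
    open ≈-Reasoning

  shanks : ∀ n → plusFactors n *ˢ sum n ≈ factorsFrom 0 n +ˢ remainder 0 n
  shanks zero    = solve 0 (con (+ 1) :* con (+ 1) := con (+ 1) :+ con (+ 0)) ≈-refl
  shanks (suc n) = begin
    p *ˢ (1ˢ +ˢ v) *ˢ (s +ˢ c *ˢ e)                    ≈⟨ solve 5 (λ p v s c e → p :* (con (+ 1) :+ v) :* (s :+ c :* e) := (con (+ 1) :+ v) :* (p :* s) :+ c :* e :* (p :* (con (+ 1) :+ v))) ≈-refl p v s c e ⟩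
    (1ˢ +ˢ v) *ˢ (p *ˢ s) +ˢ c *ˢ e *ˢ (p *ˢ (1ˢ +ˢ v)) ≈⟨ +ˢ-cong (*ˢ-cong ≈-refl (shanks n)) ≈-refl ⟩
    -- Here `edge 0 n` is -2vr, and (1 + v)r - 2vr = (1 - v)r supplies the next factor of the main
    -- product.
    (1ˢ +ˢ v) *ˢ (r +ˢ z) +ˢ new n                     ≈⟨ solve 4 (λ v r z w → (con (+ 1) :+ v) :* (r :+ z) :+ w :=
      r :* (con (+ 1) :- v) :+ ((con (+ 1) :+ v) :* z :+ w :- (:- con (+ 2)) :* (v :* con (+ 1)) :* con (+ 1) :* r)) ≈-refl v r z (new n) ⟩
    r *ˢ (1ˢ -ˢ v) +ˢ ((1ˢ +ˢ v) *ˢ z +ˢ new n -ˢ edge 0 n) ≈⟨ +ˢ-cong (factorsFrom-last 0 n) (remainder-step 0 n) ⟨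
    factorsFrom 0 (suc n) +ˢ remainder 0 (suc n)       ∎
    where
    open ≈-Reasoning
    p = plusFactors n
    s = sum n
    c = coeff (suc n)
    v = q ^ˢ suc n
    e = v ^ˢ suc n
    r = factorsFrom 0 n
    z = remainder 0 n

-- A finite form of Gauss's Σ q^(n(n + 1)/2) = ∏ (1 - q^(2k))/(1 - q^(2k - 1)), cleared of
-- denominators.
module TriangleSum (q : Series) where

  p : Series
  p = q *ˢ q

  odd : ℕ → Series
  odd n = q *ˢ p ^ˢ n

  evenFactorsFrom : ℕ → ℕ → Series
  evenFactorsFrom t zero    = 1ˢ
  evenFactorsFrom t (suc m) = (1ˢ -ˢ p ^ˢ suc t) *ˢ evenFactorsFrom (suc t) m

  evenFactorsFrom-last : ∀ t m → evenFactorsFrom t (suc m) ≈ evenFactorsFrom t m *ˢ (1ˢ -ˢ p ^ˢ suc (t + m))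
  evenFactorsFrom-last t zero rewrite ℕₚ.+-identityʳ t = SR.*-comm (1ˢ -ˢ p ^ˢ suc t) 1ˢ
  evenFactorsFrom-last t (suc m) rewrite ℕₚ.+-suc t m = ≈-trans (*ˢ-cong ≈-refl (evenFactorsFrom-last (suc t) m))
    (≈-sym (SR.*-assoc (1ˢ -ˢ p ^ˢ suc t) (evenFactorsFrom (suc t) m) (1ˢ -ˢ p ^ˢ suc (suc t + m))))

  oddFactors : ℕ → Series
  oddFactors zero    = 1ˢ
  oddFactors (suc n) = oddFactors n *ˢ (1ˢ -ˢ odd n)

  -- Triangular numbers are added in pairs: those with indices 2k and 2k + 1 are k(2k + 1) and (k +
  -- 1)(2k + 1), the exponents of two consecutive powers of `odd k`.
  sum : ℕ → Series
  sum zero    = 0ˢ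
  sum (suc n) = sum n +ˢ (odd n ^ˢ n +ˢ odd n ^ˢ n *ˢ odd n)

  term : ℕ → ℕ → Series
  term t m = evenFactorsFrom t (suc m) *ˢ oddFactors t *ˢ odd (t + suc m) ^ˢ t

  remainder : ℕ → ℕ → Series
  remainder t zero    = 0ˢ
  remainder t (suc m) = term t m +ˢ remainder (suc t) m

  edge : ℕ → ℕ → Series
  edge t m = (1ˢ -ˢ p ^ˢ t) *ˢ evenFactorsFrom t m *ˢ oddFactors t *ˢ odd (t + m) ^ˢ t

  new : ℕ → Series
  new n = oddFactors n *ˢ (1ˢ -ˢ odd n) *ˢ (odd n ^ˢ n +ˢ odd n ^ˢ n *ˢ odd n)

  odd-suc : ∀ n → odd (suc n) ≈ p *ˢ odd n
  odd-suc n = solve 3 (λ q p a → q :* (p :* a) := p :* (q :* a)) ≈-refl q p (p ^ˢ n)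

  odd-suc-^ : ∀ n t → odd (suc n) ^ˢ t ≈ p ^ˢ t *ˢ odd n ^ˢ t
  odd-suc-^ n t = ≈-trans (^ˢ-cong t (odd-suc n)) (^ˢ-distrib-* p (odd n) t)

  term-step : ∀ t m → term t (suc m) ≈ (1ˢ -ˢ odd (t + suc m)) *ˢ term t m +ˢ edge (suc t) m -ˢ edge t (suc m)
  term-step t m rewrite ℕₚ.+-suc t (suc m) | ℕₚ.+-suc t m = begin
    evenFactorsFrom t (suc (suc m)) *ˢ o *ˢ odd (suc n) ^ˢ t
      ≈⟨ *ˢ-cong (*ˢ-cong (≈-trans (evenFactorsFrom-last t (suc m)) (*ˢ-cong ≈-refl last)) ≈-refl) (odd-suc-^ n t) ⟩
    (1ˢ -ˢ p ^ˢ suc t) *ˢ r *ˢ (1ˢ -ˢ q *ˢ w) *ˢ o *ˢ (a *ˢ e)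
      ≈⟨ solve 6 (λ q a r w o e → let r′ = (con (+ 1) :- q :* q :* a) :* r in
           r′ :* (con (+ 1) :- q :* w) :* o :* (a :* e) :=
           (con (+ 1) :- w) :* (r′ :* o :* e) :+ r′ :* (o :* (con (+ 1) :- q :* a)) :* (w :* e) :- (con (+ 1) :- a) :* r′ :* o :* e)
           ≈-refl q a r w o e ⟩
    (1ˢ -ˢ w) *ˢ ((1ˢ -ˢ p ^ˢ suc t) *ˢ r *ˢ o *ˢ e) +ˢ (1ˢ -ˢ p ^ˢ suc t) *ˢ r *ˢ (o *ˢ (1ˢ -ˢ q *ˢ a)) *ˢ (w *ˢ e)
      -ˢ (1ˢ -ˢ a) *ˢ ((1ˢ -ˢ p ^ˢ suc t) *ˢ r) *ˢ o *ˢ e ∎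
    where
    open ≈-Reasoning
    n = suc (t + m)
    a = p ^ˢ t
    r = evenFactorsFrom (suc t) m
    w = odd n
    o = oddFactors t
    e = w ^ˢ t
    last : 1ˢ -ˢ p ^ˢ suc (t + suc m) ≈ 1ˢ -ˢ q *ˢ w
    last rewrite ℕₚ.+-suc t m = solve 2 (λ q b → con (+ 1) :- q :* q :* b := con (+ 1) :- q :* (q :* b)) ≈-refl q (p ^ˢ n)

  remainder-step : ∀ t m → remainder t (suc m) ≈ (1ˢ -ˢ odd (t + m)) *ˢ remainder t m +ˢ new (t + m) -ˢ edge t m
  remainder-step t zero rewrite ℕₚ.+-suc t 0 | ℕₚ.+-identityʳ t = begin
    (1ˢ -ˢ p *ˢ a) *ˢ 1ˢ *ˢ o *ˢ odd (suc t) ^ˢ t +ˢ 0ˢ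
      ≈⟨ +ˢ-cong (*ˢ-cong ≈-refl (odd-suc-^ t t)) ≈-refl ⟩
    (1ˢ -ˢ p *ˢ a) *ˢ 1ˢ *ˢ o *ˢ (a *ˢ e) +ˢ 0ˢ
      ≈⟨ solve 4 (λ q a o e → (con (+ 1) :- q :* q :* a) :* con (+ 1) :* o :* (a :* e) :+ con (+ 0) :=
           (con (+ 1) :- q :* a) :* con (+ 0) :+ o :* (con (+ 1) :- q :* a) :* (e :+ e :* (q :* a)) :- (con (+ 1) :- a) :* con (+ 1) :* o :* e) ≈-refl q a o e ⟩
    (1ˢ -ˢ q *ˢ a) *ˢ 0ˢ +ˢ o *ˢ (1ˢ -ˢ q *ˢ a) *ˢ (e +ˢ e *ˢ (q *ˢ a)) -ˢ (1ˢ -ˢ a) *ˢ 1ˢ *ˢ o *ˢ e ∎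
    where
    open ≈-Reasoning
    a = p ^ˢ t
    o = oddFactors t
    e = odd t ^ˢ t
  remainder-step t (suc m) = begin
    term t (suc m) +ˢ remainder (suc t) (suc m)
      ≈⟨ +ˢ-cong (term-step t m) (remainder-step (suc t) m) ⟩
    (1ˢ -ˢ odd (t + suc m)) *ˢ term t m +ˢ edge (suc t) m -ˢ edge t (suc m)
      +ˢ ((1ˢ -ˢ odd (suc t + m)) *ˢ remainder (suc t) m +ˢ new (suc t + m) -ˢ edge (suc t) m)
      ≈⟨ ≡⇒≈ (cong (λ n → (1ˢ -ˢ odd (t + suc m)) *ˢ term t m +ˢ edge (suc t) m -ˢ edge t (suc m) +ˢ ((1ˢ -ˢ odd n) *ˢ remainder (suc t) m +ˢ new n -ˢ edge (suc t) m)) (sym (ℕₚ.+-suc t m))) ⟩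
    (1ˢ -ˢ odd (t + suc m)) *ˢ term t m +ˢ edge (suc t) m -ˢ edge t (suc m)
      +ˢ ((1ˢ -ˢ odd (t + suc m)) *ˢ remainder (suc t) m +ˢ new (t + suc m) -ˢ edge (suc t) m)
      ≈⟨ solve 6 (λ v a e e′ z n → (con (+ 1) :- v) :* a :+ e :- e′ :+ ((con (+ 1) :- v) :* z :+ n :- e) :=
           (con (+ 1) :- v) :* (a :+ z) :+ n :- e′) ≈-refl (odd (t + suc m)) (term t m) (edge (suc t) m) (edge t (suc m)) (remainder (suc t) m) (new (t + suc m)) ⟩
    (1ˢ -ˢ odd (t + suc m)) *ˢ (term t m +ˢ remainder (suc t) m) +ˢ new (t + suc m) -ˢ edge t (suc m) ∎
    where
    open ≈-Reasoning

  -- For n > 0 the main product sits inside the remainder: its term at t = 0 is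
  -- `evenFactorsFrom 0 n`, because `odd` enters there with exponent 0. Only the terms from t = 1 on
  -- are small.
  shanks : ∀ n → oddFactors n *ˢ sum n ≈ remainder 0 n
  shanks zero    = solve 0 (con (+ 1) :* con (+ 0) := con (+ 0)) ≈-refl
  shanks (suc n) = begin
    o *ˢ (1ˢ -ˢ w) *ˢ (s +ˢ (e +ˢ e *ˢ w))                ≈⟨ solve 4 (λ o w s e → o :* (con (+ 1) :- w) :* (s :+ (e :+ e :* w)) := (con (+ 1) :- w) :* (o :* s) :+ o :* (con (+ 1) :- w) :* (e :+ e :* w)) ≈-refl o w s e ⟩
    (1ˢ -ˢ w) *ˢ (o *ˢ s) +ˢ new n                        ≈⟨ +ˢ-cong (*ˢ-cong ≈-refl (shanks n)) ≈-refl ⟩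
    -- `edge 0 n` vanishes by its factor 1 - p⁰, so it may be subtracted to reach the form of
    -- `remainder-step`.
    (1ˢ -ˢ w) *ˢ z +ˢ new n                               ≈⟨ solve 4 (λ w z u r → (con (+ 1) :- w) :* z :+ u := (con (+ 1) :- w) :* z :+ u :- (con (+ 1) :- con (+ 1)) :* r :* con (+ 1) :* con (+ 1)) ≈-refl w z (new n) (evenFactorsFrom 0 n) ⟩
    (1ˢ -ˢ w) *ˢ z +ˢ new n -ˢ edge 0 n                   ≈⟨ remainder-step 0 n ⟨
    remainder 0 (suc n)                                   ∎
    where
    open ≈-Reasoning
    o = oddFactors n
    w = odd n
    s = sum n
    e = odd n ^ˢ n
    z = remainder 0 n

-- Counting the partitions in a box

hasSum : ℕ → List ℕ → Bool
hasSum n xs = does (sumℕ xs ≟ n)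

admissible : List ℕ → Bool
admissible xs = does (evenPartsDistinct? xs)

indicator : Bool → Bool → ℤ
indicator a b = if a then (if b then + 1 else + 0) else + 0

weight : ℕ → List ℕ → ℤ
weight n xs = indicator (hasSum n xs) (admissible xs)

count : ℕ → ℕ → Series
count ℓ k n = sumOver (box ℓ k) (weight n)

ped-count : ∀ n → + ped n ≡ count n n n
ped-count n = go (box n n)
  where
  go : ∀ xss → + length (filter evenPartsDistinct? (filter (λ xs → sumℕ xs ≟ n) xss)) ≡ sumOver xss (weight n)
  go [] = refl
  go (xs ∷ xss) with does (sumℕ xs ≟ n)
  ... | false = trans (go xss) (sym (ℤₚ.+-identityˡ _))
  ... | true with does (evenPartsDistinct? xs)
  ...   | false = trans (go xss) (sym (ℤₚ.+-identityˡ _))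
  ...   | true  = cong (+ 1 +ᶻ_) (go xss)

hasSum-∷ : ∀ k m xs → hasSum (k + m) (k ∷ xs) ≡ hasSum m xs
hasSum-∷ k m xs = does-⇔ (mk⇔ (ℕₚ.+-cancelˡ-≡ k _ m) (cong (λ s → k + s))) (sumℕ (k ∷ xs) ≟ k + m) (sumℕ xs ≟ m)

hasSum-small : ∀ k n xs → n < k → hasSum n (k ∷ xs) ≡ false
hasSum-small k n xs n<k = dec-false (sumℕ (k ∷ xs) ≟ n) (λ eq → ℕₚ.<⇒≱ n<k (subst (k ≤_) eq (ℕₚ.m≤m+n k _)))

admissible-odd : ∀ k xs → ¬ 2 ∣ k → admissible (k ∷ xs) ≡ admissible xs
admissible-odd k xs 2∤k = does-⇔ (mk⇔ (subst Unique eq) (subst Unique (sym eq))) (evenPartsDistinct? (k ∷ xs)) (evenPartsDistinct? xs)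
  where
  eq : filter (2 ∣?_) (k ∷ xs) ≡ filter (2 ∣?_) xs
  eq = filter-reject (2 ∣?_) 2∤k

admissible-even : ∀ k xs → 2 ∣ k → All (k ≢_) xs → admissible (k ∷ xs) ≡ admissible xs
admissible-even k xs 2∣k fresh = does-⇔ (mk⇔ (λ u → AllPairs.tail (subst Unique eq u)) (λ u → subst Unique (sym eq) (evens-fresh ∷ u)))
  (evenPartsDistinct? (k ∷ xs)) (evenPartsDistinct? xs)
  where
  eq : filter (2 ∣?_) (k ∷ xs) ≡ k ∷ filter (2 ∣?_) xs
  eq = filter-accept (2 ∣?_) 2∣k
  evens-fresh : All (k ≢_) (filter (2 ∣?_) xs)
  evens-fresh = All.tabulate (λ x∈ → All.lookup fresh (proj₁ (∈-filter⁻ (2 ∣?_) {xs = xs} x∈)))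

admissible-repeated : ∀ k xs → 2 ∣ k → admissible (k ∷ k ∷ xs) ≡ false
admissible-repeated k xs 2∣k = dec-false (evenPartsDistinct? (k ∷ k ∷ xs)) (λ u → head-fresh (subst Unique eq u))
  where
  eq : filter (2 ∣?_) (k ∷ k ∷ xs) ≡ k ∷ k ∷ filter (2 ∣?_) xs
  eq = trans (filter-accept (2 ∣?_) 2∣k) (cong (k ∷_) (filter-accept (2 ∣?_) 2∣k))
  head-fresh : ∀ {ys} → ¬ Unique (k ∷ k ∷ ys)
  head-fresh ((k≢k ∷ _) ∷ _) = k≢k refl

weight-small : ∀ k n xs → n < k → weight n (k ∷ xs) ≡ + 0
weight-small k n xs n<k rewrite hasSum-small k n xs n<k = refl

indicator-false : ∀ a → indicator a false ≡ + 0
indicator-false true  = refl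
indicator-false false = refl

box-bounded : ∀ ℓ k {xs} → xs ∈ box ℓ k → All (_≤ k) xs
box-bounded zero    k       (here refl) = []
box-bounded (suc ℓ) zero    (here refl) = []
box-bounded (suc ℓ) (suc k) xs∈ with ∈-++⁻ (map (suc k ∷_) (box ℓ (suc k))) xs∈
... | inj₂ xs∈′ = All.map ℕₚ.m≤n⇒m≤1+n (box-bounded (suc ℓ) k xs∈′)
... | inj₁ xs∈′ with ∈-map⁻ (suc k ∷_) xs∈′
...   | ys , ys∈ , refl = ℕₚ.≤-refl ∷ box-bounded ℓ (suc k) ys∈

count-split : ∀ ℓ k n → count (suc ℓ) (suc k) n ≡ sumOver (box ℓ (suc k)) (weight n ∘ (suc k ∷_)) +ᶻ count (suc ℓ) k n
count-split ℓ k n = trans (sumOver-++ (map (suc k ∷_) (box ℓ (suc k))) (box (suc ℓ) k) (weight n))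
  (cong (_+ᶻ count (suc ℓ) k n) (sumOver-map (suc k ∷_) (box ℓ (suc k)) (weight n)))

sumOver-0 : ∀ {A : Set} (xs : List A) → sumOver xs (λ _ → + 0) ≡ + 0
sumOver-0 []       = refl
sumOver-0 (x ∷ xs) = trans (ℤₚ.+-identityˡ _) (sumOver-0 xs)

first-small : ∀ ℓ k n → n < suc k → sumOver (box ℓ (suc k)) (weight n ∘ (suc k ∷_)) ≡ + 0
first-small ℓ k n n<k = trans (sumOver-cong (box ℓ (suc k)) (λ {xs} _ → weight-small (suc k) n xs n<k)) (sumOver-0 (box ℓ (suc k)))

first-odd : ∀ ℓ k m → ¬ 2 ∣ suc k → sumOver (box ℓ (suc k)) (weight (suc k + m) ∘ (suc k ∷_)) ≡ count ℓ (suc k) m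
first-odd ℓ k m odd = sumOver-cong (box ℓ (suc k)) (λ {xs} _ → cong₂ indicator (hasSum-∷ (suc k) m xs) (admissible-odd (suc k) xs odd))

-- An even first part forbids a second copy of itself. The lists that continue with `suc k` drop
-- out, and for the others, with parts at most k, the new part repeats nothing.
first-even : ∀ ℓ k m → 2 ∣ suc k → sumOver (box ℓ (suc k)) (weight (suc k + m) ∘ (suc k ∷_)) ≡ count ℓ k m
first-even zero k m even = cong (_+ᶻ + 0) (cong₂ indicator (hasSum-∷ (suc k) m []) (admissible-even (suc k) [] even []))
first-even (suc ℓ) k m even = begin
  sumOver (map (suc k ∷_) (box ℓ (suc k)) ++ box (suc ℓ) k) w           ≡⟨ sumOver-++ (map (suc k ∷_) (box ℓ (suc k))) (box (suc ℓ) k) w ⟩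
  sumOver (map (suc k ∷_) (box ℓ (suc k))) w +ᶻ sumOver (box (suc ℓ) k) w ≡⟨ cong₂ _+ᶻ_ repeated fresh ⟩
  + 0 +ᶻ count (suc ℓ) k m                                              ≡⟨ ℤₚ.+-identityˡ (count (suc ℓ) k m) ⟩
  count (suc ℓ) k m                                                     ∎
  where
  open ≡-Reasoning
  w = weight (suc k + m) ∘ (suc k ∷_)
  repeated : sumOver (map (suc k ∷_) (box ℓ (suc k))) w ≡ + 0
  repeated = trans (sumOver-map (suc k ∷_) (box ℓ (suc k)) w) (trans (sumOver-cong (box ℓ (suc k)) (λ {xs} _ →
    trans (cong (indicator (hasSum (suc k + m) (suc k ∷ suc k ∷ xs))) (admissible-repeated (suc k) xs even)) (indicator-false _))) (sumOver-0 (box ℓ (suc k))))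
  fresh : sumOver (box (suc ℓ) k) w ≡ count (suc ℓ) k m
  fresh = sumOver-cong (box (suc ℓ) k) (λ {xs} xs∈ → cong₂ indicator (hasSum-∷ (suc k) m xs)
    (admissible-even (suc k) xs even (All.map (λ x≤k eq → ℕₚ.<⇒≢ (s≤s x≤k) (sym eq)) (box-bounded (suc ℓ) k xs∈))))

count-at-0 : ∀ ℓ k → count ℓ k 0 ≡ + 1
count-at-0 zero    k       = refl
count-at-0 (suc ℓ) zero    = refl
count-at-0 (suc ℓ) (suc k) = trans (count-split ℓ k 0) (cong₂ _+ᶻ_ (first-small ℓ k 0 (s≤s z≤n)) (count-at-0 (suc ℓ) k))

-- The bound on the parts after a first part suc k: even parts may not be repeated.
nextPart : ℕ → ℕ
nextPart k = if does (2 ∣? suc k) then k else suc k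

first-part : ∀ ℓ k m → sumOver (box ℓ (suc k)) (weight (suc k + m) ∘ (suc k ∷_)) ≡ count ℓ (nextPart k) m
first-part ℓ k m with 2 ∣? suc k in eq
... | yes even = trans (first-even ℓ k m even) (cong (λ d → count ℓ (if does d then k else suc k) m) (sym eq))
... | no  odd  = trans (first-odd ℓ k m odd) (cong (λ d → count ℓ (if does d then k else suc k) m) (sym eq))

-- Parts are positive, so removing a first part lowers n by at least as much as the bound on the
-- number of parts.
count-stable : ∀ ℓ ℓ′ k n → n ≤ ℓ → n ≤ ℓ′ → count ℓ k n ≡ count ℓ′ k n
count-stable zero    ℓ′       k       zero    p q = sym (count-at-0 ℓ′ k)
count-stable (suc ℓ) zero     k       zero    p q = count-at-0 (suc ℓ) k
count-stable (suc ℓ) (suc ℓ′) zero    n       p q = refl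
count-stable (suc ℓ) (suc ℓ′) (suc k) n       p q = trans (count-split ℓ k n)
  (trans (cong₂ _+ᶻ_ first (count-stable (suc ℓ) (suc ℓ′) k n p q)) (sym (count-split ℓ′ k n)))
  where
  first : sumOver (box ℓ (suc k)) (weight n ∘ (suc k ∷_)) ≡ sumOver (box ℓ′ (suc k)) (weight n ∘ (suc k ∷_))
  first with n ℕₚ.<? suc k
  ... | yes n<k = trans (first-small ℓ k n n<k) (sym (first-small ℓ′ k n n<k))
  ... | no  n≮k with ℕₚ.m≤n⇒∃[o]m+o≡n (ℕₚ.≮⇒≥ n≮k)
  ...   | m , refl = trans (first-part ℓ k m) (trans (count-stable ℓ ℓ′ (nextPart k) m
      (ℕₚ.≤-trans (ℕₚ.m≤n+m m k) (ℕₚ.≤-pred p)) (ℕₚ.≤-trans (ℕₚ.m≤n+m m k) (ℕₚ.≤-pred q))) (sym (first-part ℓ′ k m)))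

pedUpTo : ℕ → Series
pedUpTo k n = count n k n

pedUpTo-0 : pedUpTo 0 ≈ 1ˢ
pedUpTo-0 = pointwise λ { zero → refl ; (suc n) → refl }

pedUpTo-suc-small : ∀ k n → n < suc k → pedUpTo (suc k) n ≡ pedUpTo k n
pedUpTo-suc-small k zero    p = trans (count-at-0 0 (suc k)) (sym (count-at-0 0 k))
pedUpTo-suc-small k (suc n) p = trans (count-split n k (suc n)) (trans (cong (_+ᶻ count (suc n) k (suc n)) (first-small n k (suc n) p)) (ℤₚ.+-identityˡ _))

-- For odd `suc k` the recurrence contains its own left side, which encodes the factor 1/(1 - q^(k +
-- 1)); for even `suc k` it is multiplication by 1 + q^(k + 1).
pedUpTo-suc : ∀ k → pedUpTo (suc k) ≈ pedUpTo k +ˢ X ^ˢ suc k *ˢ pedUpTo (nextPart k)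
pedUpTo-suc k = pointwise go
  where
  go : ∀ n → pedUpTo (suc k) n ≡ pedUpTo k n +ᶻ (X ^ˢ suc k *ˢ pedUpTo (nextPart k)) n
  go n with n ℕₚ.<? suc k
  ... | yes n<k = trans (pedUpTo-suc-small k n n<k) (trans (sym (ℤₚ.+-identityʳ (pedUpTo k n)))
        (cong (pedUpTo k n +ᶻ_) (sym (X^-*ˢ-below (suc k) (pedUpTo (nextPart k)) n n<k))))
  ... | no  n≮k with ℕₚ.m≤n⇒∃[o]m+o≡n (ℕₚ.≮⇒≥ n≮k)
  ...   | m , refl = begin
    count (suc (k + m)) (suc k) (suc k + m)
      ≡⟨ count-split (k + m) k (suc k + m) ⟩
    sumOver (box (k + m) (suc k)) (weight (suc k + m) ∘ (suc k ∷_)) +ᶻ pedUpTo k (suc k + m)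
      ≡⟨ cong (_+ᶻ pedUpTo k (suc k + m)) (trans (first-part (k + m) k m) (count-stable (k + m) m (nextPart k) m (ℕₚ.m≤n+m m k) ℕₚ.≤-refl)) ⟩
    pedUpTo (nextPart k) m +ᶻ pedUpTo k (suc k + m)
      ≡⟨ ℤₚ.+-comm (pedUpTo (nextPart k) m) (pedUpTo k (suc k + m)) ⟩
    pedUpTo k (suc k + m) +ᶻ pedUpTo (nextPart k) m
      ≡⟨ cong (pedUpTo k (suc k + m) +ᶻ_) (sym (X^-*ˢ (suc k) (pedUpTo (nextPart k)) m)) ⟩
    pedUpTo k (suc k + m) +ᶻ (X ^ˢ suc k *ˢ pedUpTo (nextPart k)) (suc k + m) ∎
    where open ≡-Reasoning

pedUpTo-ped : ∀ n d → pedUpTo (d + n) n ≡ + ped n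
pedUpTo-ped n zero    = sym (ped-count n)
pedUpTo-ped n (suc d) = trans (pedUpTo-suc-small (d + n) n (s≤s (ℕₚ.m≤n+m n d))) (pedUpTo-ped n d)

2∤odd : ∀ j → ¬ 2 ∣ suc (j * 2)
2∤odd j p with ∣m+n∣m⇒∣n {2} {j * 2} {1} (subst (2 ∣_) (ℕₚ.+-comm 1 (j * 2)) p) (n∣m*n j)
... | divides zero    ()
... | divides (suc _) ()

nextPart-even : ∀ j → nextPart (j * 2) ≡ suc (j * 2)
nextPart-even j = cong (λ b → if b then j * 2 else suc (j * 2)) (dec-false (2 ∣? suc (j * 2)) (2∤odd j))

nextPart-odd : ∀ j → nextPart (suc (j * 2)) ≡ suc (j * 2)
nextPart-odd j = cong (λ b → if b then suc (j * 2) else suc (suc (j * 2))) (dec-true (2 ∣? suc j * 2) (n∣m*n (suc j)))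

-- The recurrence φ(q) Σ (−1)ⁿ ped(n) qⁿ = ψ(q)

partial : (ℕ → ℕ) → ℕ → Series
partial e zero    = 0ˢ
partial e (suc n) = partial e n +ˢ X ^ˢ e n

X^-at : ∀ a k → (X ^ˢ a) k ≡ (if does (a ≟ k) then + 1 else + 0)
X^-at a k = trans (sym (at (SR.*-identityʳ (X ^ˢ a)) k)) (go (k ℕₚ.<? a))
  where
  go : Dec (k < a) → (X ^ˢ a *ˢ 1ˢ) k ≡ (if does (a ≟ k) then + 1 else + 0)
  go (yes k<a) = trans (X^-*ˢ-below a 1ˢ k k<a) (cong (λ b → if b then + 1 else + 0) (sym (dec-false (a ≟ k) (λ a≡k → ℕₚ.<⇒≢ k<a (sym a≡k)))))
  go (no k≮a) with ℕₚ.m≤n⇒∃[o]m+o≡n (ℕₚ.≮⇒≥ k≮a)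
  ... | zero  , refl = trans (X^-*ˢ a 1ˢ 0) (cong (λ b → if b then + 1 else + 0) (sym (dec-true (a ≟ a + 0) (sym (ℕₚ.+-identityʳ a)))))
  ... | suc m , refl = trans (X^-*ˢ a 1ˢ (suc m)) (cong (λ b → if b then + 1 else + 0) (sym (dec-false (a ≟ a + suc m) (λ eq → ℕₚ.m≢1+m+n a (trans eq (ℕₚ.+-suc a m))))))

sumOver-filter-1 : ∀ {A : Set} {P : A → Set} (P? : ∀ x → Dec (P x)) xs →
  sumOver (filter P? xs) (λ _ → + 1) ≡ sumOver xs (λ x → if does (P? x) then + 1 else + 0)
sumOver-filter-1 P? []       = refl
sumOver-filter-1 P? (x ∷ xs) with does (P? x)
... | true  = cong (+ 1 +ᶻ_) (sumOver-filter-1 P? xs)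
... | false = trans (sumOver-filter-1 P? xs) (sym (ℤₚ.+-identityˡ _))

module _ (e : ℕ → ℕ) (b : ∀ i → i ≤ e i) where

  partial-upTo : ∀ n k → partial e n k ≡ sumOver (upTo n) (λ i → (X ^ˢ e i) k)
  partial-upTo zero    k = 0ˢ≡0 k
  partial-upTo (suc n) k = begin
    partial e n k +ᶻ (X ^ˢ e n) k                            ≡⟨ cong₂ _+ᶻ_ (partial-upTo n k) (sym (ℤₚ.+-identityʳ _)) ⟩
    sumOver (upTo n) w +ᶻ sumOver (n ∷ []) w                 ≡⟨ sumOver-++ (upTo n) (n ∷ []) w ⟨
    sumOver (upTo n ++ n ∷ []) w                             ≡⟨ cong (λ xs → sumOver xs w) (upTo-∷ʳ n) ⟩
    sumOver (upTo (suc n)) w                                 ∎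
    where
    open ≡-Reasoning
    w = λ i → (X ^ˢ e i) k

  partial-enough : ∀ d k → partial e (d + suc k) k ≡ partial e (suc k) k
  partial-enough zero    k = refl
  partial-enough (suc d) k = trans (cong₂ _+ᶻ_ (partial-enough d k) zero-term) (ℤₚ.+-identityʳ (partial e (suc k) k))
    where
    large : k < e (d + suc k)
    large = ℕₚ.≤-trans (ℕₚ.m≤n+m (suc k) d) (b (d + suc k))
    zero-term : (X ^ˢ e (d + suc k)) k ≡ + 0
    zero-term = trans (X^-at (e (d + suc k)) k) (cong (λ b → if b then + 1 else + 0) (dec-false (e (d + suc k) ≟ k) (λ eq → ℕₚ.<⇒≢ large (sym eq))))

  partial-gf : ∀ n k → k < n → partial e n k ≡ gf (overℕ e b) k
  partial-gf n k k<n with ℕₚ.m≤n⇒∃[o]m+o≡n k<n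
  ... | d , refl = begin
    partial e (suc k + d) k ≡⟨ cong (λ m → partial e m k) (ℕₚ.+-comm (suc k) d) ⟩
    partial e (d + suc k) k ≡⟨ partial-enough d k ⟩
    partial e (suc k) k     ≡⟨ partial-upTo (suc k) k ⟩
    sumOver (upTo (suc k)) (λ i → (X ^ˢ e i) k) ≡⟨ sumOver-cong (upTo (suc k)) (λ {i} _ → X^-at (e i) k) ⟩
    sumOver (upTo (suc k)) (λ i → if does (e i ≟ k) then + 1 else + 0) ≡⟨ sumOver-filter-1 (λ i → e i ≟ k) (upTo (suc k)) ⟨
    gf (overℕ e b) k        ∎
    where open ≡-Reasoning

-- The products after the substitution q ↦ -q

-X : Series
-X = -ˢ X

open module Sq = SquareSum -X using () renaming (sum to squareSum; remainder to squareRemainder)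
open module Tr = TriangleSum X using (odd; oddFactors; evenFactorsFrom) renaming (p to X²; sum to triangleSum; remainder to triangleRemainder)

-X^-even : ∀ k → -X ^ˢ (k * 2) ≈ X² ^ˢ k
-X^-even zero    = ≈-refl
-X^-even (suc k) = ≈-trans (*ˢ-cong ≈-refl (*ˢ-cong ≈-refl (-X^-even k)))
  (solve 2 (λ x a → (:- x) :* ((:- x) :* a) := x :* x :* a) ≈-refl X (X² ^ˢ k))

-X^-odd : ∀ k → -X ^ˢ suc (k * 2) ≈ -ˢ odd k
-X^-odd k = ≈-trans (*ˢ-cong ≈-refl (-X^-even k)) (solve 2 (λ x a → (:- x) :* a := :- (x :* a)) ≈-refl X (X² ^ˢ k))

X²^ : ∀ k → X² ^ˢ k ≈ X ^ˢ (k * 2)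
X²^ zero    = ≈-refl
X²^ (suc k) = ≈-trans (*ˢ-cong ≈-refl (X²^ k)) (SR.*-assoc X X (X ^ˢ (k * 2)))

odd≈X^ : ∀ k → odd k ≈ X ^ˢ suc (k * 2)
odd≈X^ k = *ˢ-cong ≈-refl (X²^ k)

plusOdd plusEven : ℕ → Series
plusOdd zero     = 1ˢ
plusOdd (suc n)  = plusOdd n *ˢ (1ˢ +ˢ odd n)
plusEven zero    = 1ˢ
plusEven (suc n) = plusEven n *ˢ (1ˢ +ˢ X² ^ˢ suc n)

plusFactors-split : ∀ n → Sq.plusFactors (n * 2) ≈ oddFactors n *ˢ plusEven n
plusFactors-split zero    = ≈-sym (SR.*-identityˡ 1ˢ)
plusFactors-split (suc n) = ≈-trans (*ˢ-cong (*ˢ-cong (plusFactors-split n) (+ˢ-cong {1ˢ} ≈-refl (-X^-odd n))) (+ˢ-cong {1ˢ} ≈-refl (-X^-even (suc n))))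
  (solve 4 (λ a b c d → a :* b :* (con (+ 1) :+ (:- c)) :* (con (+ 1) :+ d) := a :* (con (+ 1) :- c) :* (b :* (con (+ 1) :+ d))) ≈-refl (oddFactors n) (plusEven n) (odd n) (X² ^ˢ suc n))

factors-split : ∀ n → Sq.factorsFrom 0 (n * 2) ≈ plusOdd n *ˢ evenFactorsFrom 0 n
factors-split zero    = ≈-sym (SR.*-identityˡ 1ˢ)
factors-split (suc n) = ≈-trans (Sq.factorsFrom-last 0 (suc (n * 2))) (≈-trans
  (*ˢ-cong (≈-trans (Sq.factorsFrom-last 0 (n * 2)) (*ˢ-cong (factors-split n) (+ˢ-cong {1ˢ} ≈-refl (-ˢ-cong (-X^-odd n))))) (+ˢ-cong {1ˢ} ≈-refl (-ˢ-cong (-X^-even (suc n)))))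
  (≈-trans (solve 4 (λ a b c d → a :* b :* (con (+ 1) :- (:- c)) :* (con (+ 1) :- d) := a :* (con (+ 1) :+ c) :* (b :* (con (+ 1) :- d))) ≈-refl (plusOdd n) (evenFactorsFrom 0 n) (odd n) (X² ^ˢ suc n))
    (*ˢ-cong ≈-refl (≈-sym (Tr.evenFactorsFrom-last 0 n)))))

twist-X^ : ∀ k f → twist (X ^ˢ k *ˢ f) ≈ -X ^ˢ k *ˢ twist f
twist-X^ k f = ≈-trans (twist-* (X ^ˢ k) f) (*ˢ-cong (go k) ≈-refl)
  where
  twist-zero : ∀ n → twist (λ _ → + 0) n ≡ + 0
  twist-zero zero    = refl
  twist-zero (suc n) = cong -ᶻ_ (twist-zero n)
  twist-1 : twist 1ˢ ≈ 1ˢ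
  twist-1 = pointwise λ { zero → refl ; (suc n) → cong -ᶻ_ (twist-zero n) }
  twist-X : twist X ≈ -X
  twist-X = pointwise λ { zero → refl ; (suc n) → cong -ᶻ_ (at twist-1 n) }
  go : ∀ k → twist (X ^ˢ k) ≈ -X ^ˢ k
  go zero    = twist-1
  go (suc k) = ≈-trans (twist-* X (X ^ˢ k)) (*ˢ-cong twist-X (go k))

signedPedUpTo : ℕ → Series
signedPedUpTo k = twist (pedUpTo k)

signedPedUpTo-suc : ∀ k → signedPedUpTo (suc k) ≈ signedPedUpTo k +ˢ -X ^ˢ suc k *ˢ signedPedUpTo (nextPart k)
signedPedUpTo-suc k = ≈-trans (pointwise λ n → twist-at n (at (pedUpTo-suc k)))
  (≈-trans (pointwise λ n → twist-+-at n (pedUpTo k) (X ^ˢ suc k *ˢ pedUpTo (nextPart k)))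
    (+ˢ-cong {signedPedUpTo k} ≈-refl (twist-X^ (suc k) (pedUpTo (nextPart k)))))

-- The truncated product ∏ (1 + q^(2k))/(1 + q^(2k - 1)), cleared of denominators. The step for an
-- odd part, which refers to itself, is solved for the previous series; the step for an even part
-- then contributes its factor.
signedPedUpTo-product : ∀ n → signedPedUpTo (n * 2) *ˢ plusOdd n ≈ plusEven n
signedPedUpTo-product zero    = ≈-trans (SR.*-identityʳ (signedPedUpTo 0)) (pointwise λ n → trans (twist-at n (at pedUpTo-0)) (go n))
  where
  go : ∀ n → twist 1ˢ n ≡ 1ˢ n
  go zero    = refl
  go (suc n) = trans (cong -ᶻ_ (zeros n)) refl
    where
    zeros : ∀ n → twist (λ _ → + 0) n ≡ + 0
    zeros zero    = refl
    zeros (suc n) = cong -ᶻ_ (zeros n)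
signedPedUpTo-product (suc n) = begin
  signedPedUpTo (suc (suc (n * 2))) *ˢ (o *ˢ (1ˢ +ˢ odd n)) ≈⟨ *ˢ-cong even ≈-refl ⟩
  (d +ˢ b *ˢ d) *ˢ (o *ˢ (1ˢ +ˢ odd n))        ≈⟨ solve 4 (λ d b o w → (d :+ b :* d) :* (o :* (con (+ 1) :+ w)) := (d :- (:- w) :* d) :* o :* (con (+ 1) :+ b)) ≈-refl d b o (odd n) ⟩
  (d -ˢ (-ˢ odd n) *ˢ d) *ˢ o *ˢ (1ˢ +ˢ b)     ≈⟨ *ˢ-cong (*ˢ-cong previous ≈-refl) ≈-refl ⟩
  signedPedUpTo (n * 2) *ˢ o *ˢ (1ˢ +ˢ b)      ≈⟨ *ˢ-cong (signedPedUpTo-product n) ≈-refl ⟩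
  plusEven n *ˢ (1ˢ +ˢ b)                      ∎
  where
  open ≈-Reasoning
  d = signedPedUpTo (suc (n * 2))
  b = X² ^ˢ suc n
  o = plusOdd n
  even : signedPedUpTo (suc (suc (n * 2))) ≈ d +ˢ b *ˢ d
  even = ≈-trans (signedPedUpTo-suc (suc (n * 2))) (+ˢ-cong {d} ≈-refl (*ˢ-cong (-X^-even (suc n)) (≡⇒≈ (cong signedPedUpTo (nextPart-odd n)))))
  odd-step : d ≈ signedPedUpTo (n * 2) +ˢ (-ˢ odd n) *ˢ d
  odd-step = ≈-trans (signedPedUpTo-suc (n * 2)) (+ˢ-cong {signedPedUpTo (n * 2)} ≈-refl (*ˢ-cong (-X^-odd n) (≡⇒≈ (cong signedPedUpTo (nextPart-even n)))))
  previous : d -ˢ (-ˢ odd n) *ˢ d ≈ signedPedUpTo (n * 2)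
  previous = ≈-trans (+ˢ-cong {g = -ˢ ((-ˢ odd n) *ˢ d)} odd-step ≈-refl)
    (solve 2 (λ a b → a :+ b :- b := a) ≈-refl (signedPedUpTo (n * 2)) ((-ˢ odd n) *ˢ d))

-- Equality of series up to a given degree

infix 4 _≈_below_
_≈_below_ : Series → Series → ℕ → Set
f ≈ g below K = ∀ {k} → k < K → f k ≡ g k

below⇒Below : ∀ {f g K} → f ≈ g below K → Below K (f -ˢ g)
below⇒Below {f} {g} p {k} k<K = trans (cong (_-ᶻ g k) (p k<K)) (ℤₚ.+-inverseʳ (g k))

Below⇒below : ∀ {f g K} → Below K (f -ˢ g) → f ≈ g below K
Below⇒below {f} {g} p {k} k<K = ℤₚ.i-j≡0⇒i≡j (f k) (g k) (p k<K)

Below-≈ : ∀ {f g K} → f ≈ g → Below K f → Below K g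
Below-≈ p b k<K = trans (sym (at p _)) (b k<K)

Below-+ : ∀ {f g K} → Below K f → Below K g → Below K (f +ˢ g)
Below-+ a b k<K = cong₂ _+ᶻ_ (a k<K) (b k<K)

below-* : ∀ {f f′ g g′ K} → f ≈ f′ below K → g ≈ g′ below K → f *ˢ g ≈ f′ *ˢ g′ below K
below-* {f} {f′} {g} {g′} {K} p q = Below⇒below {f *ˢ g} {f′ *ˢ g′} {K} (Below-≈ {(f -ˢ f′) *ˢ g +ˢ (g -ˢ g′) *ˢ f′} {f *ˢ g -ˢ f′ *ˢ g′}
  (solve 4 (λ f f′ g g′ → (f :- f′) :* g :+ (g :- g′) :* f′ := f :* g :- f′ :* g′) ≈-refl f f′ g g′)
  (Below-+ {(f -ˢ f′) *ˢ g} {(g -ˢ g′) *ˢ f′} (Below-*ˢ g (below⇒Below {f} {f′} p)) (Below-*ˢ f′ (below⇒Below {g} {g′} q))))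

Below-raise : ∀ {K} f g → f 0 ≡ + 0 → Below K g → Below (suc K) (f *ˢ g)
Below-raise f g f0 b {zero}  _         = trans (cong (_*ᶻ g 0) f0) (ℤₚ.*-zeroˡ (g 0))
Below-raise f g f0 b {suc k} (s≤s k<K) = cong₂ _+ᶻ_ (trans (cong (_*ᶻ g (suc k)) f0) (ℤₚ.*-zeroˡ (g (suc k))))
  (trans (*ˢ-comm-at k (tail f) g) (Below-*ˢ (tail f) b k<K))

Below-^ : ∀ k f → f 0 ≡ + 0 → Below k (f ^ˢ k)
Below-^ zero    f f0 ()
Below-^ (suc k) f f0 = Below-raise f (f ^ˢ k) f0 (Below-^ k f f0)

squareRemainder-Below : ∀ K t m → K ≤ t + m → Below K (squareRemainder t m)
squareRemainder-Below K t zero    K≤ {k} _ = 0ˢ≡0 k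
squareRemainder-Below K t (suc m) K≤ = Below-+ {Sq.term t m} {squareRemainder (suc t) m}
  (Below-≈ {v *ˢ (c *ˢ e *ˢ r *ˢ s)} {Sq.term t m} (solve 5 (λ v c e r s → v :* (c :* e :* r :* s) := c :* (v :* e) :* r :* s) ≈-refl v c e r s)
    (Below-*ˢ (c *ˢ e *ˢ r *ˢ s) (Below-≤ (ℕₚ.m≤n⇒m≤1+n K≤) {v} (Below-^ (suc (t + suc m)) -X refl))))
  (squareRemainder-Below K (suc t) m (subst (K ≤_) (ℕₚ.+-suc t m) K≤))
  where
  v = -X ^ˢ suc (t + suc m)
  c = Sq.coeff (suc t)
  e = v ^ˢ t
  r = Sq.factorsFrom (suc t) m
  s = Sq.plusFactors t

odd-Below : ∀ n → Below (suc n) (odd n)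
odd-Below n = Below-raise X (X² ^ˢ n) refl (Below-^ n X² refl)

triangleRemainder-Below : ∀ K t m → K ≤ suc t + m → Below K (triangleRemainder (suc t) m)
triangleRemainder-Below K t zero    K≤ {k} _ = 0ˢ≡0 k
triangleRemainder-Below K t (suc m) K≤ = Below-+ {Tr.term (suc t) m} {triangleRemainder (suc (suc t)) m}
  (Below-≈ {v *ˢ (e *ˢ r *ˢ s)} {Tr.term (suc t) m} (solve 4 (λ v e r s → v :* (e :* r :* s) := r :* s :* (v :* e)) ≈-refl v e r s)
    (Below-*ˢ (e *ˢ r *ˢ s) (Below-≤ (ℕₚ.m≤n⇒m≤1+n K≤) {v} (odd-Below (suc t + suc m)))))
  (triangleRemainder-Below K (suc t) m (subst (K ≤_) (ℕₚ.+-suc (suc t) m) K≤))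
  where
  v = odd (suc t + suc m)
  e = v ^ˢ t
  r = evenFactorsFrom (suc t) (suc m)
  s = oddFactors (suc t)

const-term-1 : ∀ f g → f 0 ≡ + 1 → g 0 ≡ + 1 → (f *ˢ g) 0 ≡ + 1
const-term-1 f g p q = cong₂ _*ᶻ_ p q

oddFactors-0 : ∀ n → oddFactors n 0 ≡ + 1
oddFactors-0 zero    = refl
oddFactors-0 (suc n) = const-term-1 (oddFactors n) (1ˢ -ˢ odd n) (oddFactors-0 n) (cong (λ a → + 1 -ᶻ a) (odd-Below n (s≤s z≤n)))

plusEven-0 : ∀ n → plusEven n 0 ≡ + 1
plusEven-0 zero    = refl
plusEven-0 (suc n) = const-term-1 (plusEven n) (1ˢ +ˢ X² ^ˢ suc n) (plusEven-0 n) (cong (λ a → + 1 +ᶻ a) (Below-^ (suc n) X² refl (s≤s z≤n)))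

-- Multiplication by `P` and `E` turns both sums into Gauss's products: P E Φ = M N + Z₁ and P Ψ = N
-- + Z₂. Since D M = E, the main parts cancel, and Z₁ D - Z₂ E has no terms up to degree n. The
-- multiplier P E has constant term 1 and is cancelled again.
finite-recurrence : ∀ n → signedPedUpTo (suc n * 2) *ˢ squareSum (suc n * 2) ≈ triangleSum (suc n) below suc n
finite-recurrence n = Below⇒below {D *ˢ Φ} {Ψ} (Below-cancel (P *ˢ E) (D *ˢ Φ -ˢ Ψ)
  (const-term-1 P E (oddFactors-0 (suc n)) (plusEven-0 (suc n)))
  (Below-≈ {Z₁ *ˢ D +ˢ Z₂ *ˢ (-ˢ E)} {P *ˢ E *ˢ (D *ˢ Φ -ˢ Ψ)} (≈-sym identity)
    (Below-+ {Z₁ *ˢ D} {Z₂ *ˢ (-ˢ E)}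
      (Below-*ˢ D (squareRemainder-Below (suc n) 0 (suc n * 2) (ℕₚ.m≤m*n (suc n) 2)))
      (Below-*ˢ (-ˢ E) (triangleRemainder-Below (suc n) 0 n ℕₚ.≤-refl)))))
  where
  open ≈-Reasoning
  D = signedPedUpTo (suc n * 2)
  Φ = squareSum (suc n * 2)
  Ψ = triangleSum (suc n)
  P = oddFactors (suc n)
  E = plusEven (suc n)
  M = plusOdd (suc n)
  N = evenFactorsFrom 0 (suc n)
  Z₁ = squareRemainder 0 (suc n * 2)
  Z₂ = triangleRemainder 1 n
  squares : P *ˢ E *ˢ Φ ≈ M *ˢ N +ˢ Z₁
  squares = ≈-trans (*ˢ-cong (≈-sym (plusFactors-split (suc n))) ≈-refl) (≈-trans (Sq.shanks (suc n * 2)) (+ˢ-cong {g = Z₁} (factors-split (suc n)) ≈-refl))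
  triangles : P *ˢ Ψ ≈ N +ˢ Z₂
  triangles = ≈-trans (Tr.shanks (suc n)) (+ˢ-cong {g = Z₂} (≈-trans (SR.*-identityʳ (N *ˢ 1ˢ)) (SR.*-identityʳ N)) ≈-refl)
  identity : P *ˢ E *ˢ (D *ˢ Φ -ˢ Ψ) ≈ Z₁ *ˢ D +ˢ Z₂ *ˢ (-ˢ E)
  identity = begin
    P *ˢ E *ˢ (D *ˢ Φ -ˢ Ψ)                        ≈⟨ solve 5 (λ P E D Φ Ψ → P :* E :* (D :* Φ :- Ψ) := D :* (P :* E :* Φ) :- E :* (P :* Ψ)) ≈-refl P E D Φ Ψ ⟩
    D *ˢ (P *ˢ E *ˢ Φ) -ˢ E *ˢ (P *ˢ Ψ)            ≈⟨ +ˢ-cong (*ˢ-cong {D} ≈-refl squares) (-ˢ-cong (*ˢ-cong {E} ≈-refl triangles)) ⟩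
    D *ˢ (M *ˢ N +ˢ Z₁) -ˢ E *ˢ (N +ˢ Z₂)          ≈⟨ solve 6 (λ D M N Z E Z′ → D :* (M :* N :+ Z) :- E :* (N :+ Z′) := D :* M :* N :- E :* N :+ (Z :* D :+ Z′ :* (:- E))) ≈-refl D M N Z₁ E Z₂ ⟩
    D *ˢ M *ˢ N -ˢ E *ˢ N +ˢ (Z₁ *ˢ D +ˢ Z₂ *ˢ (-ˢ E)) ≈⟨ +ˢ-cong {g = Z₁ *ˢ D +ˢ Z₂ *ˢ (-ˢ E)} (+ˢ-cong {g = -ˢ (E *ˢ N)} (*ˢ-cong (signedPedUpTo-product (suc n)) ≈-refl) ≈-refl) ≈-refl ⟩
    E *ˢ N -ˢ E *ˢ N +ˢ (Z₁ *ˢ D +ˢ Z₂ *ˢ (-ˢ E))  ≈⟨ solve 2 (λ a b → a :- a :+ b := b) ≈-refl (E *ˢ N) (Z₁ *ˢ D +ˢ Z₂ *ˢ (-ˢ E)) ⟩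
    Z₁ *ˢ D +ˢ Z₂ *ˢ (-ˢ E)                        ∎

-- Gauss's finite sums as truncations of φ and ψ

-1ˢ : Series
-1ˢ = -ˢ 1ˢ

coeff≈ : ∀ s → Sq.coeff s ≈ const (+ 2) *ˢ -1ˢ ^ˢ s
coeff≈ zero    = ≈-sym (SR.*-identityʳ (const (+ 2)))
coeff≈ (suc s) = ≈-trans (-ˢ-cong (coeff≈ s)) (solve 2 (λ c e → :- (c :* e) := c :* ((:- con (+ 1)) :* e)) ≈-refl (const (+ 2)) (-1ˢ ^ˢ s))

-1^-even : ∀ k → -1ˢ ^ˢ (k * 2) ≈ 1ˢ
-1^-even zero    = ≈-refl
-1^-even (suc k) = ≈-trans (*ˢ-cong ≈-refl (*ˢ-cong ≈-refl (-1^-even k))) (solve 0 ((:- con (+ 1)) :* ((:- con (+ 1)) :* con (+ 1)) := con (+ 1)) ≈-refl)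

-- At -X the sign (-1)^s of Gauss's sum meets (-1)^(s²), and the joint exponent s + s² = 2 · `tri s`
-- is even. This is how φ comes out with positive coefficients.
square-term : ∀ s → Sq.coeff s *ˢ (-X ^ˢ s) ^ˢ s ≈ const (+ 2) *ˢ X ^ˢ sq s
square-term s = begin
  Sq.coeff s *ˢ (-X ^ˢ s) ^ˢ s                             ≈⟨ *ˢ-cong (coeff≈ s) (≈-trans (^ˢ-cong s (≈-trans (^ˢ-cong s split) (^ˢ-distrib-* -1ˢ X s))) (^ˢ-distrib-* (-1ˢ ^ˢ s) (X ^ˢ s) s)) ⟩
  const (+ 2) *ˢ -1ˢ ^ˢ s *ˢ ((-1ˢ ^ˢ s) ^ˢ s *ˢ (X ^ˢ s) ^ˢ s) ≈⟨ solve 4 (λ c a b x → c :* a :* (b :* x) := c :* (a :* b :* x)) ≈-refl (const (+ 2)) (-1ˢ ^ˢ s) ((-1ˢ ^ˢ s) ^ˢ s) ((X ^ˢ s) ^ˢ s) ⟩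
  const (+ 2) *ˢ ((-1ˢ ^ˢ s) ^ˢ suc s *ˢ (X ^ˢ s) ^ˢ s)    ≈⟨ *ˢ-cong ≈-refl (*ˢ-cong (≈-trans (^ˢ-* -1ˢ s (suc s)) (≈-trans (≡⇒≈ (cong (-1ˢ ^ˢ_) (trans (ℕₚ.*-comm (suc s) s) (sym (2*tri s))))) (-1^-even (tri s)))) (^ˢ-* X s s)) ⟩
  const (+ 2) *ˢ (1ˢ *ˢ X ^ˢ sq s)                         ≈⟨ *ˢ-cong ≈-refl (SR.*-identityˡ (X ^ˢ sq s)) ⟩
  const (+ 2) *ˢ X ^ˢ sq s                                 ∎
  where
  open ≈-Reasoning
  split : -X ≈ -1ˢ *ˢ X
  split = solve 1 (λ x → :- x := (:- con (+ 1)) :* x) ≈-refl X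

squareSum≈ : ∀ n → squareSum n ≈ 1ˢ +ˢ const (+ 2) *ˢ partial (sq ∘ suc) n
squareSum≈ zero    = solve 0 (con (+ 1) := con (+ 1) :+ con (+ 2) :* con (+ 0)) ≈-refl
squareSum≈ (suc n) = ≈-trans (+ˢ-cong (squareSum≈ n) (square-term (suc n)))
  (solve 2 (λ a b → con (+ 1) :+ con (+ 2) :* a :+ con (+ 2) :* b := con (+ 1) :+ con (+ 2) :* (a :+ b)) ≈-refl (partial (sq ∘ suc) n) (X ^ˢ sq (suc n)))

squareSum-φ : ∀ n → squareSum n ≈ φ below n
squareSum-φ n {k} k<n = begin
  squareSum n k                                    ≡⟨ at (squareSum≈ n) k ⟩
  1ˢ k +ᶻ (const (+ 2) *ˢ partial (sq ∘ suc) n) k  ≡⟨ cong (1ˢ k +ᶻ_) (trans (const-*ˢ-at k (+ 2) (partial (sq ∘ suc) n)) (cong (+ 2 *ᶻ_) (partial-gf (sq ∘ suc) n≤sq-suc n k k<n))) ⟩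
  1ˢ k +ᶻ + 2 *ᶻ S k                               ≡⟨ cong (1ˢ k +ᶻ_) (const-*ˢ-at k (+ 2) S) ⟨
  1ˢ k +ᶻ (const (+ 2) *ˢ S) k                     ≡⟨ at φ≈1+2S k ⟨
  φ k                                              ∎
  where open ≡-Reasoning

triangleSum≈ : ∀ n → triangleSum n ≈ partial tri (n * 2)
triangleSum≈ zero    = ≈-refl
triangleSum≈ (suc n) = ≈-trans (+ˢ-cong (triangleSum≈ n) (+ˢ-cong even-term (≈-trans (*ˢ-cong even-term (odd≈X^ n))
    (≈-trans (≈-sym (^ˢ-+ X (tri (n * 2)) (suc (n * 2)))) (≡⇒≈ (cong (X ^ˢ_) (ℕₚ.+-comm (tri (n * 2)) (suc (n * 2)))))))))
  (≈-sym (SR.+-assoc (partial tri (n * 2)) (X ^ˢ tri (n * 2)) (X ^ˢ tri (suc (n * 2)))))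
  where
  exponent : n * suc (n * 2) ≡ tri (n * 2)
  exponent = ℕₚ.*-cancelʳ-≡ (n * suc (n * 2)) (tri (n * 2)) 2 (trans (lemma n) (sym (2*tri (n * 2))))
    where
    lemma : ∀ n → n * suc (n * 2) * 2 ≡ n * 2 * suc (n * 2)
    lemma = ℕ-ring
  even-term : odd n ^ˢ n ≈ X ^ˢ tri (n * 2)
  even-term = ≈-trans (^ˢ-cong n (odd≈X^ n)) (≈-trans (^ˢ-* X (suc (n * 2)) n) (≡⇒≈ (cong (X ^ˢ_) exponent)))

signedPed : Series
signedPed = twist (λ n → + ped n)

twist-sign : ∀ n f → twist f n ≡ f n ⊎ twist f n ≡ -ᶻ f n
twist-sign zero    f = inj₁ refl
twist-sign (suc n) f with twist-sign n (tail f)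
... | inj₁ p = inj₂ (cong -ᶻ_ p)
... | inj₂ p = inj₁ (trans (cong -ᶻ_ p) (ℤₚ.neg-involutive (f (suc n))))

twist-below : ∀ k f g → f k ≡ g k → twist f k ≡ twist g k
twist-below zero    f g p = p
twist-below (suc k) f g p = cong -ᶻ_ (twist-below k (tail f) (tail g) p)

signedPed-recurrence : signedPed *ˢ φ ≈ ψ
signedPed-recurrence = pointwise λ k → begin
  (signedPed *ˢ φ) k                                            ≡⟨ below-* {signedPed} {signedPedUpTo (suc k * 2)} {φ} {squareSum (suc k * 2)} {suc k}
      (λ {j} j≤k → twist-below j _ _ (sym (large j j≤k)))
      (λ j≤k → sym (squareSum-φ (suc k * 2) (ℕₚ.<-≤-trans j≤k (ℕₚ.m≤m*n (suc k) 2)))) ℕₚ.≤-refl ⟩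
  (signedPedUpTo (suc k * 2) *ˢ squareSum (suc k * 2)) k        ≡⟨ finite-recurrence k ℕₚ.≤-refl ⟩
  triangleSum (suc k) k                                         ≡⟨ at (triangleSum≈ (suc k)) k ⟩
  partial tri (suc k * 2) k                                     ≡⟨ partial-gf tri n≤tri (suc k * 2) k (ℕₚ.m≤m*n (suc k) 2) ⟩
  ψ k                                                           ∎
  where
  open ≡-Reasoning
  large : ∀ {k} j → j < suc k → pedUpTo (suc k * 2) j ≡ + ped j
  large {k} j j≤k = subst (λ m → pedUpTo m j ≡ + ped j) (ℕₚ.m∸n+n≡m (ℕₚ.≤-trans (ℕₚ.<⇒≤ j≤k) (ℕₚ.m≤m*n (suc k) 2))) (pedUpTo-ped j (suc k * 2 ∸ j))

-- Divisibility of ped(9n + 7) by 3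

mod-*ˢ-at : ∀ m n f u → (∀ {k} → k < n → ∃ λ c → f k ≡ m *ᶻ c) → ∃ λ c → (f *ˢ u) n ≡ f n *ᶻ u 0 +ᶻ m *ᶻ c
mod-*ˢ-at m zero    f u p = + 0 , sym (trans (cong (f 0 *ᶻ u 0 +ᶻ_) (ℤₚ.*-zeroʳ m)) (ℤₚ.+-identityʳ (f 0 *ᶻ u 0)))
mod-*ˢ-at m (suc n) f u p with p (s≤s z≤n) | mod-*ˢ-at m n (tail f) u (λ k<n → p (s≤s k<n))
... | c , q | d , r = c *ᶻ u (suc n) +ᶻ d , trans (cong₂ (λ a b → a *ᶻ u (suc n) +ᶻ b) q r) (lemma m c (u (suc n)) (f (suc n) *ᶻ u 0) d)
  where
  lemma : ∀ m c u a d → m *ᶻ c *ᶻ u +ᶻ (a +ᶻ m *ᶻ d) ≡ a +ᶻ m *ᶻ (c *ᶻ u +ᶻ d)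
  lemma = ℤ-ring

-- Division by u modulo m without inverting u: in degree n the product is `f n` plus multiples of
-- lower coefficients of f, which are divisible by m by induction.
mod-cancel : ∀ m u f h → u 0 ≡ + 1 → u *ˢ f ≈ const m *ˢ h → ∀ n → ∃ λ c → f n ≡ m *ᶻ c
mod-cancel m u f h u0 p = <-rec _ λ n rec → step n (λ k<n → rec k<n)
  where
  lemma : ∀ a b c → a +ᶻ b ≡ c → a ≡ c -ᶻ b
  lemma a b c refl = sym (trans (ℤₚ.+-assoc a b (-ᶻ b)) (trans (cong (a +ᶻ_) (ℤₚ.+-inverseʳ b)) (ℤₚ.+-identityʳ a)))
  factor : ∀ m a b → m *ᶻ a -ᶻ m *ᶻ b ≡ m *ᶻ (a -ᶻ b)
  factor = ℤ-ring
  step : ∀ n → (∀ {k} → k < n → ∃ λ c → f k ≡ m *ᶻ c) → ∃ λ c → f n ≡ m *ᶻ c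
  step n rec = let c , q = mod-*ˢ-at m n f u rec in h n -ᶻ c , (begin
    f n                        ≡⟨ ℤₚ.*-identityʳ (f n) ⟨
    f n *ᶻ + 1                 ≡⟨ cong (f n *ᶻ_) u0 ⟨
    f n *ᶻ u 0                 ≡⟨ lemma (f n *ᶻ u 0) (m *ᶻ c) ((f *ˢ u) n) (sym q) ⟩
    (f *ˢ u) n -ᶻ m *ᶻ c       ≡⟨ cong (_-ᶻ m *ᶻ c) (trans (*ˢ-comm-at n f u) (trans (at p n) (const-*ˢ-at n m h))) ⟩
    m *ᶻ h n -ᶻ m *ᶻ c         ≡⟨ factor m (h n) c ⟩
    m *ᶻ (h n -ᶻ c)            ∎)
    where open ≡-Reasoning

mod-sec : ∀ {f g m} k r → f ≈ g mod m → sec k r f ≈ sec k r g mod m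
mod-sec {f} {g} {m} k r (by h p) = by (sec k r h) $ pointwise λ n → trans (at p (r + n * k))
  (cong (g (r + n * k) +ᶻ_) (trans (const-*ˢ-at (r + n * k) m h) (sym (const-*ˢ-at n m (sec k r h)))))

sec-const-* : ∀ k r c f → sec k r (const c *ˢ f) ≈ const c *ˢ sec k r f
sec-const-* k r c f = pointwise λ n → trans (const-*ˢ-at (r + n * k) c f) (sym (const-*ˢ-at n c (sec k r f)))

d3-sec : ∀ r → r < 3 → ∀ f g → sec 3 r (d3 f *ˢ g) ≈ f *ˢ sec 3 r g
d3-sec r r<3 f g = pointwise λ n → d3-*-sec r r<3 n f g

sec₁-expansion : ∀ g₀ g₁ g₂ g₃ → sec 3 1 (d3 g₀ *ˢ 1ˢ +ˢ d3 g₁ *ˢ X +ˢ d3 g₂ *ˢ (X *ˢ X) +ˢ d3 g₃ *ˢ (X *ˢ (X *ˢ X))) ≈ g₁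
sec₁-expansion g₀ g₁ g₂ g₃ = ≈-trans
  (+ˢ-cong (+ˢ-cong (+ˢ-cong
    (≈-trans (d3-sec 1 1<3 g₀ 1ˢ) (*ˢ-cong {g₀} ≈-refl s₀))
    (≈-trans (d3-sec 1 1<3 g₁ X) (*ˢ-cong {g₁} ≈-refl s₁)))
    (≈-trans (d3-sec 1 1<3 g₂ (X *ˢ X)) (*ˢ-cong {g₂} ≈-refl s₂)))
    (≈-trans (d3-sec 1 1<3 g₃ (X *ˢ (X *ˢ X))) (*ˢ-cong {g₃} ≈-refl s₃)))
  (solve 4 (λ a b c d → a :* con (+ 0) :+ b :* con (+ 1) :+ c :* con (+ 0) :+ d :* con (+ 0) := b) ≈-refl g₀ g₁ g₂ g₃)
  where
  1<3 : 1 < 3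
  1<3 = s≤s (s≤s z≤n)
  s₀ : sec 3 1 1ˢ ≈ 0ˢ
  s₀ = pointwise λ n → sym (0ˢ≡0 n)
  s₁ : sec 3 1 X ≈ 1ˢ
  s₁ = pointwise λ { zero → refl ; (suc n) → refl }
  s₂ : sec 3 1 (X *ˢ X) ≈ 0ˢ
  s₂ = pointwise λ { zero → refl ; (suc n) → X-*ˢ-suc X (3 + n * 3) }
  s₃ : sec 3 1 (X *ˢ (X *ˢ X)) ≈ 0ˢ
  s₃ = pointwise λ { zero → refl ; (suc n) → trans (X-*ˢ-suc (X *ˢ X) (3 + n * 3)) (X-*ˢ-suc X (2 + n * 3)) }

φ-0 : φ 0 ≡ + 1
φ-0 = refl

-- Write ψ = a + qp and φ = f + 2qb with a, p, f, b series in q³. The degrees ≡ 1 modulo 3 of (a +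
-- qp)(f + 2qb)² carry q(4abf + pf²); the term with q³ falls into the class of 0.
sec₁-ψφ² : sec 3 1 (ψ *ˢ (φ *ˢ φ)) ≈ d3 φ *ˢ (const (+ 4) *ˢ (A₃ *ˢ B₃) +ˢ d3 (φ *ˢ ψ))
sec₁-ψφ² = ≈-trans (pointwise λ n → at expand (1 + n * 3)) (≈-trans (sec₁-expansion G₀ G₁ G₂ G₃)
  (≈-trans (solve 5 (λ c a b f p → c :* (a :* (b :* f)) :+ p :* (f :* f) := f :* (c :* (a :* b) :+ f :* p)) ≈-refl (const (+ 4)) A₃ B₃ (d3 φ) (d3 ψ))
    (*ˢ-cong ≈-refl (+ˢ-cong {const (+ 4) *ˢ (A₃ *ˢ B₃)} ≈-refl (≈-sym (d3-* φ ψ))))))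
  where
  a = d3 A₃
  b = d3 B₃
  f = d3 (d3 φ)
  p₉ = d3 (d3 ψ)
  d3-*³ : ∀ f g h → d3 (f *ˢ (g *ˢ h)) ≈ d3 f *ˢ (d3 g *ˢ d3 h)
  d3-*³ f g h = ≈-trans (d3-* f (g *ˢ h)) (*ˢ-cong ≈-refl (d3-* g h))
  d3-4*³ : ∀ f g h → d3 (const (+ 4) *ˢ (f *ˢ (g *ˢ h))) ≈ const (+ 4) *ˢ (d3 f *ˢ (d3 g *ˢ d3 h))
  d3-4*³ f g h = ≈-trans (d3-* (const (+ 4)) (f *ˢ (g *ˢ h))) (*ˢ-cong (d3-const (+ 4)) (d3-*³ f g h))
  G₀ = A₃ *ˢ (d3 φ *ˢ d3 φ)
  G₁ = const (+ 4) *ˢ (A₃ *ˢ (B₃ *ˢ d3 φ)) +ˢ d3 ψ *ˢ (d3 φ *ˢ d3 φ)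
  G₂ = const (+ 4) *ˢ (A₃ *ˢ (B₃ *ˢ B₃)) +ˢ const (+ 4) *ˢ (d3 ψ *ˢ (d3 φ *ˢ B₃))
  G₃ = const (+ 4) *ˢ (d3 ψ *ˢ (B₃ *ˢ B₃))
  expand : ψ *ˢ (φ *ˢ φ) ≈ d3 G₀ *ˢ 1ˢ +ˢ d3 G₁ *ˢ X +ˢ d3 G₂ *ˢ (X *ˢ X) +ˢ d3 G₃ *ˢ (X *ˢ (X *ˢ X))
  expand = ≈-trans (*ˢ-cong ψ-by-residue (*ˢ-cong φ-by-residue φ-by-residue)) (≈-trans
    (solve 5 (λ x a b f p → (a :+ x :* p) :* ((f :+ x :* (con (+ 2) :* b)) :* (f :+ x :* (con (+ 2) :* b))) :=
        a :* (f :* f) :* con (+ 1) :+ (con (+ 4) :* (a :* (b :* f)) :+ p :* (f :* f)) :* x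
        :+ (con (+ 4) :* (a :* (b :* b)) :+ con (+ 4) :* (p :* (f :* b))) :* (x :* x)
        :+ con (+ 4) :* (p :* (b :* b)) :* (x :* (x :* x))) ≈-refl X a b f p₉)
    (≈-sym (+ˢ-cong (+ˢ-cong (+ˢ-cong
      (*ˢ-cong (d3-*³ A₃ (d3 φ) (d3 φ)) ≈-refl)
      (*ˢ-cong (≈-trans (d3-+ (const (+ 4) *ˢ (A₃ *ˢ (B₃ *ˢ d3 φ))) (d3 ψ *ˢ (d3 φ *ˢ d3 φ))) (+ˢ-cong (d3-4*³ A₃ B₃ (d3 φ)) (d3-*³ (d3 ψ) (d3 φ) (d3 φ)))) ≈-refl))
      (*ˢ-cong (≈-trans (d3-+ (const (+ 4) *ˢ (A₃ *ˢ (B₃ *ˢ B₃))) (const (+ 4) *ˢ (d3 ψ *ˢ (d3 φ *ˢ B₃)))) (+ˢ-cong (d3-4*³ A₃ B₃ B₃) (d3-4*³ (d3 ψ) (d3 φ) B₃))) ≈-refl))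
      (*ˢ-cong (d3-4*³ (d3 ψ) B₃ B₃) ≈-refl))))

sec₂-φ : sec 3 2 φ ≈ 0ˢ
sec₂-φ = pointwise λ n → trans (at φ-by-residue (2 + n * 3)) (trans (cong₂ _+ᶻ_ (d3-2 n (d3 φ))
  (trans (X-*ˢ-suc (const (+ 2) *ˢ d3 B₃) (1 + n * 3)) (trans (const-*ˢ-at (1 + n * 3) (+ 2) (d3 B₃)) (cong (+ 2 *ᶻ_) (d3-1 n B₃))))) (sym (0ˢ≡0 n)))

-- D stands for Σ (−1)ⁿ ped(n) qⁿ.
module Quotient₃ (D : Series) (Dφ≈ψ : D *ˢ φ ≈ ψ) where

  quotient-9n+7 : ∀ n → ∃ λ c → D (7 + n * 9) ≡ + 3 *ᶻ c
  quotient-9n+7 n = let c , q = mod-cancel (+ 3) φ E (quotient final) φ-0 (≈-trans (congruence final) (SR.+-identityˡ (const (+ 3) *ˢ quotient final))) n in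
    c , trans (cong D (index n)) q
    where
    D₁ = sec 3 1 D
    E  = sec 3 2 D₁
    index : ∀ n → 7 + n * 9 ≡ 1 + (2 + n * 3) * 3
    index = ℕ-ring
    open ≈-Reasoning
    first : d3 φ *ˢ D ≈ ψ *ˢ (φ *ˢ φ) mod + 3
    first = mod-trans (mod-* (mod-sym (cube≈d3 φ)) (≈⇒mod {D} ≈-refl))
      (≈⇒mod (≈-trans (solve 2 (λ f d → f :* f :* f :* d := d :* f :* (f :* f)) ≈-refl φ D) (*ˢ-cong Dφ≈ψ ≈-refl)))
    second : φ *ˢ D₁ ≈ d3 φ *ˢ (const (+ 2) *ˢ (ψ *ˢ d2 ψ)) mod + 3
    -- As 4 ≡ 1 modulo 3, the bracket 4A₃B₃ + φ(q³)ψ(q³) of `sec₁-ψφ²` is congruent to the right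
    -- side of `ψψ₂`, hence to 2ψ(q)ψ(q²).
    second = mod-trans (≈⇒mod (≈-sym (d3-sec 1 (s≤s (s≤s z≤n)) φ D))) (mod-trans (mod-sec 3 1 first) (mod-trans (≈⇒mod sec₁-ψφ²)
      (by (d3 φ *ˢ (A₃ *ˢ B₃)) $ ≈-trans (solve 3 (λ f ab g → f :* (con (+ 4) :* ab :+ g) := f :* (g :+ ab) :+ con (+ 3) :* (f :* ab)) ≈-refl (d3 φ) (A₃ *ˢ B₃) (d3 (φ *ˢ ψ)))
        (+ˢ-cong (*ˢ-cong ≈-refl (≈-sym ψψ₂)) ≈-refl))))
    third : d3 φ *ˢ D₁ ≈ d3 (φ *ˢ ψ) *ˢ (const (+ 2) *ˢ φ) mod + 3
    -- A further factor φ² completes a cube of φ on the left. On the right φ(q)ψ(q²) = ψ² completes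
    -- a cube of ψ, and both cubes become series in q³.
    third = mod-trans (mod-* (mod-sym (cube≈d3 φ)) (≈⇒mod {D₁} ≈-refl)) (mod-trans
      (≈⇒mod (solve 2 (λ f d → f :* f :* f :* d := f :* f :* (f :* d)) ≈-refl φ D₁)) (mod-trans
      (mod-* (≈⇒mod {φ *ˢ φ} ≈-refl) second) (mod-trans
      (≈⇒mod (begin
        φ *ˢ φ *ˢ (d3 φ *ˢ (const (+ 2) *ˢ (ψ *ˢ d2 ψ)))  ≈⟨ solve 4 (λ f g p r → f :* f :* (g :* (con (+ 2) :* (p :* r))) := con (+ 2) :* (g :* f) :* (p :* (f :* r))) ≈-refl φ (d3 φ) ψ (d2 ψ) ⟩
        const (+ 2) *ˢ (d3 φ *ˢ φ) *ˢ (ψ *ˢ (φ *ˢ d2 ψ))  ≈⟨ *ˢ-cong ≈-refl (*ˢ-cong ≈-refl ψ²) ⟨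
        const (+ 2) *ˢ (d3 φ *ˢ φ) *ˢ (ψ *ˢ (ψ *ˢ ψ))     ≈⟨ *ˢ-cong ≈-refl (SR.*-assoc ψ ψ ψ) ⟨
        const (+ 2) *ˢ (d3 φ *ˢ φ) *ˢ (ψ *ˢ ψ *ˢ ψ)       ∎)) (mod-trans
      (mod-* (≈⇒mod {const (+ 2) *ˢ (d3 φ *ˢ φ)} ≈-refl) (cube≈d3 ψ))
      (≈⇒mod (≈-trans (solve 3 (λ f g p → con (+ 2) :* (g :* f) :* p := g :* p :* (con (+ 2) :* f)) ≈-refl φ (d3 φ) (d3 ψ)) (*ˢ-cong (≈-sym (d3-* φ ψ)) ≈-refl)))))))
    2<3 : 2 < 3
    2<3 = s≤s (s≤s (s≤s z≤n))
    final : φ *ˢ E ≈ 0ˢ mod + 3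
    final = mod-trans (≈⇒mod (≈-sym (d3-sec 2 2<3 φ D₁))) (mod-trans (mod-sec 3 2 third) (≈⇒mod (begin
      sec 3 2 (d3 (φ *ˢ ψ) *ˢ (const (+ 2) *ˢ φ))  ≈⟨ d3-sec 2 2<3 (φ *ˢ ψ) (const (+ 2) *ˢ φ) ⟩
      φ *ˢ ψ *ˢ sec 3 2 (const (+ 2) *ˢ φ)         ≈⟨ *ˢ-cong {φ *ˢ ψ} ≈-refl (≈-trans (sec-const-* 3 2 (+ 2) φ) (≈-trans (*ˢ-cong {const (+ 2)} ≈-refl sec₂-φ) (SR.zeroʳ (const (+ 2))))) ⟩
      φ *ˢ ψ *ˢ 0ˢ                                 ≈⟨ SR.zeroʳ (φ *ˢ ψ) ⟩
      0ˢ                                           ∎)))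

-- Reduction modulo 64

S₂ S₄ S₈ oddSquares V : Series
S₂ = d2 S
S₄ = d2 S₂
S₈ = d2 S₄
oddSquares  = X *ˢ d2 (d2 (d2 ψ))
V  = S +ˢ S *ˢ S  -- φ² = 1 + 4V

d2-1+2 : ∀ {f g} → f ≈ 1ˢ +ˢ const (+ 2) *ˢ g → d2 f ≈ 1ˢ +ˢ const (+ 2) *ˢ d2 g
d2-1+2 {f} {g} p = ≈-trans (d2-cong p) (≈-trans (d2-+ 1ˢ (const (+ 2) *ˢ g)) (+ˢ-cong (d2-const (+ 1)) (d2-2* g)))

d2φ : d2 φ ≈ 1ˢ +ˢ const (+ 2) *ˢ S₂
d2φ = d2-1+2 φ≈1+2S

d4φ : d2 (d2 φ) ≈ 1ˢ +ˢ const (+ 2) *ˢ S₄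
d4φ = d2-1+2 d2φ

d8φ : d2 (d2 (d2 φ)) ≈ 1ˢ +ˢ const (+ 2) *ˢ S₈
d8φ = d2-1+2 d4φ

S-by-parity : S ≈ S₄ +ˢ oddSquares
S-by-parity = const-cancel (+ 2) _ _ (begin
  const (+ 2) *ˢ S                                   ≈⟨ solve 1 (λ s → con (+ 2) :* s := con (+ 1) :+ con (+ 2) :* s :- con (+ 1)) ≈-refl S ⟩
  1ˢ +ˢ const (+ 2) *ˢ S -ˢ 1ˢ                       ≈⟨ +ˢ-cong {g = -ˢ 1ˢ} (≈-trans (≈-sym φ≈1+2S) (≈-trans φ-by-parity (+ˢ-cong d4φ ≈-refl))) ≈-refl ⟩
  1ˢ +ˢ const (+ 2) *ˢ S₄ +ˢ X *ˢ (const (+ 2) *ˢ d2 (d2 (d2 ψ))) -ˢ 1ˢ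
                                                     ≈⟨ solve 3 (λ s x p → con (+ 1) :+ con (+ 2) :* s :+ x :* (con (+ 2) :* p) :- con (+ 1) := con (+ 2) :* (s :+ x :* p)) ≈-refl S₄ X (d2 (d2 (d2 ψ))) ⟩
  const (+ 2) *ˢ (S₄ +ˢ oddSquares)                           ∎)
  where open ≈-Reasoning

-- By `d2-φ²` the even part of φ(q)² is φ(q²)², so the even part of V is V(q²). The odd part of V is
-- the cross term φ(q⁴) · `oddSquares`.
V-by-parity : V ≈ S₂ +ˢ S₂ *ˢ S₂ +ˢ (oddSquares +ˢ const (+ 2) *ˢ (S₄ *ˢ oddSquares))
V-by-parity = const-cancel (+ 4) _ _ (begin
  const (+ 4) *ˢ V
    ≈⟨ solve 1 (λ s → con (+ 4) :* (s :+ s :* s) := (con (+ 1) :+ con (+ 2) :* s) :* (con (+ 1) :+ con (+ 2) :* s) :- con (+ 1)) ≈-refl S ⟩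
  (1ˢ +ˢ const (+ 2) *ˢ S) *ˢ (1ˢ +ˢ const (+ 2) *ˢ S) -ˢ 1ˢ
    ≈⟨ +ˢ-cong {g = -ˢ 1ˢ} (*ˢ-cong φ-split φ-split) ≈-refl ⟩
  (d2 (d2 φ) +ˢ const (+ 2) *ˢ oddSquares) *ˢ (d2 (d2 φ) +ˢ const (+ 2) *ˢ oddSquares) -ˢ 1ˢ
    ≈⟨ solve 3 (λ f x p → (f :+ con (+ 2) :* (x :* p)) :* (f :+ con (+ 2) :* (x :* p)) :- con (+ 1) :=
         f :* f :+ x :* (x :* (con (+ 4) :* (p :* p))) :+ con (+ 4) :* (f :* (x :* p)) :- con (+ 1)) ≈-refl (d2 (d2 φ)) X (d2 (d2 (d2 ψ))) ⟩
  d2 (d2 φ) *ˢ d2 (d2 φ) +ˢ X *ˢ (X *ˢ (const (+ 4) *ˢ (d2 (d2 (d2 ψ)) *ˢ d2 (d2 (d2 ψ))))) +ˢ const (+ 4) *ˢ (d2 (d2 φ) *ˢ oddSquares) -ˢ 1ˢ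
    ≈⟨ +ˢ-cong {g = -ˢ 1ˢ} (+ˢ-cong squares (*ˢ-cong ≈-refl (*ˢ-cong d4φ ≈-refl))) ≈-refl ⟩
  (1ˢ +ˢ const (+ 2) *ˢ S₂) *ˢ (1ˢ +ˢ const (+ 2) *ˢ S₂) +ˢ const (+ 4) *ˢ ((1ˢ +ˢ const (+ 2) *ˢ S₄) *ˢ oddSquares) -ˢ 1ˢ
    ≈⟨ solve 3 (λ s t o → (con (+ 1) :+ con (+ 2) :* s) :* (con (+ 1) :+ con (+ 2) :* s) :+ con (+ 4) :* ((con (+ 1) :+ con (+ 2) :* t) :* o) :- con (+ 1)
         := con (+ 4) :* (s :+ s :* s :+ (o :+ con (+ 2) :* (t :* o)))) ≈-refl S₂ S₄ oddSquares ⟩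
  const (+ 4) *ˢ (S₂ +ˢ S₂ *ˢ S₂ +ˢ (oddSquares +ˢ const (+ 2) *ˢ (S₄ *ˢ oddSquares))) ∎)
  where
  open ≈-Reasoning
  φ-split : 1ˢ +ˢ const (+ 2) *ˢ S ≈ d2 (d2 φ) +ˢ const (+ 2) *ˢ oddSquares
  φ-split = ≈-trans (≈-sym φ≈1+2S) (≈-trans φ-by-parity (+ˢ-cong {d2 (d2 φ)} ≈-refl
    (solve 2 (λ x p → x :* (con (+ 2) :* p) := con (+ 2) :* (x :* p)) ≈-refl X (d2 (d2 (d2 ψ))))))
  d2-4* : ∀ f → d2 (const (+ 4) *ˢ f) ≈ const (+ 4) *ˢ d2 f
  d2-4* f = ≈-trans (d2-* (const (+ 4)) f) (*ˢ-cong (d2-const (+ 4)) ≈-refl)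
  d8-4* : ∀ f → d2 (d2 (d2 (const (+ 4) *ˢ (f *ˢ f)))) ≈ const (+ 4) *ˢ (d2 (d2 (d2 f)) *ˢ d2 (d2 (d2 f)))
  d8-4* f = ≈-trans (d2-cong (≈-trans (d2-cong (≈-trans (d2-4* (f *ˢ f)) (*ˢ-cong ≈-refl (d2-* f f)))) (≈-trans (d2-4* (d2 f *ˢ d2 f)) (*ˢ-cong ≈-refl (d2-* (d2 f) (d2 f))))))
    (≈-trans (d2-4* (d2 (d2 f) *ˢ d2 (d2 f))) (*ˢ-cong ≈-refl (d2-* (d2 (d2 f)) (d2 (d2 f)))))
  squares : d2 (d2 φ) *ˢ d2 (d2 φ) +ˢ X *ˢ (X *ˢ (const (+ 4) *ˢ (d2 (d2 (d2 ψ)) *ˢ d2 (d2 (d2 ψ)))))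
          ≈ (1ˢ +ˢ const (+ 2) *ˢ S₂) *ˢ (1ˢ +ˢ const (+ 2) *ˢ S₂)
  squares = ≈-trans (+ˢ-cong {d2 (d2 φ) *ˢ d2 (d2 φ)} ≈-refl (*ˢ-cong ≈-refl (*ˢ-cong ≈-refl (≈-sym (d8-4* ψ)))))
    (≈-trans (≈-sym d2-φ²) (≈-trans (d2-* φ φ) (*ˢ-cong d2φ d2φ)))

-- Frobenius gives V ≡ S + S(q²) modulo 2, hence V² ≡ (S + S(q²))² modulo 4. The sum of the two
-- squares is then needed modulo 4, for which Frobenius alone is too weak; `sum-of-squares` supplies
-- it.
φV² : φ *ˢ (V *ˢ V) ≈ S₂ +ˢ S₄ +ˢ const (+ 2) *ˢ S₈ mod + 4
φV² = by H (begin
  φ *ˢ (V *ˢ V)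
    ≈⟨ *ˢ-cong φ≈1+2S (*ˢ-cong V≈ V≈) ⟩
  (1ˢ +ˢ const (+ 2) *ˢ S) *ˢ ((S +ˢ (S₂ +ˢ const (+ 2) *ˢ D₁)) *ˢ (S +ˢ (S₂ +ˢ const (+ 2) *ˢ D₁)))
    ≈⟨ solve 3 (λ s t d → (con (+ 1) :+ con (+ 2) :* s) :* ((s :+ (t :+ con (+ 2) :* d)) :* (s :+ (t :+ con (+ 2) :* d))) :=
         (con (+ 1) :+ con (+ 2) :* s) :* (s :* s :+ t :* t :+ con (+ 2) :* (s :* t)) :+ con (+ 4) :* ((con (+ 1) :+ con (+ 2) :* s) :* (d :* (s :+ t) :+ d :* d))) ≈-refl S S₂ D₁ ⟩
  (1ˢ +ˢ const (+ 2) *ˢ S) *ˢ (S *ˢ S +ˢ S₂ *ˢ S₂ +ˢ const (+ 2) *ˢ (S *ˢ S₂)) +ˢ const (+ 4) *ˢ H₁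
    ≈⟨ +ˢ-cong {g = const (+ 4) *ˢ H₁} (*ˢ-cong {1ˢ +ˢ const (+ 2) *ˢ S} ≈-refl (+ˢ-cong {g = const (+ 2) *ˢ (S *ˢ S₂)} sum-of-squares ≈-refl)) ≈-refl ⟩
  (1ˢ +ˢ const (+ 2) *ˢ S) *ˢ (S₂ +ˢ S₄ -ˢ const (+ 2) *ˢ (S₄ *ˢ oddSquares) +ˢ const (+ 4) *ˢ D₁ +ˢ const (+ 2) *ˢ (S *ˢ S₂)) +ˢ const (+ 4) *ˢ H₁
    ≈⟨ solve 6 (λ s t u o d h → (con (+ 1) :+ con (+ 2) :* s) :* (t :+ u :- con (+ 2) :* (u :* o) :+ con (+ 4) :* d :+ con (+ 2) :* (s :* t)) :+ con (+ 4) :* h :=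
         t :+ u :+ con (+ 2) :* (u :* (s :- o)) :+ con (+ 4) :* (d :+ s :* t :- s :* u :* o :+ con (+ 2) :* s :* d :+ s :* s :* t :+ h)) ≈-refl S S₂ S₄ oddSquares D₁ H₁ ⟩
  S₂ +ˢ S₄ +ˢ const (+ 2) *ˢ (S₄ *ˢ (S -ˢ oddSquares)) +ˢ const (+ 4) *ˢ H₂
    ≈⟨ +ˢ-cong {g = const (+ 4) *ˢ H₂} (+ˢ-cong {S₂ +ˢ S₄} ≈-refl (*ˢ-cong {const (+ 2)} ≈-refl (≈-trans (*ˢ-cong {S₄} ≈-refl S-O) (congruence (square≈d2 S₄))))) ≈-refl ⟩
  S₂ +ˢ S₄ +ˢ const (+ 2) *ˢ (S₈ +ˢ const (+ 2) *ˢ D₄) +ˢ const (+ 4) *ˢ H₂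
    ≈⟨ solve 5 (λ t u w d h → t :+ u :+ con (+ 2) :* (w :+ con (+ 2) :* d) :+ con (+ 4) :* h := t :+ u :+ con (+ 2) :* w :+ con (+ 4) :* (d :+ h)) ≈-refl S₂ S₄ S₈ D₄ H₂ ⟩
  S₂ +ˢ S₄ +ˢ const (+ 2) *ˢ S₈ +ˢ const (+ 4) *ˢ H ∎)
  where
  open ≈-Reasoning
  D₁ = quotient (square≈d2 S)
  D₄ = quotient (square≈d2 S₄)
  H₁ = (1ˢ +ˢ const (+ 2) *ˢ S) *ˢ (D₁ *ˢ (S +ˢ S₂) +ˢ D₁ *ˢ D₁)
  H₂ = D₁ +ˢ S *ˢ S₂ -ˢ S *ˢ S₄ *ˢ oddSquares +ˢ const (+ 2) *ˢ S *ˢ D₁ +ˢ S *ˢ S *ˢ S₂ +ˢ H₁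
  H  = D₄ +ˢ H₂
  V≈ : V ≈ S +ˢ (S₂ +ˢ const (+ 2) *ˢ D₁)
  V≈ = +ˢ-cong {S} ≈-refl (congruence (square≈d2 S))
  S-O : S -ˢ oddSquares ≈ S₄
  S-O = ≈-trans (+ˢ-cong {g = -ˢ oddSquares} S-by-parity ≈-refl) (solve 2 (λ s o → s :+ o :- o := s) ≈-refl S₄ oddSquares)
  -- Equating V = S + S² with `V-by-parity` expresses S(q²)² through S². The sum of both squares
  -- then contains S² only with coefficient 2, so that knowing S² modulo 2 is enough.
  sum-of-squares : S *ˢ S +ˢ S₂ *ˢ S₂ ≈ S₂ +ˢ S₄ -ˢ const (+ 2) *ˢ (S₄ *ˢ oddSquares) +ˢ const (+ 4) *ˢ D₁
  sum-of-squares = begin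
    S *ˢ S +ˢ S₂ *ˢ S₂
      ≈⟨ solve 5 (λ s t o e w → w :+ t :* t := con (+ 2) :* w :+ s :- t :- o :- con (+ 2) :* e :- (s :+ w) :+ (t :+ t :* t :+ (o :+ con (+ 2) :* e))) ≈-refl S S₂ oddSquares (S₄ *ˢ oddSquares) (S *ˢ S) ⟩
    const (+ 2) *ˢ (S *ˢ S) +ˢ S -ˢ S₂ -ˢ oddSquares -ˢ const (+ 2) *ˢ (S₄ *ˢ oddSquares) -ˢ V +ˢ (S₂ +ˢ S₂ *ˢ S₂ +ˢ (oddSquares +ˢ const (+ 2) *ˢ (S₄ *ˢ oddSquares)))
      ≈⟨ +ˢ-cong {const (+ 2) *ˢ (S *ˢ S) +ˢ S -ˢ S₂ -ˢ oddSquares -ˢ const (+ 2) *ˢ (S₄ *ˢ oddSquares) -ˢ V} ≈-refl (≈-sym V-by-parity) ⟩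
    const (+ 2) *ˢ (S *ˢ S) +ˢ S -ˢ S₂ -ˢ oddSquares -ˢ const (+ 2) *ˢ (S₄ *ˢ oddSquares) -ˢ V +ˢ V
      ≈⟨ solve 6 (λ s t o e w v → con (+ 2) :* w :+ s :- t :- o :- con (+ 2) :* e :- v :+ v := (s :- o) :+ con (+ 2) :* w :- t :- con (+ 2) :* e) ≈-refl S S₂ oddSquares (S₄ *ˢ oddSquares) (S *ˢ S) V ⟩
    (S -ˢ oddSquares) +ˢ const (+ 2) *ˢ (S *ˢ S) -ˢ S₂ -ˢ const (+ 2) *ˢ (S₄ *ˢ oddSquares)
      ≈⟨ +ˢ-cong {g = -ˢ (const (+ 2) *ˢ (S₄ *ˢ oddSquares))} (+ˢ-cong {g = -ˢ S₂} (+ˢ-cong S-O (*ˢ-cong {const (+ 2)} ≈-refl (congruence (square≈d2 S)))) ≈-refl) ≈-refl ⟩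
    S₄ +ˢ const (+ 2) *ˢ (S₂ +ˢ const (+ 2) *ˢ D₁) -ˢ S₂ -ˢ const (+ 2) *ˢ (S₄ *ˢ oddSquares)
      ≈⟨ solve 4 (λ t u e d → u :+ con (+ 2) :* (t :+ con (+ 2) :* d) :- t :- con (+ 2) :* e := t :+ u :- con (+ 2) :* e :+ con (+ 4) :* d) ≈-refl S₂ S₄ (S₄ *ˢ oddSquares) D₁ ⟩
    S₂ +ˢ S₄ -ˢ const (+ 2) *ˢ (S₄ *ˢ oddSquares) +ˢ const (+ 4) *ˢ D₁ ∎

module Quotient₆₄ (D : Series) (Dφ≈ψ : D *ˢ φ ≈ ψ) where

  -- With φ² = 1 + 4V and (1 + 4V)(1 - 4V + 16V²) = 1 + 64V³, the inverse of φ is φ(1 - 4V) + 16φV²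
  -- modulo 64, where φ(1 - 4V) = 2φ - φ³. Of φV² only the value modulo 4 matters.
  quotient-mod-64 : D ≈ const (+ 2) *ˢ (ψ *ˢ φ) -ˢ ψ *ˢ (φ *ˢ φ *ˢ φ) +ˢ const (+ 16) *ˢ (ψ *ˢ d2 S +ˢ ψ *ˢ S₄ +ˢ const (+ 2) *ˢ (ψ *ˢ S₈)) mod + 64
  quotient-mod-64 = by H (begin
    D
      ≈⟨ solve 2 (λ d s → let f = con (+ 1) :+ con (+ 2) :* s ; v = s :+ s :* s ; p = d :* f in
           d := con (+ 2) :* (p :* f) :- p :* (f :* f :* f) :+ con (+ 16) :* (p :* (f :* (v :* v))) :- con (+ 64) :* (d :* v :* v :* v)) ≈-refl D S ⟩
    const (+ 2) *ˢ (D *ˢ F *ˢ F) -ˢ D *ˢ F *ˢ (F *ˢ F *ˢ F) +ˢ const (+ 16) *ˢ (D *ˢ F *ˢ (F *ˢ (V *ˢ V))) -ˢ const (+ 64) *ˢ (D *ˢ V *ˢ V *ˢ V)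
      ≈⟨ +ˢ-cong {g = -ˢ (const (+ 64) *ˢ (D *ˢ V *ˢ V *ˢ V))} (+ˢ-cong (+ˢ-cong
           (*ˢ-cong {const (+ 2)} ≈-refl (*ˢ-cong DF (≈-sym φ≈1+2S)))
           (-ˢ-cong (*ˢ-cong DF (*ˢ-cong (*ˢ-cong (≈-sym φ≈1+2S) (≈-sym φ≈1+2S)) (≈-sym φ≈1+2S)))))
           (*ˢ-cong {const (+ 16)} ≈-refl (*ˢ-cong DF (≈-trans (*ˢ-cong (≈-sym φ≈1+2S) ≈-refl) (congruence φV²))))) ≈-refl ⟩
    const (+ 2) *ˢ (ψ *ˢ φ) -ˢ ψ *ˢ (φ *ˢ φ *ˢ φ) +ˢ const (+ 16) *ˢ (ψ *ˢ (S₂ +ˢ S₄ +ˢ const (+ 2) *ˢ S₈ +ˢ const (+ 4) *ˢ quotient φV²)) -ˢ const (+ 64) *ˢ (D *ˢ V *ˢ V *ˢ V)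
      ≈⟨ solve 8 (λ a b p t u w h k → a :- b :+ con (+ 16) :* (p :* (t :+ u :+ con (+ 2) :* w :+ con (+ 4) :* h)) :- con (+ 64) :* k :=
           a :- b :+ con (+ 16) :* (p :* t :+ p :* u :+ con (+ 2) :* (p :* w)) :+ con (+ 64) :* (p :* h :- k))
           ≈-refl (const (+ 2) *ˢ (ψ *ˢ φ)) (ψ *ˢ (φ *ˢ φ *ˢ φ)) ψ S₂ S₄ S₈ (quotient φV²) (D *ˢ V *ˢ V *ˢ V) ⟩
    const (+ 2) *ˢ (ψ *ˢ φ) -ˢ ψ *ˢ (φ *ˢ φ *ˢ φ) +ˢ const (+ 16) *ˢ (ψ *ˢ S₂ +ˢ ψ *ˢ S₄ +ˢ const (+ 2) *ˢ (ψ *ˢ S₈)) +ˢ const (+ 64) *ˢ H ∎)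
    where
    open ≈-Reasoning
    F = 1ˢ +ˢ const (+ 2) *ˢ S
    H = ψ *ˢ quotient φV² -ˢ D *ˢ V *ˢ V *ˢ V
    DF : D *ˢ F ≈ ψ
    DF = ≈-trans (*ˢ-cong {D} ≈-refl (≈-sym φ≈1+2S)) Dφ≈ψ

-- Liouville's identity for the solutions of Aα + Bβ = n in positive integers

-- Positive integers are indexed by their predecessors.
Divisions Sums₁ Sums₂ Crossed : Family
Divisions = finitely (ℕ × ℕ) (λ (a , s) → suc a * suc s) (λ n → cartesianProduct (upTo (suc n)) (upTo (suc n)))
  (λ n → Unique.cartesianProduct⁺ (Unique.upTo⁺ (suc n)) (Unique.upTo⁺ (suc n)))
  (λ (a , s) → ∈-cartesianProduct⁺ (∈-upTo⁺ (s≤s (ℕₚ.≤-trans (ℕₚ.n≤1+n a) (ℕₚ.m≤m*n (suc a) (suc s)))))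
                                   (∈-upTo⁺ (s≤s (ℕₚ.≤-trans (ℕₚ.n≤1+n s) (ℕₚ.m≤n*m (suc s) (suc a))))))
Sums₁ = labelled Divisions proj₂
Sums₂ = labelled Divisions proj₁
Crossed = finitely ((ℕ × ℕ) × (ℕ × ℕ)) crossed (λ n → cartesianProduct (square n) (square n))
  (λ n → Unique.cartesianProduct⁺ (square-unique n) (square-unique n))
  (λ x@((p , q) , (a , b)) → ∈-cartesianProduct⁺
    (∈-cartesianProduct⁺ (bound (≤p p q a b)) (bound (≤q p q a b)))
    (∈-cartesianProduct⁺ (bound (≤a p q a b)) (bound (≤b p q a b))))
  where
  crossed : (ℕ × ℕ) × (ℕ × ℕ) → ℕ
  crossed ((p , q) , (a , b)) = (suc p + suc q) * suc a + suc q * suc b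
  square : ℕ → List (ℕ × ℕ)
  square n = cartesianProduct (upTo (suc n)) (upTo (suc n))
  square-unique : ∀ n → _
  square-unique n = Unique.cartesianProduct⁺ (Unique.upTo⁺ (suc n)) (Unique.upTo⁺ (suc n))
  bound : ∀ {i n} → i ≤ n → _
  bound i≤n = ∈-upTo⁺ (s≤s i≤n)
  ≤p : ∀ p q a b → p ≤ crossed ((p , q) , (a , b))
  ≤p p q a b = ℕₚ.≤-trans (ℕₚ.≤-trans (ℕₚ.≤-trans (ℕₚ.n≤1+n p) (ℕₚ.m≤m+n (suc p) (suc q))) (ℕₚ.m≤m*n (suc p + suc q) (suc a))) (ℕₚ.m≤m+n ((suc p + suc q) * suc a) (suc q * suc b))
  ≤q : ∀ p q a b → q ≤ crossed ((p , q) , (a , b))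
  ≤q p q a b = ℕₚ.≤-trans (ℕₚ.≤-trans (ℕₚ.n≤1+n q) (ℕₚ.m≤m*n (suc q) (suc b))) (ℕₚ.m≤n+m (suc q * suc b) ((suc p + suc q) * suc a))
  ≤a : ∀ p q a b → a ≤ crossed ((p , q) , (a , b))
  ≤a p q a b = ℕₚ.≤-trans (ℕₚ.≤-trans (ℕₚ.n≤1+n a) (ℕₚ.m≤n*m (suc a) (suc p + suc q))) (ℕₚ.m≤m+n ((suc p + suc q) * suc a) (suc q * suc b))
  ≤b : ∀ p q a b → b ≤ crossed ((p , q) , (a , b))
  ≤b p q a b = ℕₚ.≤-trans (ℕₚ.≤-trans (ℕₚ.n≤1+n b) (ℕₚ.m≤n*m (suc b) (suc q))) (ℕₚ.m≤n+m (suc q * suc b) ((suc p + suc q) * suc a))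

-- Trichotomy as a bijection: the smaller number and, if the two differ, the predecessor of their
-- distance.
cmp : ℕ × ℕ → ℕ ⊎ (ℕ × ℕ) ⊎ (ℕ × ℕ)
cmp (zero  , zero)  = inj₁ 0
cmp (zero  , suc k) = inj₂ (inj₁ (0 , k))
cmp (suc k , zero)  = inj₂ (inj₂ (0 , k))
cmp (suc m , suc n) with cmp (m , n)
... | inj₁ i              = inj₁ (suc i)
... | inj₂ (inj₁ (i , k)) = inj₂ (inj₁ (suc i , k))
... | inj₂ (inj₂ (i , k)) = inj₂ (inj₂ (suc i , k))

uncmp : ℕ ⊎ (ℕ × ℕ) ⊎ (ℕ × ℕ) → ℕ × ℕ
uncmp (inj₁ i)              = i , i
uncmp (inj₂ (inj₁ (i , k))) = i , suc (i + k)
uncmp (inj₂ (inj₂ (i , k))) = suc (i + k) , i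

uncmp-cmp : ∀ x → uncmp (cmp x) ≡ x
uncmp-cmp (zero  , zero)  = refl
uncmp-cmp (zero  , suc k) = refl
uncmp-cmp (suc k , zero)  = refl
uncmp-cmp (suc m , suc n) with cmp (m , n) | uncmp-cmp (m , n)
... | inj₁ i              | refl = refl
... | inj₂ (inj₁ (i , k)) | refl = refl
... | inj₂ (inj₂ (i , k)) | refl = refl

cmp-uncmp : ∀ y → cmp (uncmp y) ≡ y
cmp-uncmp (inj₁ zero)                 = refl
cmp-uncmp (inj₁ (suc i))              rewrite cmp-uncmp (inj₁ i) = refl
cmp-uncmp (inj₂ (inj₁ (zero , k)))    = refl
cmp-uncmp (inj₂ (inj₁ (suc i , k)))   rewrite cmp-uncmp (inj₂ (inj₁ (i , k))) = refl
cmp-uncmp (inj₂ (inj₂ (zero , k)))    = refl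
cmp-uncmp (inj₂ (inj₂ (suc i , k)))   rewrite cmp-uncmp (inj₂ (inj₂ (i , k))) = refl

-- A number s splits into two positive summands in s - 1 ways. As s is stored by its predecessor,
-- this is exactly the bound of `Fin`.
label : ℕ → ℕ → Σ ℕ Fin
label i k = suc (i + k) , fromℕ< (s≤s (ℕₚ.m≤m+n i k))

unlabel : Σ ℕ Fin → ℕ × ℕ
unlabel (suc s , l) = toℕ l , s ∸ toℕ l

unlabel-label : ∀ i k → unlabel (label i k) ≡ (i , k)
unlabel-label i k rewrite Finₚ.toℕ-fromℕ< (s≤s (ℕₚ.m≤m+n i k)) = cong (i ,_) (ℕₚ.m+n∸m≡n i k)

label-unlabel : ∀ x → (let i , k = unlabel x in label i k) ≡ x
label-unlabel (suc s , l) = same-label (cong suc sum≡s) (Finₚ.toℕ-fromℕ< (s≤s (ℕₚ.m≤m+n (toℕ l) (s ∸ toℕ l))))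
  where
  sum≡s : toℕ l + (s ∸ toℕ l) ≡ s
  sum≡s = ℕₚ.m+[n∸m]≡n (Finₚ.toℕ≤pred[n] l)
  same-label : ∀ {m n} {i : Fin m} {j : Fin n} → m ≡ n → toℕ i ≡ toℕ j → _≡_ {A = Σ ℕ Fin} (m , i) (n , j)
  same-label refl p = cong (_ ,_) (Finₚ.toℕ-injective p)

-- If A ≠ B, then (A, B) is (Q, P + Q) or (P + Q, Q).
by-first : (Divisions ⊗ Divisions) ≅ (Sums₁ ⊞ Crossed ⊞ Crossed)
by-first = mk≅ to from from-to to-from size-from
  where
  to : (ℕ × ℕ) × (ℕ × ℕ) → Index (Sums₁ ⊞ Crossed ⊞ Crossed)
  to ((a , α) , (b , β)) with cmp (a , b)
  ... | inj₁ i              = inj₁ ((i , proj₁ (label α β)) , proj₂ (label α β))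
  ... | inj₂ (inj₁ (i , k)) = inj₂ (inj₁ ((k , i) , (β , α)))
  ... | inj₂ (inj₂ (i , k)) = inj₂ (inj₂ ((k , i) , (α , β)))
  from : Index (Sums₁ ⊞ Crossed ⊞ Crossed) → (ℕ × ℕ) × (ℕ × ℕ)
  from (inj₁ ((i , s) , l)) = let α , β = unlabel (s , l) in (i , α) , (i , β)
  from (inj₂ (inj₁ ((k , i) , (β , α)))) = (i , α) , (suc (i + k) , β)
  from (inj₂ (inj₂ ((k , i) , (α , β)))) = (suc (i + k) , α) , (i , β)
  from-to : ∀ x → from (to x) ≡ x
  from-to ((a , α) , (b , β)) with cmp (a , b) | uncmp-cmp (a , b)
  ... | inj₁ i              | refl = cong (λ (α , β) → (i , α) , (i , β)) (unlabel-label α β)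
  ... | inj₂ (inj₁ (i , k)) | refl = refl
  ... | inj₂ (inj₂ (i , k)) | refl = refl
  to-from : ∀ y → to (from y) ≡ y
  to-from (inj₁ ((i , s) , l)) rewrite cmp-uncmp (inj₁ i) = cong (λ (s , l) → inj₁ ((i , s) , l)) (label-unlabel (s , l))
  to-from (inj₂ (inj₁ ((k , i) , (β , α)))) rewrite cmp-uncmp (inj₂ (inj₁ (i , k))) = refl
  to-from (inj₂ (inj₂ ((k , i) , (α , β)))) rewrite cmp-uncmp (inj₂ (inj₂ (i , k))) = refl
  s₀ : ∀ i α β → suc i * suc α + suc i * suc β ≡ suc i * suc (suc (α + β))
  s₀ = ℕ-ring
  s₁ : ∀ i k α β → suc i * suc α + suc (suc (i + k)) * suc β ≡ (suc k + suc i) * suc β + suc i * suc α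
  s₁ = ℕ-ring
  s₂ : ∀ i k α β → suc (suc (i + k)) * suc α + suc i * suc β ≡ (suc k + suc i) * suc α + suc i * suc β
  s₂ = ℕ-ring
  size-from : ∀ y → size (Divisions ⊗ Divisions) (from y) ≡ size (Sums₁ ⊞ Crossed ⊞ Crossed) y
  size-from (inj₁ ((i , s) , l)) = let α , β = unlabel (s , l) in trans (s₀ i α β) (cong (λ s → suc i * suc s) (cong proj₁ (label-unlabel (s , l))))
  size-from (inj₂ (inj₁ ((k , i) , (β , α)))) = s₁ i k α β
  size-from (inj₂ (inj₂ ((k , i) , (α , β)))) = s₂ i k α β

-- The same splitting by the order of α and β. If β = α + γ, then Aα + Bβ = (A + B)α + Bγ, which is
-- again a point of `Crossed`. Liouville's method consists in playing this decomposition off against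
-- `by-first`.
by-second : (Divisions ⊗ Divisions) ≅ (Sums₂ ⊞ Crossed ⊞ Crossed)
by-second = mk≅ to from from-to to-from size-from
  where
  to : (ℕ × ℕ) × (ℕ × ℕ) → Index (Sums₂ ⊞ Crossed ⊞ Crossed)
  to ((a , α) , (b , β)) with cmp (α , β)
  ... | inj₁ i              = inj₁ ((proj₁ (label a b) , i) , proj₂ (label a b))
  ... | inj₂ (inj₁ (i , k)) = inj₂ (inj₁ ((a , b) , (i , k)))
  ... | inj₂ (inj₂ (i , k)) = inj₂ (inj₂ ((b , a) , (i , k)))
  from : Index (Sums₂ ⊞ Crossed ⊞ Crossed) → (ℕ × ℕ) × (ℕ × ℕ)
  from (inj₁ ((s , i) , l)) = let a , b = unlabel (s , l) in (a , i) , (b , i)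
  from (inj₂ (inj₁ ((a , b) , (i , k)))) = (a , i) , (b , suc (i + k))
  from (inj₂ (inj₂ ((b , a) , (i , k)))) = (a , suc (i + k)) , (b , i)
  from-to : ∀ x → from (to x) ≡ x
  from-to ((a , α) , (b , β)) with cmp (α , β) | uncmp-cmp (α , β)
  ... | inj₁ i              | refl = cong (λ (a , b) → (a , i) , (b , i)) (unlabel-label a b)
  ... | inj₂ (inj₁ (i , k)) | refl = refl
  ... | inj₂ (inj₂ (i , k)) | refl = refl
  to-from : ∀ y → to (from y) ≡ y
  to-from (inj₁ ((s , i) , l)) rewrite cmp-uncmp (inj₁ i) = cong (λ (s , l) → inj₁ ((s , i) , l)) (label-unlabel (s , l))
  to-from (inj₂ (inj₁ ((a , b) , (i , k)))) rewrite cmp-uncmp (inj₂ (inj₁ (i , k))) = refl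
  to-from (inj₂ (inj₂ ((b , a) , (i , k)))) rewrite cmp-uncmp (inj₂ (inj₂ (i , k))) = refl
  s₀ : ∀ i a b → suc a * suc i + suc b * suc i ≡ suc (suc (a + b)) * suc i
  s₀ = ℕ-ring
  s₁ : ∀ i k a b → suc a * suc i + suc b * suc (suc (i + k)) ≡ (suc a + suc b) * suc i + suc b * suc k
  s₁ = ℕ-ring
  s₂ : ∀ i k a b → suc a * suc (suc (i + k)) + suc b * suc i ≡ (suc b + suc a) * suc i + suc a * suc k
  s₂ = ℕ-ring
  size-from : ∀ y → size (Divisions ⊗ Divisions) (from y) ≡ size (Sums₂ ⊞ Crossed ⊞ Crossed) y
  size-from (inj₁ ((s , i) , l)) = let a , b = unlabel (s , l) in trans (s₀ i a b) (cong (λ s → suc s * suc i) (cong proj₁ (label-unlabel (s , l))))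
  size-from (inj₂ (inj₁ ((a , b) , (i , k)))) = s₁ i k a b
  size-from (inj₂ (inj₂ ((b , a) , (i , k)))) = s₂ i k a b

pairs : (ℕ → ℕ → ℤ) → Series
pairs h = gen (Divisions ⊗ Divisions) (λ ((_ , α) , (_ , β)) → h (suc α) (suc β))

crossed : (ℕ → ℕ → ℤ) → Series
crossed g = gen Crossed (λ (_ , (x , y)) → g (suc x) (suc y))

lambert : (ℕ → ℕ → ℤ) → Series
lambert g = gen Divisions (λ (a , s) → g (suc a) (suc s))

sums₁ sums₂ : (ℕ → ℕ → ℤ) → Series
sums₁ h = gen Sums₁ (λ ((_ , s) , l) → let α , β = unlabel (s , l) in h (suc α) (suc β))
sums₂ h = gen Sums₂ (λ ((_ , α) , _) → h (suc α) (suc α))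

pairs-by-first : ∀ h → pairs h ≈ sums₁ h +ˢ (crossed (λ x y → h y x) +ˢ crossed h)
pairs-by-first h = ≈-trans (≈-trans (gen-cong (Divisions ⊗ Divisions) (λ x → weights x)) (gen-≅ by-first w))
  (≈-trans (gen-⊞ Sums₁ (Crossed ⊞ Crossed) w) (+ˢ-cong {sums₁ h} ≈-refl (gen-⊞ Crossed Crossed (w ∘ inj₂))))
  where
  v : ℕ × ℕ → ℕ × ℕ → ℤ
  v (_ , α) (_ , β) = h (suc α) (suc β)
  w : Index (Sums₁ ⊞ Crossed ⊞ Crossed) → ℤ
  w (inj₁ ((_ , s) , l))           = let α , β = unlabel (s , l) in h (suc α) (suc β)
  w (inj₂ (inj₁ (_ , (x , y))))    = h (suc y) (suc x)
  w (inj₂ (inj₂ (_ , (x , y))))    = h (suc x) (suc y)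
  weights : ∀ x → v (proj₁ x) (proj₂ x) ≡ w (_≅_.to by-first x)
  weights ((a , α) , (b , β)) with cmp (a , b)
  ... | inj₁ i              = sym (cong (λ (α , β) → h (suc α) (suc β)) (unlabel-label α β))
  ... | inj₂ (inj₁ (i , k)) = refl
  ... | inj₂ (inj₂ (i , k)) = refl

pairs-by-second : ∀ h → pairs h ≈ sums₂ h +ˢ (crossed (λ x y → h x (x + y)) +ˢ crossed (λ x y → h (x + y) x))
pairs-by-second h = ≈-trans (≈-trans (gen-cong (Divisions ⊗ Divisions) (λ x → weights x)) (gen-≅ by-second w))
  (≈-trans (gen-⊞ Sums₂ (Crossed ⊞ Crossed) w) (+ˢ-cong {sums₂ h} ≈-refl (gen-⊞ Crossed Crossed (w ∘ inj₂))))
  where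
  v : ℕ × ℕ → ℕ × ℕ → ℤ
  v (_ , α) (_ , β) = h (suc α) (suc β)
  w : Index (Sums₂ ⊞ Crossed ⊞ Crossed) → ℤ
  w (inj₁ ((_ , α) , _))           = h (suc α) (suc α)
  w (inj₂ (inj₁ (_ , (x , y))))    = h (suc x) (suc x + suc y)
  w (inj₂ (inj₂ (_ , (x , y))))    = h (suc x + suc y) (suc x)
  weights : ∀ x → v (proj₁ x) (proj₂ x) ≡ w (_≅_.to by-second x)
  weights ((a , α) , (b , β)) with cmp (α , β) | uncmp-cmp (α , β)
  ... | inj₁ i              | refl = refl
  ... | inj₂ (inj₁ (i , k)) | refl = cong (λ n → h (suc i) (suc n)) (sym (ℕₚ.+-suc i k))
  ... | inj₂ (inj₂ (i , k)) | refl = cong (λ n → h (suc n) (suc i)) (sym (ℕₚ.+-suc i k))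

prefix : (ℕ → ℤ) → ℕ → ℤ
prefix f zero    = + 0
prefix f (suc n) = f 1 +ᶻ prefix (f ∘ suc) n

sumOver-allFin : ∀ n f → sumOver (allFin n) (λ l → f (suc (toℕ l))) ≡ prefix f n
sumOver-allFin n f = go n id f (λ _ → refl)
  where
  go : ∀ {m} n (h : Fin n → Fin m) (f : ℕ → ℤ) {w : Fin m → ℤ} → (∀ i → w (h i) ≡ f (suc (toℕ i))) → sumOver (tabulate h) w ≡ prefix f n
  go zero    h f p = refl
  go (suc n) h f p = cong₂ _+ᶻ_ (p Fin.zero) (go n (h ∘ Fin.suc) (f ∘ suc) (p ∘ Fin.suc))

sumOver-allFin-const : ∀ n c → sumOver (allFin n) (λ _ → c) ≡ + n *ᶻ c
sumOver-allFin-const n c = trans (sumOver-allFin n (λ _ → c)) (go n)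
  where
  lemma : ∀ n c → c +ᶻ n *ᶻ c ≡ (+ 1 +ᶻ n) *ᶻ c
  lemma = ℤ-ring
  go : ∀ n → prefix (λ _ → c) n ≡ + n *ᶻ c
  go zero    = sym (ℤₚ.*-zeroˡ c)
  go (suc n) = trans (cong (c +ᶻ_) (go n)) (lemma (+ n) c)

sums₂-lambert : ∀ h → sums₂ h ≈ lambert (λ a s → (+ a -ᶻ + 1) *ᶻ h s s)
sums₂-lambert h = ≈-trans (gen-labelled Divisions proj₁ _) (gen-cong Divisions λ (a , s) →
  trans (sumOver-allFin-const a (h (suc s) (suc s))) (cong (_*ᶻ h (suc s) (suc s)) (sym (lemma (+ a)))))
  where
  lemma : ∀ a → + 1 +ᶻ a -ᶻ + 1 ≡ a
  lemma = ℤ-ring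

sums₁-sum : ∀ f → sums₁ (λ α β → f (α + β)) ≈ lambert (λ a s → (+ s -ᶻ + 1) *ᶻ f s)
sums₁-sum f = ≈-trans (gen-cong Sums₁ λ ((a , s) , l) → cong f (trans (cong suc (ℕₚ.+-suc _ _)) (cong suc (cong proj₁ (label-unlabel (s , l))))))
  (≈-trans (gen-labelled Divisions proj₂ _) (gen-cong Divisions λ (a , s) →
    trans (sumOver-allFin-const s (f (suc s))) (cong (_*ᶻ f (suc s)) (sym (lemma (+ s))))))
  where
  lemma : ∀ a → + 1 +ᶻ a -ᶻ + 1 ≡ a
  lemma = ℤ-ring

sums₁-first : ∀ f → sums₁ (λ α β → f α) ≈ lambert (λ a s → prefix f (s ∸ 1))
sums₁-first f = ≈-trans (gen-cong Sums₁ (λ ((a , s) , l) → cong (f ∘ suc) (unlabel-first s l)))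
  (≈-trans (gen-labelled Divisions proj₂ _) (gen-cong Divisions λ (a , s) → sumOver-allFin s f))
  where
  unlabel-first : ∀ s (l : Fin s) → proj₁ (unlabel (s , l)) ≡ toℕ l
  unlabel-first (suc s) l = refl

lambert-cong : ∀ {g g′} → (∀ a s → g a s ≡ g′ a s) → lambert g ≈ lambert g′
lambert-cong p = gen-cong Divisions (λ (a , s) → p (suc a) (suc s))

lambert-+ : ∀ g g′ → lambert (λ a s → g a s +ᶻ g′ a s) ≈ lambert g +ˢ lambert g′
lambert-+ g g′ = gen-+ Divisions _ _

lambert-* : ∀ c g → lambert (λ a s → c *ᶻ g a s) ≈ const c *ˢ lambert g
lambert-* c g = gen-* Divisions c _

-- Collects the contributions of the solutions with A = B or with α = β, which become factorisations
-- n = a · s.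
boundary : (ℕ → ℤ) → ℕ → ℕ → ℤ
boundary f a s = (+ a -ᶻ + 1) *ᶻ f 0 +ᶻ + 2 *ᶻ ((+ a -ᶻ + 1) *ᶻ f s) +ᶻ (-ᶻ + 1 *ᶻ ((+ s -ᶻ + 1) *ᶻ f s) +ᶻ -ᶻ + 2 *ᶻ prefix f (s ∸ 1))

-- Split by α and β, the weight f |α - β| becomes f y on `Crossed`; split by A and B, the weight f
-- (α + β) becomes f (x + y). The two are compared by counting the weight f α in both ways, where
-- the terms f x cancel.
liouville : ∀ f → pairs (λ α β → f ∣ α - β ∣) -ˢ pairs (λ α β → f (α + β)) ≈ lambert (boundary f)
liouville f = begin
  pairs (λ α β → f ∣ α - β ∣) -ˢ pairs (λ α β → f (α + β))
    ≈⟨ +ˢ-cong (≈-trans (pairs-by-second (λ α β → f ∣ α - β ∣)) (+ˢ-cong sums₂-diff (+ˢ-cong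
         (gen-cong Crossed (λ (_ , (x , y)) → cong f (trans (ℕₚ.∣-∣-comm (suc x) (suc x + suc y)) (∣m+n-m∣≡n (suc x) (suc y)))))
         (gen-cong Crossed (λ (_ , (x , y)) → cong f (∣m+n-m∣≡n (suc x) (suc y)))))))
       (-ˢ-cong (≈-trans (pairs-by-first (λ α β → f (α + β))) (+ˢ-cong (sums₁-sum f) (+ˢ-cong
         (gen-cong Crossed (λ (_ , (x , y)) → cong f (ℕₚ.+-comm (suc y) (suc x)))) ≈-refl)))) ⟩
  E₀ +ˢ (Ky +ˢ Ky) -ˢ (E₁ +ˢ (Kxy +ˢ Kxy))
    ≈⟨ solve 4 (λ e k e′ k′ → e :+ (k :+ k) :- (e′ :+ (k′ :+ k′)) := e :+ con (+ 2) :* (k :- k′) :- e′) ≈-refl E₀ Ky E₁ Kxy ⟩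
  E₀ +ˢ const (+ 2) *ˢ (Ky -ˢ Kxy) -ˢ E₁
    ≈⟨ +ˢ-cong {g = -ˢ E₁} (+ˢ-cong {E₀} ≈-refl (*ˢ-cong {const (+ 2)} ≈-refl difference)) ≈-refl ⟩
  E₀ +ˢ const (+ 2) *ˢ (E₂ -ˢ E₃) -ˢ E₁
    ≈⟨ solve 4 (λ a b c d → a :+ con (+ 2) :* (b :- c) :- d := a :+ con (+ 2) :* b :+ (con (-ᶻ + 1) :* d :+ con (-ᶻ + 2) :* c)) ≈-refl E₀ E₂ E₃ E₁ ⟩
  E₀ +ˢ const (+ 2) *ˢ E₂ +ˢ (const (-ᶻ + 1) *ˢ E₁ +ˢ const (-ᶻ + 2) *ˢ E₃)
    ≈⟨ ≈-trans (lambert-+ (λ a s → e₀ a s +ᶻ + 2 *ᶻ e₂ a s) (λ a s → -ᶻ + 1 *ᶻ e₁ a s +ᶻ -ᶻ + 2 *ᶻ e₃ a s))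
         (+ˢ-cong (≈-trans (lambert-+ e₀ (λ a s → + 2 *ᶻ e₂ a s)) (+ˢ-cong {E₀} ≈-refl (lambert-* (+ 2) e₂)))
         (≈-trans (lambert-+ (λ a s → -ᶻ + 1 *ᶻ e₁ a s) (λ a s → -ᶻ + 2 *ᶻ e₃ a s)) (+ˢ-cong (lambert-* (-ᶻ + 1) e₁) (lambert-* (-ᶻ + 2) e₃)))) ⟨
  lambert (boundary f) ∎
  where
  open ≈-Reasoning
  e₀ e₁ e₂ e₃ : ℕ → ℕ → ℤ
  Kx Ky Kxy E₀ E₁ E₂ E₃ : Series
  Kx  = crossed (λ x y → f x)
  Ky  = crossed (λ x y → f y)
  Kxy = crossed (λ x y → f (x + y))
  e₀ = λ (a s : ℕ) → (+ a -ᶻ + 1) *ᶻ f 0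
  E₀ = lambert e₀
  e₁ = λ (a s : ℕ) → (+ s -ᶻ + 1) *ᶻ f s
  E₁ = lambert e₁
  e₂ = λ (a s : ℕ) → (+ a -ᶻ + 1) *ᶻ f s
  E₂ = lambert e₂
  e₃ = λ (a s : ℕ) → prefix f (s ∸ 1)
  E₃ = lambert e₃
  ∣m+n-m∣≡n : ∀ m n → ∣ m + n - m ∣ ≡ n
  ∣m+n-m∣≡n m n = trans (ℕₚ.∣-∣-comm (m + n) m) (ℕₚ.∣m-m+n∣≡n m n)
  sums₂-diff : sums₂ (λ α β → f ∣ α - β ∣) ≈ E₀
  sums₂-diff = ≈-trans (sums₂-lambert (λ α β → f ∣ α - β ∣)) (lambert-cong (λ a s → cong (λ m → (+ a -ᶻ + 1) *ᶻ f m) (ℕₚ.∣n-n∣≡0 s)))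
  two-ways : E₃ +ˢ (Ky +ˢ Kx) ≈ E₂ +ˢ (Kx +ˢ Kxy)
  two-ways = ≈-trans (≈-sym (≈-trans (pairs-by-first (λ α β → f α)) (+ˢ-cong (sums₁-first f) ≈-refl)))
    (≈-trans (pairs-by-second (λ α β → f α)) (+ˢ-cong (sums₂-lambert (λ α β → f α)) ≈-refl))
  difference : Ky -ˢ Kxy ≈ E₂ -ˢ E₃
  difference = begin
    Ky -ˢ Kxy                                       ≈⟨ solve 4 (λ k x k′ e → k :- k′ := e :+ (k :+ x) :- e :- x :- k′) ≈-refl Ky Kx Kxy E₃ ⟩
    E₃ +ˢ (Ky +ˢ Kx) -ˢ E₃ -ˢ Kx -ˢ Kxy             ≈⟨ +ˢ-cong {g = -ˢ Kxy} (+ˢ-cong {g = -ˢ Kx} (+ˢ-cong {g = -ˢ E₃} two-ways ≈-refl) ≈-refl) ≈-refl ⟩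
    E₂ +ˢ (Kx +ˢ Kxy) -ˢ E₃ -ˢ Kx -ˢ Kxy            ≈⟨ solve 4 (λ x k e e′ → e :+ (x :+ k) :- e′ :- x :- k := e :- e′) ≈-refl Kx Kxy E₂ E₃ ⟩
    E₂ -ˢ E₃                                        ∎

-- The characters modulo 4 and 8

-- χ₄ = (−4/·), χ₈ = (8/·), χ₋₈ = (−8/·), and χ₄′ n = χ₄ (n / 2) for even n.
χ₄ χ₈ χ₋₈ χ₄′ f₄ f₈ : ℕ → ℤ
χ₄ 0 = + 0
χ₄ 1 = + 1
χ₄ 2 = + 0
χ₄ 3 = -[1+ 0 ]
χ₄ (suc (suc (suc (suc n)))) = χ₄ n
χ₈ 0 = + 0
χ₈ 1 = + 1
χ₈ 2 = + 0
χ₈ 3 = -[1+ 0 ]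
χ₈ 4 = + 0
χ₈ 5 = -[1+ 0 ]
χ₈ 6 = + 0
χ₈ 7 = + 1
χ₈ (suc (suc (suc (suc (suc (suc (suc (suc n)))))))) = χ₈ n
χ₋₈ 0 = + 0
χ₋₈ 1 = + 1
χ₋₈ 2 = + 0
χ₋₈ 3 = + 1
χ₋₈ 4 = + 0
χ₋₈ 5 = -[1+ 0 ]
χ₋₈ 6 = + 0
χ₋₈ 7 = -[1+ 0 ]
χ₋₈ (suc (suc (suc (suc (suc (suc (suc (suc n)))))))) = χ₋₈ n
χ₄′ 0 = + 0
χ₄′ 1 = + 0
χ₄′ 2 = + 1
χ₄′ 3 = + 0
χ₄′ 4 = + 0
χ₄′ 5 = + 0
χ₄′ 6 = -[1+ 0 ]
χ₄′ 7 = + 0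
χ₄′ (suc (suc (suc (suc (suc (suc (suc (suc n)))))))) = χ₄′ n
f₄ 0 = + 1
f₄ 1 = + 0
f₄ 2 = -[1+ 0 ]
f₄ 3 = + 0
f₄ (suc (suc (suc (suc n)))) = f₄ n
f₈ 0 = + 1
f₈ 1 = + 0
f₈ 2 = + 0
f₈ 3 = + 0
f₈ 4 = -[1+ 0 ]
f₈ 5 = + 0
f₈ 6 = + 0
f₈ 7 = + 0
f₈ (suc (suc (suc (suc (suc (suc (suc (suc n)))))))) = f₈ n

-- Identities between periodic functions by verification on residues

module _ (p : ℕ) .{{_ : NonZero p}} (P : ℕ → Set) (step : ∀ n → P n → P (p + n)) (base : ∀ (r : Fin p) → P (toℕ r)) where

  by-residue : ∀ n → P n
  by-residue n = subst P (sym (trans (m≡m%n+[m/n]*n n p) (ℕₚ.+-comm (n % p) (n / p * p)))) (climb (n / p))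
    where
    climb : ∀ k → P (k * p + n % p)
    climb zero    = subst P (Finₚ.toℕ-fromℕ< (m%n<n n p)) (base (fromℕ< (m%n<n n p)))
    climb (suc k) = subst P (sym (ℕₚ.+-assoc p (k * p) (n % p))) (step (k * p + n % p) (climb k))

check : ∀ (E E′ : ℕ → ℤ) → (∀ n → E (8 + n) ≡ E n) → (∀ n → E′ (8 + n) ≡ E′ n) →
  {True (Finₚ.all? (λ (r : Fin 8) → E (toℕ r) ℤ.≟ E′ (toℕ r)))} → ∀ n → E n ≡ E′ n
check E E′ p p′ {t} = by-residue 8 (λ n → E n ≡ E′ n) (λ n q → trans (p n) (trans q (sym (p′ n)))) (toWitness t)

check₂ : ∀ (E E′ : ℕ → ℕ → ℤ) → (∀ m n → E (8 + m) n ≡ E m n) → (∀ m n → E m (8 + n) ≡ E m n) →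
  (∀ m n → E′ (8 + m) n ≡ E′ m n) → (∀ m n → E′ m (8 + n) ≡ E′ m n) →
  {True (Finₚ.all? (λ (r : Fin 8) → Finₚ.all? (λ (t : Fin 8) → E (toℕ r) (toℕ t) ℤ.≟ E′ (toℕ r) (toℕ t))))} →
  ∀ m n → E m n ≡ E′ m n
check₂ E E′ p q p′ q′ {t} m = by-residue 8 (λ n → E m n ≡ E′ m n) (λ n e → trans (q m n) (trans e (sym (q′ m n))))
  (λ s → by-residue 8 (λ m → E m (toℕ s) ≡ E′ m (toℕ s)) (λ m e → trans (p m (toℕ s)) (trans e (sym (p′ m (toℕ s))))) (λ r → toWitness t r s) m)

-- It suffices to compare f |α − β| − f (α + β) with H for β = α + γ, where both sides are periodic.
module _ (f : ℕ → ℤ) (H : ℕ → ℕ → ℤ) (H-sym : ∀ α β → H α β ≡ H β α) (f-periodic : ∀ n → f (8 + n) ≡ f n)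
  (Hˡ : ∀ α β → H (8 + α) β ≡ H α β)
  {t : True (Finₚ.all? (λ (r : Fin 8) → Finₚ.all? (λ (t : Fin 8) →
    f (toℕ t) -ᶻ f (toℕ r + (toℕ r + toℕ t)) ℤ.≟ H (toℕ r) (toℕ r + toℕ t))))} where

  private
    Hʳ : ∀ α β → H α (8 + β) ≡ H α β
    Hʳ α β = trans (H-sym α (8 + β)) (trans (Hˡ β α) (H-sym β α))
    D : ℕ → ℕ → ℤ
    D α γ = f γ -ᶻ f (α + (α + γ))
    shift₁ : ∀ α γ → 8 + α + (8 + α + γ) ≡ 8 + (8 + (α + (α + γ)))
    shift₁ = ℕ-ring
    shift₂ : ∀ α γ → α + (α + (8 + γ)) ≡ 8 + (α + (α + γ))
    shift₂ = ℕ-ring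
    shift₃ : ∀ α γ → α + (8 + γ) ≡ 8 + (α + γ)
    shift₃ = ℕ-ring
    ordered : ∀ α γ → D α γ ≡ H α (α + γ)
    ordered = check₂ D (λ α γ → H α (α + γ))
      (λ α γ → cong (λ u → f γ -ᶻ u) (trans (cong f (shift₁ α γ)) (trans (f-periodic (8 + (α + (α + γ)))) (f-periodic (α + (α + γ))))))
      (λ α γ → cong₂ _-ᶻ_ (f-periodic γ) (trans (cong f (shift₂ α γ)) (f-periodic (α + (α + γ)))))
      (λ α γ → trans (Hˡ α (8 + (α + γ))) (Hʳ α (α + γ)))
      (λ α γ → trans (cong (H α) (shift₃ α γ)) (Hʳ α (α + γ))) {t}

  difference-identity : ∀ α β → f ∣ α - β ∣ ≡ H α β +ᶻ f (α + β)
  difference-identity α β with ℕₚ.≤-total α β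
  ... | inj₁ α≤β with ℕₚ.m≤n⇒∃[o]m+o≡n α≤β
  ...   | γ , refl = trans (cong f (ℕₚ.∣m-m+n∣≡n α γ)) (solution (ordered α γ))
    where
    solution : ∀ {a b c} → a -ᶻ b ≡ c → a ≡ c +ᶻ b
    solution {a} {b} refl = sym (trans (ℤₚ.+-assoc a (-ᶻ b) b) (trans (cong (a +ᶻ_) (ℤₚ.+-inverseˡ b)) (ℤₚ.+-identityʳ a)))
  difference-identity α β | inj₂ β≤α with ℕₚ.m≤n⇒∃[o]m+o≡n β≤α
  ...   | γ , refl = trans (cong f (trans (ℕₚ.∣-∣-comm (β + γ) β) (ℕₚ.∣m-m+n∣≡n β γ)))
      (trans (solution (ordered β γ)) (cong₂ _+ᶻ_ (H-sym β (β + γ)) (cong f (ℕₚ.+-comm β (β + γ)))))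
    where
    solution : ∀ {a b c} → a -ᶻ b ≡ c → a ≡ c +ᶻ b
    solution {a} {b} refl = sym (trans (ℤₚ.+-assoc a (-ᶻ b) b) (trans (cong (a +ᶻ_) (ℤₚ.+-inverseˡ b)) (ℤₚ.+-identityʳ a)))

  liouville-with : pairs H ≈ lambert (boundary f)
  liouville-with = begin
    pairs H                                                                  ≈⟨ solve 2 (λ a b → a := a :+ b :- b) ≈-refl (pairs H) (pairs (λ α β → f (α + β))) ⟩
    pairs H +ˢ pairs (λ α β → f (α + β)) -ˢ pairs (λ α β → f (α + β))        ≈⟨ +ˢ-cong {g = -ˢ pairs (λ α β → f (α + β))}
        (≈-trans (≈-sym (gen-+ (Divisions ⊗ Divisions) (λ ((_ , α) , (_ , β)) → H (suc α) (suc β)) (λ ((_ , α) , (_ , β)) → f (suc α + suc β))))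
          (gen-cong (Divisions ⊗ Divisions) (λ ((_ , α) , (_ , β)) → sym (difference-identity (suc α) (suc β))))) ≈-refl ⟩
    pairs (λ α β → f ∣ α - β ∣) -ˢ pairs (λ α β → f (α + β))                 ≈⟨ liouville f ⟩
    lambert (boundary f)                                                     ∎
    where open ≈-Reasoning

pairs-* : ∀ (u v : ℕ → ℤ) → pairs (λ α β → u α *ᶻ v β) ≈ lambert (λ _ s → u s) *ˢ lambert (λ _ s → v s)
pairs-* u v = gen-⊗ Divisions Divisions (λ (_ , s) → u (suc s)) (λ (_ , s) → v (suc s))

pairs-+ : ∀ (g h : ℕ → ℕ → ℤ) → pairs (λ α β → g α β +ᶻ h α β) ≈ pairs g +ˢ pairs h
pairs-+ g h = gen-+ (Divisions ⊗ Divisions) (λ ((_ , α) , (_ , β)) → g (suc α) (suc β)) (λ ((_ , α) , (_ , β)) → h (suc α) (suc β))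

pairs-•* : ∀ c (u v : ℕ → ℤ) → pairs (λ α β → c *ᶻ (u α *ᶻ v β)) ≈ const c *ˢ (lambert (λ _ s → u s) *ˢ lambert (λ _ s → v s))
pairs-•* c u v = ≈-trans (gen-* (Divisions ⊗ Divisions) c (λ ((_ , α) , (_ , β)) → u (suc α) *ᶻ v (suc β))) (*ˢ-cong {const c} ≈-refl (pairs-* u v))

-- Liouville's identity for the characters

ℓ₄ ℓ₄′ ℓ₈ σ σχ₈ : Series
ℓ₄  = lambert (λ _ s → χ₄ s)
ℓ₄′ = lambert (λ _ s → χ₄′ s)
ℓ₈  = lambert (λ _ s → χ₋₈ s)
σ   = lambert (λ a _ → + a)
σχ₈ = lambert (λ a s → + a *ᶻ χ₈ s)

lambert-cong-at : ∀ n {g g′} → (∀ a s → a * s ≡ n → g a s ≡ g′ a s) → lambert g n ≡ lambert g′ n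
lambert-cong-at n p = gen-cong-at Divisions n (λ (a , s) q → p (suc a) (suc s) q)

lambert-+-at : ∀ n g g′ → lambert (λ a s → g a s +ᶻ g′ a s) n ≡ lambert g n +ᶻ lambert g′ n
lambert-+-at n g g′ = at (lambert-+ g g′) n

lambert-*-at : ∀ n c g → lambert (λ a s → c *ᶻ g a s) n ≡ c *ᶻ lambert g n
lambert-*-at n c g = trans (at (lambert-* c g) n) (const-*ˢ-at n c (lambert g))

lambert-swap : ∀ g n → lambert g n ≡ lambert (λ a s → g s a) n
lambert-swap g n = gen-reindex Divisions Divisions _ _ n n (λ (a , s) → s , a) (λ (a , s) → s , a)
  (λ (a , s) p _ → trans (ℕₚ.*-comm (suc s) (suc a)) p , refl , refl)
  (λ (a , s) p _ → trans (ℕₚ.*-comm (suc s) (suc a)) p , refl , refl)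

private
  sym₂ : ∀ c (u : ℕ → ℤ) α β → c *ᶻ (u α *ᶻ u β) ≡ c *ᶻ (u β *ᶻ u α)
  sym₂ c u α β = cong (c *ᶻ_) (ℤₚ.*-comm (u α) (u β))

-- `χ₄ n` is sin(πn/2) and `f₄ n` is cos(πn/2); the identity on residues is cos(x - y) - cos(x + y)
-- = 2 sin x sin y.
ℓ₄² : const (+ 2) *ˢ (ℓ₄ *ˢ ℓ₄) ≈ lambert (boundary f₄)
ℓ₄² = ≈-trans (≈-sym (pairs-•* (+ 2) χ₄ χ₄)) (liouville-with f₄ (λ α β → + 2 *ᶻ (χ₄ α *ᶻ χ₄ β)) (sym₂ (+ 2) χ₄) (λ _ → refl) (λ _ _ → refl))

-- `f₈ n` is the mean of cos(πn/4) and cos(3πn/4). The sum of the sines of these two angles is √2 ·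
-- `χ₋₈ n` and their difference is 2 · `χ₄′ n`, which accounts for the coefficients 1 and 2.
ℓ₈² : ℓ₈ *ˢ ℓ₈ +ˢ const (+ 2) *ˢ (ℓ₄′ *ˢ ℓ₄′) ≈ lambert (boundary f₈)
ℓ₈² = ≈-trans (≈-sym (≈-trans (pairs-+ (λ α β → χ₋₈ α *ᶻ χ₋₈ β) (λ α β → + 2 *ᶻ (χ₄′ α *ᶻ χ₄′ β))) (+ˢ-cong (pairs-* χ₋₈ χ₋₈) (pairs-•* (+ 2) χ₄′ χ₄′))))
  (liouville-with f₈ (λ α β → χ₋₈ α *ᶻ χ₋₈ β +ᶻ + 2 *ᶻ (χ₄′ α *ᶻ χ₄′ β))
    (λ α β → cong₂ _+ᶻ_ (ℤₚ.*-comm (χ₋₈ α) (χ₋₈ β)) (sym₂ (+ 2) χ₄′ α β)) (λ _ → refl) (λ _ _ → refl))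

-- `χ₈ n` is cos(πn/4) - cos(3πn/4) divided by √2, so the addition formulas now yield the mixed
-- products of `χ₋₈` and `χ₄′`.
ℓ₈ℓ₄ : const (+ 4) *ˢ (ℓ₈ *ˢ ℓ₄′) ≈ lambert (boundary χ₈)
ℓ₈ℓ₄ = ≈-trans (solve 2 (λ a b → con (+ 4) :* (a :* b) := con (+ 2) :* (a :* b) :+ con (+ 2) :* (b :* a)) ≈-refl ℓ₈ ℓ₄′)
  (≈-trans (≈-sym (≈-trans (pairs-+ (λ α β → + 2 *ᶻ (χ₋₈ α *ᶻ χ₄′ β)) (λ α β → + 2 *ᶻ (χ₄′ α *ᶻ χ₋₈ β))) (+ˢ-cong (pairs-•* (+ 2) χ₋₈ χ₄′) (pairs-•* (+ 2) χ₄′ χ₋₈))))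
    (liouville-with χ₈ (λ α β → + 2 *ᶻ (χ₋₈ α *ᶻ χ₄′ β) +ᶻ + 2 *ᶻ (χ₄′ α *ᶻ χ₋₈ β))
      (λ α β → trans (ℤₚ.+-comm (+ 2 *ᶻ (χ₋₈ α *ᶻ χ₄′ β)) _) (cong₂ (λ u v → + 2 *ᶻ u +ᶻ + 2 *ᶻ v) (ℤₚ.*-comm (χ₄′ α) (χ₋₈ β)) (ℤₚ.*-comm (χ₋₈ α) (χ₄′ β))))
      (λ _ → refl) (λ _ _ → refl)))

-- Evaluation of the boundary terms

even≢odd : ∀ k j → k * 2 ≢ 1 + j * 2
even≢odd k j p with trans (sym (half-even k)) (trans (cong halfℕ p) (half-odd j))
... | ()

parityℕ : ∀ n → (∃ λ k → n ≡ k * 2) ⊎ (∃ λ k → n ≡ 1 + k * 2)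
parityℕ n with halfℕ n | unhalf-half n
... | inj₁ k | p = inj₁ (k , sym p)
... | inj₂ k | p = inj₂ (k , sym p)

odd-factor : ∀ a s j → a * s ≡ 1 + j * 2 → ∃ λ i → s ≡ 1 + i * 2
odd-factor a s j p with parityℕ s
... | inj₂ q = q
... | inj₁ (k , refl) = contradiction (trans (ℕₚ.*-assoc a k 2) p) (even≢odd (a * k) j)

odd-factorˡ : ∀ a s j → a * s ≡ 1 + j * 2 → ∃ λ i → a ≡ 1 + i * 2
odd-factorˡ a s j p = odd-factor s a j (trans (ℕₚ.*-comm s a) p)

even-factor : ∀ i s m → (1 + i * 2) * s ≡ m * 2 → ∃ λ k → s ≡ k * 2
even-factor i s m p with parityℕ s
... | inj₁ q = q
... | inj₂ (k , refl) = contradiction (trans (sym p) (lemma i k)) (even≢odd m (k + i + i * k * 2))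
  where
  lemma : ∀ i k → (1 + i * 2) * (1 + k * 2) ≡ 1 + (k + i + i * k * 2) * 2
  lemma = ℕ-ring

climb-period : ∀ (f : ℕ → ℤ) → (∀ n → f (8 + n) ≡ f n) → ∀ k r → f (k * 8 + r) ≡ f r
climb-period f p zero    r = refl
climb-period f p (suc k) r = trans (p (k * 8 + r)) (climb-period f p k r)

prefix-f₄ : ∀ n → prefix f₄ (8 + n) ≡ prefix f₄ n
prefix-f₄ n = lemma (prefix f₄ n)
  where
  lemma : ∀ x → + 0 +ᶻ (-[1+ 0 ] +ᶻ (+ 0 +ᶻ (+ 1 +ᶻ (+ 0 +ᶻ (-[1+ 0 ] +ᶻ (+ 0 +ᶻ (+ 1 +ᶻ x))))))) ≡ x
  lemma = ℤ-ring

prefix-f₈ : ∀ n → prefix f₈ (8 + n) ≡ prefix f₈ n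
prefix-f₈ n = lemma (prefix f₈ n)
  where
  lemma : ∀ x → + 0 +ᶻ (+ 0 +ᶻ (+ 0 +ᶻ (-[1+ 0 ] +ᶻ (+ 0 +ᶻ (+ 0 +ᶻ (+ 0 +ᶻ (+ 1 +ᶻ x))))))) ≡ x
  lemma = ℤ-ring

prefix-χ₈ : ∀ n → prefix χ₈ (8 + n) ≡ prefix χ₈ n
prefix-χ₈ n = lemma (prefix χ₈ n)
  where
  lemma : ∀ x → + 1 +ᶻ (+ 0 +ᶻ (-[1+ 0 ] +ᶻ (+ 0 +ᶻ (-[1+ 0 ] +ᶻ (+ 0 +ᶻ (+ 1 +ᶻ (+ 0 +ᶻ x))))))) ≡ x
  lemma = ℤ-ring

boundary-odd : ∀ f → f 0 ≡ + 1 → ∀ (χ : ℕ → ℤ) → (∀ i → f (1 + i * 2) ≡ + 0) → (∀ i → + 1 +ᶻ + 2 *ᶻ prefix f (i * 2) ≡ χ (1 + i * 2)) →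
  ∀ a i → boundary f a (1 + i * 2) ≡ + a -ᶻ χ (1 + i * 2)
boundary-odd f f0 χ z p a i rewrite f0 | z i = trans (lemma (+ a) (+ (1 + i * 2)) (prefix f (i * 2))) (cong (λ u → + a -ᶻ u) (p i))
  where
  lemma : ∀ a s x → (a -ᶻ + 1) *ᶻ + 1 +ᶻ + 2 *ᶻ ((a -ᶻ + 1) *ᶻ + 0) +ᶻ (-ᶻ + 1 *ᶻ ((s -ᶻ + 1) *ᶻ + 0) +ᶻ -ᶻ + 2 *ᶻ x) ≡ a -ᶻ (+ 1 +ᶻ + 2 *ᶻ x)
  lemma = ℤ-ring

boundary-f₄-odd : ∀ a i → boundary f₄ a (1 + i * 2) ≡ + a -ᶻ χ₄ (1 + i * 2)
boundary-f₄-odd = boundary-odd f₄ refl χ₄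
  (check (λ i → f₄ (1 + i * 2)) (λ _ → + 0) (λ _ → refl) (λ _ → refl))
  (check (λ i → + 1 +ᶻ + 2 *ᶻ prefix f₄ (i * 2)) (λ i → χ₄ (1 + i * 2))
    (λ i → cong (λ x → + 1 +ᶻ + 2 *ᶻ x) (trans (prefix-f₄ (8 + i * 2)) (prefix-f₄ (i * 2)))) (λ _ → refl))

boundary-f₈-odd : ∀ a i → boundary f₈ a (1 + i * 2) ≡ + a -ᶻ χ₋₈ (1 + i * 2)
boundary-f₈-odd = boundary-odd f₈ refl χ₋₈
  (check (λ i → f₈ (1 + i * 2)) (λ _ → + 0) (λ _ → refl) (λ _ → refl))
  (check (λ i → + 1 +ᶻ + 2 *ᶻ prefix f₈ (i * 2)) (λ i → χ₋₈ (1 + i * 2))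
    (λ i → cong (λ x → + 1 +ᶻ + 2 *ᶻ x) (trans (prefix-f₈ (8 + i * 2)) (prefix-f₈ (i * 2)))) (λ _ → refl))

boundary-χ₈-odd : ∀ a i → let s = 1 + i * 2 in boundary χ₈ a s ≡ + 2 *ᶻ (+ a *ᶻ χ₈ s) +ᶻ (-[1+ 0 ] *ᶻ (+ s *ᶻ χ₈ s) +ᶻ -[1+ 0 ] *ᶻ χ₋₈ s)
boundary-χ₈-odd a i = trans (lemma (+ a) (+ (1 + i * 2)) (χ₈ (1 + i * 2)) (prefix χ₈ (i * 2)))
  (cong (λ u → + 2 *ᶻ (+ a *ᶻ χ₈ (1 + i * 2)) +ᶻ (-[1+ 0 ] *ᶻ (+ (1 + i * 2) *ᶻ χ₈ (1 + i * 2)) +ᶻ -[1+ 0 ] *ᶻ u)) (sum i))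
  where
  lemma : ∀ a s c x → (a -ᶻ + 1) *ᶻ + 0 +ᶻ + 2 *ᶻ ((a -ᶻ + 1) *ᶻ c) +ᶻ (-ᶻ + 1 *ᶻ ((s -ᶻ + 1) *ᶻ c) +ᶻ -ᶻ + 2 *ᶻ x)
    ≡ + 2 *ᶻ (a *ᶻ c) +ᶻ (-[1+ 0 ] *ᶻ (s *ᶻ c) +ᶻ -[1+ 0 ] *ᶻ (c +ᶻ + 2 *ᶻ x))
  lemma = ℤ-ring
  sum : ∀ i → χ₈ (1 + i * 2) +ᶻ + 2 *ᶻ prefix χ₈ (i * 2) ≡ χ₋₈ (1 + i * 2)
  sum = check (λ i → χ₈ (1 + i * 2) +ᶻ + 2 *ᶻ prefix χ₈ (i * 2)) (λ i → χ₋₈ (1 + i * 2))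
    (λ i → cong (λ x → χ₈ (1 + i * 2) +ᶻ + 2 *ᶻ x) (trans (prefix-χ₈ (8 + i * 2)) (prefix-χ₈ (i * 2)))) (λ _ → refl)

boundary-f₄-even : ∀ a i → boundary f₄ a ((1 + i * 2) * 2) ≡ + ((1 + i * 2) * 2) -ᶻ + a
boundary-f₄-even a i = trans (cong₂ (λ u v → (+ a -ᶻ + 1) *ᶻ + 1 +ᶻ + 2 *ᶻ ((+ a -ᶻ + 1) *ᶻ u) +ᶻ (-ᶻ + 1 *ᶻ ((+ s -ᶻ + 1) *ᶻ u) +ᶻ -ᶻ + 2 *ᶻ v)) (value i) (zero-sum i))
  (lemma (+ a) (+ s))
  where
  s = (1 + i * 2) * 2
  value : ∀ i → f₄ ((1 + i * 2) * 2) ≡ -[1+ 0 ]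
  value = check (λ i → f₄ ((1 + i * 2) * 2)) (λ _ → -[1+ 0 ]) (λ _ → refl) (λ _ → refl)
  zero-sum : ∀ i → prefix f₄ ((1 + i * 2) * 2 ∸ 1) ≡ + 0
  zero-sum = check (λ i → prefix f₄ ((1 + i * 2) * 2 ∸ 1)) (λ _ → + 0)
    (λ i → let n = (1 + i * 2) * 2 ∸ 1 in trans (prefix-f₄ (24 + n)) (trans (prefix-f₄ (16 + n)) (trans (prefix-f₄ (8 + n)) (prefix-f₄ n)))) (λ _ → refl)
  lemma : ∀ a s → (a -ᶻ + 1) *ᶻ + 1 +ᶻ + 2 *ᶻ ((a -ᶻ + 1) *ᶻ -[1+ 0 ]) +ᶻ (-ᶻ + 1 *ᶻ ((s -ᶻ + 1) *ᶻ -[1+ 0 ]) +ᶻ -ᶻ + 2 *ᶻ + 0) ≡ s -ᶻ a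
  lemma = ℤ-ring

-- If only the s divisible by p carry weight, the factor p can be taken out of s, leaving the
-- factorisations of m.
lambert-scale : ∀ p′ → let p = suc p′ in ∀ (w : ℕ → ℕ → ℤ) m → (∀ a s → a * s ≡ m * p → w a s ≢ + 0 → p ∣ s) →
  lambert w (m * p) ≡ lambert (λ a s → w a (s * p)) m
lambert-scale p′ w m multiple = gen-reindex Divisions Divisions _ _ (m * p) m f g to from
  where
  p = suc p′
  f g : ℕ × ℕ → ℕ × ℕ
  f (a , s) = a , pred (suc s / p)
  g (a , k) = a , p′ + k * p
  f-g : ∀ k → pred (suc k * p / p) ≡ k
  f-g k = cong pred (m*n/n≡m (suc k) p)
  to : ∀ x → size Divisions x ≡ m * p → w (suc (proj₁ x)) (suc (proj₂ x)) ≢ + 0 →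
    size Divisions (f x) ≡ m × g (f x) ≡ x × w (suc (proj₁ x)) (suc (proj₂ (f x)) * p) ≡ w (suc (proj₁ x)) (suc (proj₂ x))
  to (a , s) q nz with multiple (suc a) (suc s) q nz
  ... | divides (suc k) refl =
    trans (cong (λ k → suc a * suc k) (f-g k)) (ℕₚ.*-cancelʳ-≡ (suc a * suc k) m p (trans (ℕₚ.*-assoc (suc a) (suc k) p) q))
    , cong (λ k → g (a , k)) (f-g k) , cong (λ k → w (suc a) (suc k * p)) (f-g k)
  from : ∀ y → size Divisions y ≡ m → w (suc (proj₁ y)) (suc (proj₂ y) * p) ≢ + 0 →
    size Divisions (g y) ≡ m * p × f (g y) ≡ y × w (suc (proj₁ y)) (suc (proj₂ (g y))) ≡ w (suc (proj₁ y)) (suc (proj₂ y) * p)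
  from (a , k) q _ = trans (sym (ℕₚ.*-assoc (suc a) (suc k) p)) (cong (_* p) q) , cong (a ,_) (f-g k) , refl

lambert-double : ∀ (w : ℕ → ℕ → ℤ) m → (∀ a s → a * s ≡ m * 2 → w a s ≢ + 0 → ∃ λ k → s ≡ k * 2) → lambert w (m * 2) ≡ lambert (λ a s → w a (s * 2)) m
lambert-double w m even = lambert-scale 1 w m (λ a s p nz → let k , q = even a s p nz in divides k q)

-- An odd s leaves the factor 2 to its cofactor, so the factorisations of 2m that carry weight
-- correspond to those of m.
lambert-odd-double : ∀ (χ : ℕ → ℤ) → (∀ k → χ (k * 2) ≡ + 0) → ∀ m → lambert (λ _ s → χ s) (m * 2) ≡ lambert (λ _ s → χ s) m
lambert-odd-double χ z m = trans (lambert-swap (λ _ s → χ s) (m * 2)) (trans (lambert-double (λ a _ → χ a) m even) (lambert-swap (λ a _ → χ a) m))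
  where
  even : ∀ a s → a * s ≡ m * 2 → χ a ≢ + 0 → ∃ λ k → s ≡ k * 2
  even a s p nz with parityℕ a
  ... | inj₁ (k , refl) = contradiction (z k) nz
  ... | inj₂ (i , refl) = even-factor i s m p

ℓ₄-double : ∀ m → ℓ₄ (m * 2) ≡ ℓ₄ m
ℓ₄-double = lambert-odd-double χ₄ (check (λ k → χ₄ (k * 2)) (λ _ → + 0) (λ _ → refl) (λ _ → refl))

ℓ₈-double : ∀ m → ℓ₈ (m * 2) ≡ ℓ₈ m
ℓ₈-double = lambert-odd-double χ₋₈ (check (λ k → χ₋₈ (k * 2)) (λ _ → + 0) (λ _ → refl) (λ _ → refl))

ℓ₄′≈d2-ℓ₄ : ℓ₄′ ≈ d2 ℓ₄
ℓ₄′≈d2-ℓ₄ = pointwise go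
  where
  odd-zero : ∀ i → χ₄′ (1 + i * 2) ≡ + 0
  odd-zero = check (λ i → χ₄′ (1 + i * 2)) (λ _ → + 0) (λ _ → refl) (λ _ → refl)
  even-value : ∀ s → χ₄′ (s * 2) ≡ χ₄ s
  even-value = check (λ s → χ₄′ (s * 2)) χ₄ (λ _ → refl) (λ _ → refl)
  even : ∀ m (a s : ℕ) → a * s ≡ m * 2 → χ₄′ s ≢ + 0 → ∃ λ k → s ≡ k * 2
  even m a s _ nz with parityℕ s
  ... | inj₁ q = q
  ... | inj₂ (i , refl) = contradiction (odd-zero i) nz
  go : ∀ n → ℓ₄′ n ≡ d2 ℓ₄ n
  go n with parityℕ n
  ... | inj₁ (m , refl) = trans (lambert-double (λ _ s → χ₄′ s) m (even m)) (trans (lambert-cong-at m (λ _ s _ → even-value s)) (sym (d2-even m ℓ₄)))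
  ... | inj₂ (j , refl) = trans (lambert-cong-at (1 + j * 2) (λ a s p → let i , q = odd-factor a s j p in trans (cong χ₄′ q) (odd-zero i)))
    (trans (gen-0 (1 + j * 2)) (sym (d2-odd j ℓ₄)))
    where
    gen-0 : ∀ n → lambert (λ _ _ → + 0) n ≡ + 0
    gen-0 n = trans (lambert-cong-at n {λ _ _ → + 0} {λ _ _ → + 0 *ᶻ + 0} (λ _ _ _ → refl)) (trans (lambert-*-at n (+ 0) (λ _ _ → + 0)) (ℤₚ.*-zeroˡ (lambert (λ _ _ → + 0) n)))

lambert-neg-at : ∀ n (g : ℕ → ℕ → ℤ) → lambert (λ a s → -[1+ 0 ] *ᶻ g a s) n ≡ -ᶻ lambert g n
lambert-neg-at n g = trans (lambert-*-at n -[1+ 0 ] g) (ℤₚ.-1*i≡-i (lambert g n))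

lambert-difference : ∀ n (g h : ℕ → ℕ → ℤ) → lambert (λ a s → g a s -ᶻ h a s) n ≡ lambert g n -ᶻ lambert h n
lambert-difference n g h = trans (lambert-cong-at n (λ a s _ → cong (g a s +ᶻ_) (sym (ℤₚ.-1*i≡-i (h a s)))))
  (trans (lambert-+-at n g (λ a s → -[1+ 0 ] *ᶻ h a s)) (cong (lambert g n +ᶻ_) (lambert-neg-at n h)))

ℓ₄²-odd : ∀ j → + 2 *ᶻ (ℓ₄ *ˢ ℓ₄) (1 + j * 2) ≡ σ (1 + j * 2) -ᶻ ℓ₄ (1 + j * 2)
ℓ₄²-odd j = trans (sym (const-*ˢ-at (1 + j * 2) (+ 2) (ℓ₄ *ˢ ℓ₄))) (trans (at ℓ₄² (1 + j * 2)) (trans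
  (lambert-cong-at (1 + j * 2) (λ a s p → let i , q = odd-factor a s j p in subst (λ s → boundary f₄ a s ≡ + a -ᶻ χ₄ s) (sym q) (boundary-f₄-odd a i)))
  (lambert-difference (1 + j * 2) (λ a _ → + a) (λ _ s → χ₄ s))))

ℓ₈²-odd : ∀ j → (ℓ₈ *ˢ ℓ₈) (1 + j * 2) ≡ σ (1 + j * 2) -ᶻ ℓ₈ (1 + j * 2)
ℓ₈²-odd j = trans (sym (ℤₚ.+-identityʳ ((ℓ₈ *ˢ ℓ₈) n))) (trans (cong ((ℓ₈ *ˢ ℓ₈) n +ᶻ_) (sym vanishing)) (trans (at ℓ₈² n) (trans
  (lambert-cong-at n (λ a s p → let i , q = odd-factor a s j p in subst (λ s → boundary f₈ a s ≡ + a -ᶻ χ₋₈ s) (sym q) (boundary-f₈-odd a i)))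
  (lambert-difference n (λ a _ → + a) (λ _ s → χ₋₈ s)))))
  where
  n = 1 + j * 2
  vanishing : (const (+ 2) *ˢ (ℓ₄′ *ˢ ℓ₄′)) n ≡ + 0
  vanishing = trans (const-*ˢ-at n (+ 2) (ℓ₄′ *ˢ ℓ₄′)) (trans
    (cong (+ 2 *ᶻ_) (trans (at (≈-trans (*ˢ-cong ℓ₄′≈d2-ℓ₄ ℓ₄′≈d2-ℓ₄) (≈-sym (d2-* ℓ₄ ℓ₄))) n) (d2-odd j (ℓ₄ *ˢ ℓ₄)))) (ℤₚ.*-zeroʳ (+ 2)))

oddness : ℕ → ℤ
oddness zero          = + 0
oddness (suc zero)    = + 1
oddness (suc (suc n)) = oddness n

oddness-even : ∀ k → oddness (k * 2) ≡ + 0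
oddness-even zero    = refl
oddness-even (suc k) = oddness-even k

oddness-odd : ∀ k → oddness (1 + k * 2) ≡ + 1
oddness-odd zero    = refl
oddness-odd (suc k) = oddness-odd k

-- For odd m, a divisor s of 2m is odd or twice an odd number, and the boundary term has a closed
-- form in each case: the former contribute 2σ - `ℓ₄`, the latter 2σ - σ, all at m.
ℓ₄²-twice-odd : ∀ j → let m = 1 + j * 2 in + 2 *ᶻ (ℓ₄ *ˢ ℓ₄) (m * 2) ≡ + 3 *ᶻ σ m -ᶻ ℓ₄ m
ℓ₄²-twice-odd j = begin
  + 2 *ᶻ (ℓ₄ *ˢ ℓ₄) (m * 2)          ≡⟨ const-*ˢ-at (m * 2) (+ 2) (ℓ₄ *ˢ ℓ₄) ⟨
  (const (+ 2) *ˢ (ℓ₄ *ˢ ℓ₄)) (m * 2) ≡⟨ at ℓ₄² (m * 2) ⟩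
  lambert (boundary f₄) (m * 2)      ≡⟨ lambert-cong-at (m * 2) split ⟩
  lambert (λ a s → u a s +ᶻ v a s) (m * 2) ≡⟨ lambert-+-at (m * 2) u v ⟩
  lambert u (m * 2) +ᶻ lambert v (m * 2)   ≡⟨ cong₂ _+ᶻ_ odd-part even-part ⟩
  (+ 2 *ᶻ σ m -ᶻ ℓ₄ m) +ᶻ (+ 2 *ᶻ σ m -ᶻ σ m) ≡⟨ lemma (σ m) (ℓ₄ m) ⟩
  + 3 *ᶻ σ m -ᶻ ℓ₄ m                 ∎
  where
  open ≡-Reasoning
  m = 1 + j * 2
  u v : ℕ → ℕ → ℤ
  u a s = oddness s *ᶻ (+ a -ᶻ χ₄ s)
  v a s = (+ 1 -ᶻ oddness s) *ᶻ (+ s -ᶻ + a)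
  lemma : ∀ s l → (+ 2 *ᶻ s -ᶻ l) +ᶻ (+ 2 *ᶻ s -ᶻ s) ≡ + 3 *ᶻ s -ᶻ l
  lemma = ℤ-ring
  only-even : ∀ x y → y ≡ + 0 *ᶻ x +ᶻ (+ 1 -ᶻ + 0) *ᶻ y
  only-even = ℤ-ring
  only-odd : ∀ x y → x ≡ + 1 *ᶻ x +ᶻ (+ 1 -ᶻ + 1) *ᶻ y
  only-odd = ℤ-ring
  split : ∀ a s → a * s ≡ m * 2 → boundary f₄ a s ≡ u a s +ᶻ v a s
  split a s p with parityℕ s
  ... | inj₂ (i , refl) rewrite oddness-odd i = trans (boundary-f₄-odd a i) (only-odd (+ a -ᶻ χ₄ (1 + i * 2)) (+ (1 + i * 2) -ᶻ + a))
  ... | inj₁ (k , refl) with odd-factor a k j (ℕₚ.*-cancelʳ-≡ (a * k) m 2 (trans (ℕₚ.*-assoc a k 2) p))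
  ...   | i , refl rewrite oddness-even (1 + i * 2) = trans (boundary-f₄-even a i) (only-even (+ a -ᶻ χ₄ ((1 + i * 2) * 2)) (+ ((1 + i * 2) * 2) -ᶻ + a))
  odd-part : lambert u (m * 2) ≡ + 2 *ᶻ σ m -ᶻ ℓ₄ m
  odd-part = trans (lambert-swap u (m * 2)) (trans (lambert-double (λ a s → u s a) m even) (trans
    (lambert-cong-at m (λ a s p → let i , q = odd-factorˡ a s j p in
      trans (cong (_*ᶻ (+ (s * 2) -ᶻ χ₄ a)) (trans (cong oddness q) (oddness-odd i))) (trans (ℤₚ.*-identityˡ (+ (s * 2) -ᶻ χ₄ a)) (cong (_-ᶻ χ₄ a) (trans (ℤₚ.pos-* s 2) (ℤₚ.*-comm (+ s) (+ 2)))))))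
    (trans (lambert-swap (λ a s → + 2 *ᶻ + s -ᶻ χ₄ a) m) (trans (lambert-difference m (λ a _ → + 2 *ᶻ + a) (λ _ s → χ₄ s))
      (cong (_-ᶻ ℓ₄ m) (lambert-*-at m (+ 2) (λ a _ → + a)))))))
    where
    even : ∀ a s → a * s ≡ m * 2 → u s a ≢ + 0 → ∃ λ k → s ≡ k * 2
    even a s p nz with parityℕ a
    ... | inj₁ (k , refl) = contradiction (trans (cong (_*ᶻ (+ s -ᶻ χ₄ (k * 2))) (oddness-even k)) (ℤₚ.*-zeroˡ (+ s -ᶻ χ₄ (k * 2)))) nz
    ... | inj₂ (i , refl) = even-factor i s m p
  even-part : lambert v (m * 2) ≡ + 2 *ᶻ σ m -ᶻ σ m
  even-part = trans (lambert-double v m even) (trans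
    (lambert-cong-at m (λ a s p → trans (cong (λ o → (+ 1 -ᶻ o) *ᶻ (+ (s * 2) -ᶻ + a)) (oddness-even s)) (trans (ℤₚ.*-identityˡ (+ (s * 2) -ᶻ + a)) (cong (_-ᶻ + a) (trans (ℤₚ.pos-* s 2) (ℤₚ.*-comm (+ s) (+ 2)))))))
    (trans (lambert-difference m (λ _ s → + 2 *ᶻ + s) (λ a _ → + a))
      (cong (_-ᶻ σ m) (trans (lambert-*-at m (+ 2) (λ _ s → + s)) (cong (+ 2 *ᶻ_) (lambert-swap (λ _ s → + s) m))))))
    where
    even : ∀ a s → a * s ≡ m * 2 → v a s ≢ + 0 → ∃ λ k → s ≡ k * 2
    even a s p nz with parityℕ s
    ... | inj₁ q = q
    ... | inj₂ (i , refl) = contradiction (trans (cong (λ o → (+ 1 -ᶻ o) *ᶻ (+ (1 + i * 2) -ᶻ + a)) (oddness-odd i)) (ℤₚ.*-zeroˡ (+ (1 + i * 2) -ᶻ + a))) nz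

-- Characters of complementary divisors

module _ (χ : ℕ → ℤ) (periodic : ∀ n → χ (8 + n) ≡ χ n)
  {t : True (Finₚ.all? (λ (r : Fin 8) → Finₚ.all? (λ (t : Fin 8) →
    χ (toℕ r * toℕ t) *ᶻ χ (toℕ t) ℤ.≟ χ (toℕ r) *ᶻ (χ (toℕ t) *ᶻ χ (toℕ t)))))} where

  private
    multˡ : ∀ a s → χ ((8 + a) * s) ≡ χ (a * s)
    multˡ a s = trans (cong χ (lemma a s)) (climb-period χ periodic s (a * s))
      where
      lemma : ∀ a s → (8 + a) * s ≡ s * 8 + a * s
      lemma = ℕ-ring
    multʳ : ∀ a s → χ (a * (8 + s)) ≡ χ (a * s)
    multʳ a s = trans (cong χ (lemma a s)) (climb-period χ periodic a (a * s))
      where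
      lemma : ∀ a s → a * (8 + s) ≡ a * 8 + a * s
      lemma = ℕ-ring

  multiplicative : ∀ a s → χ (a * s) *ᶻ χ s ≡ χ a *ᶻ (χ s *ᶻ χ s)
  multiplicative = check₂ (λ a s → χ (a * s) *ᶻ χ s) (λ a s → χ a *ᶻ (χ s *ᶻ χ s))
    (λ a s → cong (_*ᶻ χ s) (multˡ a s))
    (λ a s → cong₂ _*ᶻ_ (multʳ a s) (periodic s))
    (λ a s → cong (_*ᶻ (χ s *ᶻ χ s)) (periodic a))
    (λ a s → cong (λ u → χ a *ᶻ (u *ᶻ u)) (periodic s)) {t}

  cofactor : ∀ a s c → χ s *ᶻ χ s ≡ + 1 → χ (a * s) ≡ c → χ a ≡ c *ᶻ χ s
  cofactor a s c p q = trans (sym (ℤₚ.*-identityʳ (χ a))) (trans (cong (χ a *ᶻ_) (sym p)) (trans (sym (multiplicative a s)) (cong (_*ᶻ χ s) q)))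

χ₄-square : ∀ i → χ₄ (1 + i * 2) *ᶻ χ₄ (1 + i * 2) ≡ + 1
χ₄-square = check (λ i → χ₄ (1 + i * 2) *ᶻ χ₄ (1 + i * 2)) (λ _ → + 1) (λ _ → refl) (λ _ → refl)

χ₈-square : ∀ i → χ₈ (1 + i * 2) *ᶻ χ₈ (1 + i * 2) ≡ + 1
χ₈-square = check (λ i → χ₈ (1 + i * 2) *ᶻ χ₈ (1 + i * 2)) (λ _ → + 1) (λ _ → refl) (λ _ → refl)

self-negative : ∀ x → x ≡ -ᶻ x → x ≡ + 0
self-negative (+ zero) p = refl

-- If a · s ≡ 3 (mod 4), then χ₄(a) = -χ₄(s), so exchanging the cofactors changes the sign of the
-- sum.
ℓ₄-3mod4 : ∀ t → ℓ₄ (3 + t * 4) ≡ + 0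
ℓ₄-3mod4 t = self-negative (ℓ₄ n) (trans (lambert-swap (λ _ s → χ₄ s) n) (trans
  (lambert-cong-at n (λ a s p → let i , q = odd-factor a s (1 + t * 2) (trans p (index t)) in
     cofactor χ₄ (λ _ → refl) a s -[1+ 0 ] (trans (cong (λ s → χ₄ s *ᶻ χ₄ s) q) (χ₄-square i)) (trans (cong χ₄ p) (value t))))
  (lambert-neg-at n (λ _ s → χ₄ s))))
  where
  n = 3 + t * 4
  index : ∀ t → 3 + t * 4 ≡ 1 + (1 + t * 2) * 2
  index = ℕ-ring
  value : ∀ t → χ₄ (3 + t * 4) ≡ -[1+ 0 ]
  value = check (λ t → χ₄ (3 + t * 4)) (λ _ → -[1+ 0 ]) (λ _ → refl) (λ _ → refl)

χ₈-cofactor : ∀ a s n c → χ₈ n ≡ c → (∃ λ j → n ≡ 1 + j * 2) → a * s ≡ n → χ₈ a ≡ c *ᶻ χ₈ s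
χ₈-cofactor a s n c v (j , o) p = let i , q = odd-factor a s j (trans p o) in
  cofactor χ₈ (λ _ → refl) a s c (trans (cong (λ s → χ₈ s *ᶻ χ₈ s) q) (χ₈-square i)) (trans (cong χ₈ p) v)

-- As a · s ≡ 1 (mod 8), cofactors have the same χ₈ and the sums of a χ₈(s) and s χ₈(s) agree. Their
-- coefficients 2 and -1 in the boundary term leave one copy.
ℓ₈ℓ₄-1mod8 : ∀ n → let N = 1 + n * 8 in + 4 *ᶻ (ℓ₈ *ˢ d2 ℓ₄) N ≡ σχ₈ N -ᶻ ℓ₈ N
ℓ₈ℓ₄-1mod8 n = begin
  + 4 *ᶻ (ℓ₈ *ˢ d2 ℓ₄) N               ≡⟨ const-*ˢ-at N (+ 4) (ℓ₈ *ˢ d2 ℓ₄) ⟨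
  (const (+ 4) *ˢ (ℓ₈ *ˢ d2 ℓ₄)) N     ≡⟨ at (*ˢ-cong {const (+ 4)} ≈-refl (*ˢ-cong {ℓ₈} ≈-refl ℓ₄′≈d2-ℓ₄)) N ⟨
  (const (+ 4) *ˢ (ℓ₈ *ˢ ℓ₄′)) N       ≡⟨ at ℓ₈ℓ₄ N ⟩
  lambert (boundary χ₈) N              ≡⟨ lambert-cong-at N (λ a s p → let i , q = odd-factor a s (n * 4) (trans p (index n)) in
    subst (λ s → boundary χ₈ a s ≡ + 2 *ᶻ (+ a *ᶻ χ₈ s) +ᶻ (-[1+ 0 ] *ᶻ (+ s *ᶻ χ₈ s) +ᶻ -[1+ 0 ] *ᶻ χ₋₈ s)) (sym q) (boundary-χ₈-odd a i)) ⟩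
  lambert (λ a s → + 2 *ᶻ (+ a *ᶻ χ₈ s) +ᶻ (-[1+ 0 ] *ᶻ (+ s *ᶻ χ₈ s) +ᶻ -[1+ 0 ] *ᶻ χ₋₈ s)) N
    ≡⟨ lambert-+-at N (λ a s → + 2 *ᶻ (+ a *ᶻ χ₈ s)) (λ a s → -[1+ 0 ] *ᶻ (+ s *ᶻ χ₈ s) +ᶻ -[1+ 0 ] *ᶻ χ₋₈ s) ⟩
  lambert (λ a s → + 2 *ᶻ (+ a *ᶻ χ₈ s)) N +ᶻ lambert (λ a s → -[1+ 0 ] *ᶻ (+ s *ᶻ χ₈ s) +ᶻ -[1+ 0 ] *ᶻ χ₋₈ s) N
    ≡⟨ cong₂ _+ᶻ_ (lambert-*-at N (+ 2) (λ a s → + a *ᶻ χ₈ s)) (trans (lambert-+-at N (λ a s → -[1+ 0 ] *ᶻ (+ s *ᶻ χ₈ s)) (λ a s → -[1+ 0 ] *ᶻ χ₋₈ s))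
         (cong₂ _+ᶻ_ (trans (lambert-neg-at N (λ a s → + s *ᶻ χ₈ s)) (cong -ᶻ_ swapped)) (lambert-neg-at N (λ a s → χ₋₈ s)))) ⟩
  + 2 *ᶻ σχ₈ N +ᶻ (-ᶻ σχ₈ N +ᶻ -ᶻ ℓ₈ N)    ≡⟨ lemma (σχ₈ N) (ℓ₈ N) ⟩
  σχ₈ N -ᶻ ℓ₈ N                          ∎
  where
  open ≡-Reasoning
  N = 1 + n * 8
  index : ∀ n → 1 + n * 8 ≡ 1 + n * 4 * 2
  index = ℕ-ring
  lemma : ∀ e l → + 2 *ᶻ e +ᶻ (-ᶻ e +ᶻ -ᶻ l) ≡ e -ᶻ l
  lemma = ℤ-ring
  value : ∀ n → χ₈ (1 + n * 8) ≡ + 1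
  value = check (λ n → χ₈ (1 + n * 8)) (λ _ → + 1) (λ _ → refl) (λ _ → refl)
  swapped : lambert (λ a s → + s *ᶻ χ₈ s) N ≡ σχ₈ N
  swapped = trans (lambert-swap (λ a s → + s *ᶻ χ₈ s) N) (lambert-cong-at N (λ a s p →
    cong (+ a *ᶻ_) (trans (χ₈-cofactor a s N (+ 1) (value n) (n * 4 , index n) p) (ℤₚ.*-identityˡ (χ₈ s)))))

-- φ(q)² and φ(q)φ(q²) as Lambert series

parity-even : ∀ f g m → (d2 f +ˢ X *ˢ d2 g) (m * 2) ≡ f m
parity-even f g m = trans (cong₂ _+ᶻ_ (d2-even m f) (go m)) (ℤₚ.+-identityʳ (f m))
  where
  go : ∀ m → (X *ˢ d2 g) (m * 2) ≡ + 0
  go zero    = refl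
  go (suc m) = trans (X-*ˢ-suc (d2 g) (1 + m * 2)) (d2-odd m g)

parity-odd : ∀ f g j → (d2 f +ˢ X *ˢ d2 g) (1 + j * 2) ≡ g j
parity-odd f g j = trans (cong₂ _+ᶻ_ (d2-odd j f) (trans (X-*ˢ-suc (d2 g) (j * 2)) (d2-even j g))) (ℤₚ.+-identityˡ (g j))

parity-split : ∀ f g → (∀ m → f (m * 2) ≡ f m) → (∀ j → f (1 + j * 2) ≡ g j) → f ≈ d2 f +ˢ X *ˢ d2 g
parity-split f g even odd = pointwise go
  where
  go : ∀ n → f n ≡ (d2 f +ˢ X *ˢ d2 g) n
  go n with parityℕ n
  ... | inj₁ (m , refl) = trans (even m) (sym (parity-even f g m))
  ... | inj₂ (j , refl) = trans (odd j) (sym (parity-odd f g j))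

module _ {f g : Series} (split : f ≈ d2 f +ˢ X *ˢ d2 g) where

  square-split : f *ˢ f ≈ d2 (f *ˢ f +ˢ X *ˢ (g *ˢ g)) +ˢ X *ˢ d2 (const (+ 2) *ˢ (f *ˢ g))
  square-split = ≈-trans (*ˢ-cong split split) (≈-trans
    (solve 3 (λ f x g → (f :+ x :* g) :* (f :+ x :* g) := f :* f :+ x :* x :* (g :* g) :+ x :* (con (+ 2) :* (f :* g))) ≈-refl (d2 f) X (d2 g))
    (≈-sym (+ˢ-cong (≈-trans (d2-+ (f *ˢ f) (X *ˢ (g *ˢ g))) (+ˢ-cong (d2-* f f) (≈-trans (d2-* X (g *ˢ g)) (*ˢ-cong d2-X (d2-* g g)))))
      (*ˢ-cong {X} ≈-refl (≈-trans (d2-* (const (+ 2)) (f *ˢ g)) (*ˢ-cong (d2-const (+ 2)) (d2-* f g)))))))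

  square-odd : ∀ j → (f *ˢ f) (1 + j * 2) ≡ + 2 *ᶻ (f *ˢ g) j
  square-odd j = trans (at square-split (1 + j * 2)) (trans (parity-odd (f *ˢ f +ˢ X *ˢ (g *ˢ g)) (const (+ 2) *ˢ (f *ˢ g)) j) (const-*ˢ-at j (+ 2) (f *ˢ g)))

  square-even : ∀ m → (f *ˢ f) (m * 2) ≡ (f *ˢ f) m +ᶻ (X *ˢ (g *ˢ g)) m
  square-even m = trans (at square-split (m * 2)) (parity-even (f *ˢ f +ˢ X *ˢ (g *ˢ g)) (const (+ 2) *ˢ (f *ˢ g)) m)

1ˢ-double : ∀ m → 1ˢ (m * 2) ≡ 1ˢ m
1ˢ-double zero    = refl
1ˢ-double (suc m) = refl

-- The candidates for φ(q)², φ(q)φ(q²) and ψ(q)².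
L₄ L₈ ℓ₄¹ : Series
L₄ = 1ˢ +ˢ const (+ 4) *ˢ ℓ₄
L₈ = 1ˢ +ˢ const (+ 2) *ˢ ℓ₈
ℓ₄¹ t = ℓ₄ (1 + t * 4)

4d2ℓ₄¹ : Series
4d2ℓ₄¹ = const (+ 4) *ˢ d2 ℓ₄¹

ℓ₄-odd : ∀ j → ℓ₄ (1 + j * 2) ≡ d2 ℓ₄¹ j
ℓ₄-odd j with parityℕ j
... | inj₁ (t , refl) = trans (cong ℓ₄ (cong suc (ℕₚ.*-assoc t 2 2))) (sym (d2-even t ℓ₄¹))
... | inj₂ (t , refl) = trans (cong ℓ₄ (index t)) (trans (ℓ₄-3mod4 t) (sym (d2-odd t ℓ₄¹)))
  where
  index : ∀ t → 1 + (1 + t * 2) * 2 ≡ 3 + t * 4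
  index = ℕ-ring

1+const*-at : ∀ c f n → (1ˢ +ˢ const c *ˢ f) n ≡ 1ˢ n +ᶻ c *ᶻ f n
1+const*-at c f n = cong (1ˢ n +ᶻ_) (const-*ˢ-at n c f)

L₄-split : L₄ ≈ d2 L₄ +ˢ X *ˢ d2 4d2ℓ₄¹
L₄-split = parity-split L₄ 4d2ℓ₄¹
  (λ m → trans (1+const*-at (+ 4) ℓ₄ (m * 2)) (trans (cong₂ (λ a b → a +ᶻ + 4 *ᶻ b) (1ˢ-double m) (ℓ₄-double m)) (sym (1+const*-at (+ 4) ℓ₄ m))))
  (λ j → trans (1+const*-at (+ 4) ℓ₄ (1 + j * 2)) (trans (ℤₚ.+-identityˡ (+ 4 *ᶻ ℓ₄ (1 + j * 2))) (trans (cong (+ 4 *ᶻ_) (ℓ₄-odd j)) (sym (const-*ˢ-at j (+ 4) (d2 ℓ₄¹))))))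

L₄²-at : ∀ n → (L₄ *ˢ L₄) (suc n) ≡ + 8 *ᶻ ℓ₄ (suc n) +ᶻ + 8 *ᶻ (+ 2 *ᶻ (ℓ₄ *ˢ ℓ₄) (suc n))
L₄²-at n = trans (at (solve 1 (λ l → (con (+ 1) :+ con (+ 4) :* l) :* (con (+ 1) :+ con (+ 4) :* l) := con (+ 1) :+ (con (+ 8) :* l :+ con (+ 16) :* (l :* l))) ≈-refl ℓ₄) (suc n))
  (trans (ℤₚ.+-identityˡ ((const (+ 8) *ˢ ℓ₄ +ˢ const (+ 16) *ˢ (ℓ₄ *ˢ ℓ₄)) (suc n))) (trans (cong₂ _+ᶻ_ (const-*ˢ-at (suc n) (+ 8) ℓ₄) (const-*ˢ-at (suc n) (+ 16) (ℓ₄ *ˢ ℓ₄))) (cong (+ 8 *ᶻ ℓ₄ (suc n) +ᶻ_) (ℤₚ.*-assoc (+ 8) (+ 2) ((ℓ₄ *ˢ ℓ₄) (suc n))))))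

L₄²-odd : ∀ j → (L₄ *ˢ L₄) (1 + j * 2) ≡ + 8 *ᶻ σ (1 + j * 2)
L₄²-odd j = trans (L₄²-at (j * 2)) (trans (cong (λ u → + 8 *ᶻ ℓ₄ (1 + j * 2) +ᶻ + 8 *ᶻ u) (ℓ₄²-odd j)) (lemma (ℓ₄ (1 + j * 2)) (σ (1 + j * 2))))
  where
  lemma : ∀ l s → + 8 *ᶻ l +ᶻ + 8 *ᶻ (s -ᶻ l) ≡ + 8 *ᶻ s
  lemma = ℤ-ring

L₄²-twice-odd : ∀ j → (L₄ *ˢ L₄) ((1 + j * 2) * 2) ≡ + 24 *ᶻ σ (1 + j * 2)
L₄²-twice-odd j = trans (L₄²-at (1 + j * 2 * 2)) (trans (cong₂ (λ u v → + 8 *ᶻ u +ᶻ + 8 *ᶻ v) (ℓ₄-double (1 + j * 2)) (ℓ₄²-twice-odd j)) (lemma (ℓ₄ (1 + j * 2)) (σ (1 + j * 2))))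
  where
  lemma : ∀ l s → + 8 *ᶻ l +ᶻ + 8 *ᶻ (+ 3 *ᶻ s -ᶻ l) ≡ + 24 *ᶻ s
  lemma = ℤ-ring

-- The odd part of a square is twice the product of the even and odd parts of its root. By
-- `L₄-split` the value 8σ of L₄² in odd degrees thus determines the product.
L₄ℓ₄¹-σ : ∀ t → (L₄ *ˢ d2 ℓ₄¹) t ≡ σ (1 + t * 2)
L₄ℓ₄¹-σ t = ℤₚ.*-cancelˡ-≡ (+ 8) ((L₄ *ˢ d2 ℓ₄¹) t) (σ (1 + t * 2)) (begin
  + 8 *ᶻ (L₄ *ˢ d2 ℓ₄¹) t          ≡⟨ ℤₚ.*-assoc (+ 2) (+ 4) ((L₄ *ˢ d2 ℓ₄¹) t) ⟩
  + 2 *ᶻ (+ 4 *ᶻ (L₄ *ˢ d2 ℓ₄¹) t) ≡⟨ cong (+ 2 *ᶻ_) (trans (sym (const-*ˢ-at t (+ 4) (L₄ *ˢ d2 ℓ₄¹))) (at (solve 2 (λ l z → con (+ 4) :* (l :* z) := l :* (con (+ 4) :* z)) ≈-refl L₄ (d2 ℓ₄¹)) t)) ⟩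
  + 2 *ᶻ (L₄ *ˢ 4d2ℓ₄¹) t          ≡⟨ square-odd L₄-split t ⟨
  (L₄ *ˢ L₄) (1 + t * 2)         ≡⟨ L₄²-odd t ⟩
  + 8 *ᶻ σ (1 + t * 2)           ∎)
  where open ≡-Reasoning

-- By `square-even` the coefficients of L₄² at 2(2t + 1) and at 2t + 1, namely 24σ and 8σ, differ by
-- 16 times the square of `ℓ₄¹`. With `L₄ℓ₄¹-σ` this yields for `ℓ₄¹` the relation that `ψ²` implies
-- for ψ².
ℓ₄¹²-σ : ∀ t → (ℓ₄¹ *ˢ ℓ₄¹) t ≡ σ (1 + t * 2)
ℓ₄¹²-σ t = ℤₚ.*-cancelˡ-≡ (+ 16) ((ℓ₄¹ *ˢ ℓ₄¹) t) (σ (1 + t * 2)) (begin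
  + 16 *ᶻ (ℓ₄¹ *ˢ ℓ₄¹) t
    ≡⟨ cong (+ 16 *ᶻ_) (trans (sym (d2-even t (ℓ₄¹ *ˢ ℓ₄¹))) (at (d2-* ℓ₄¹ ℓ₄¹) (t * 2))) ⟩
  + 16 *ᶻ (d2 ℓ₄¹ *ˢ d2 ℓ₄¹) (t * 2)
    ≡⟨ const-*ˢ-at (t * 2) (+ 16) (d2 ℓ₄¹ *ˢ d2 ℓ₄¹) ⟨
  (const (+ 16) *ˢ (d2 ℓ₄¹ *ˢ d2 ℓ₄¹)) (t * 2)
    ≡⟨ at (solve 1 (λ z → con (+ 16) :* (z :* z) := con (+ 4) :* z :* (con (+ 4) :* z)) ≈-refl (d2 ℓ₄¹)) (t * 2) ⟩
  (4d2ℓ₄¹ *ˢ 4d2ℓ₄¹) (t * 2)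
    ≡⟨ X-*ˢ-suc (4d2ℓ₄¹ *ˢ 4d2ℓ₄¹) (t * 2) ⟨
  (X *ˢ (4d2ℓ₄¹ *ˢ 4d2ℓ₄¹)) (1 + t * 2)
    ≡⟨ lemma ((X *ˢ (4d2ℓ₄¹ *ˢ 4d2ℓ₄¹)) (1 + t * 2)) ((L₄ *ˢ L₄) (1 + t * 2)) ⟩
  (L₄ *ˢ L₄) (1 + t * 2) +ᶻ (X *ˢ (4d2ℓ₄¹ *ˢ 4d2ℓ₄¹)) (1 + t * 2) -ᶻ (L₄ *ˢ L₄) (1 + t * 2)
    ≡⟨ cong₂ _-ᶻ_ (trans (sym (square-even L₄-split (1 + t * 2))) (L₄²-twice-odd t)) (L₄²-odd t) ⟩
  + 24 *ᶻ σ (1 + t * 2) -ᶻ + 8 *ᶻ σ (1 + t * 2)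
    ≡⟨ lemma′ (σ (1 + t * 2)) ⟩
  + 16 *ᶻ σ (1 + t * 2) ∎)
  where
  open ≡-Reasoning
  lemma : ∀ b a → b ≡ a +ᶻ b -ᶻ a
  lemma = ℤ-ring
  lemma′ : ∀ s → + 24 *ᶻ s -ᶻ + 8 *ᶻ s ≡ + 16 *ᶻ s
  lemma′ = ℤ-ring

ψ₂² : d2 (d2 (ψ *ˢ ψ)) ≈ d2 (d2 φ) *ˢ d2 (d2 (d2 ψ))
ψ₂² = ≈-trans (d2-cong (≈-trans (d2-cong ψ²) (d2-* φ (d2 ψ)))) (d2-* (d2 φ) (d2 (d2 ψ)))

φ²-split : φ *ˢ φ ≈ d2 (φ *ˢ φ) +ˢ X *ˢ d2 (const (+ 4) *ˢ d2 (ψ *ˢ ψ))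
φ²-split = begin
  φ *ˢ φ
    ≈⟨ *ˢ-cong φ-by-parity φ-by-parity ⟩
  (a +ˢ X *ˢ (const (+ 2) *ˢ b)) *ˢ (a +ˢ X *ˢ (const (+ 2) *ˢ b))
    ≈⟨ solve 3 (λ a x b → (a :+ x :* (con (+ 2) :* b)) :* (a :+ x :* (con (+ 2) :* b)) := a :* a :+ x :* (x :* (con (+ 4) :* (b :* b))) :+ x :* (con (+ 4) :* (a :* b))) ≈-refl a X b ⟩
  a *ˢ a +ˢ X *ˢ (X *ˢ (const (+ 4) *ˢ (b *ˢ b))) +ˢ X *ˢ (const (+ 4) *ˢ (a *ˢ b))
    ≈⟨ +ˢ-cong (≈-trans (+ˢ-cong {a *ˢ a} ≈-refl (*ˢ-cong {X} ≈-refl (*ˢ-cong {X} ≈-refl (≈-sym d8)))) (≈-sym d2-φ²))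
         (*ˢ-cong {X} ≈-refl (≈-trans (*ˢ-cong {const (+ 4)} ≈-refl (≈-sym ψ₂²)) (≈-sym (d2-4* (d2 (ψ *ˢ ψ)))))) ⟩
  d2 (φ *ˢ φ) +ˢ X *ˢ d2 (const (+ 4) *ˢ d2 (ψ *ˢ ψ)) ∎
  where
  open ≈-Reasoning
  a = d2 (d2 φ)
  b = d2 (d2 (d2 ψ))
  d2-4* : ∀ f → d2 (const (+ 4) *ˢ f) ≈ const (+ 4) *ˢ d2 f
  d2-4* f = ≈-trans (d2-* (const (+ 4)) f) (*ˢ-cong (d2-const (+ 4)) ≈-refl)
  d8 : d2 (d2 (d2 (const (+ 4) *ˢ (ψ *ˢ ψ)))) ≈ const (+ 4) *ˢ (b *ˢ b)
  d8 = ≈-trans (d2-cong (≈-trans (d2-cong (≈-trans (d2-4* (ψ *ˢ ψ)) (*ˢ-cong ≈-refl (d2-* ψ ψ)))) (≈-trans (d2-4* (d2 ψ *ˢ d2 ψ)) (*ˢ-cong ≈-refl (d2-* (d2 ψ) (d2 ψ))))))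
    (≈-trans (d2-4* (d2 (d2 ψ) *ˢ d2 (d2 ψ))) (*ˢ-cong ≈-refl (d2-* (d2 (d2 ψ)) (d2 (d2 ψ)))))

half-smaller : ∀ m → suc m < suc m * 2
half-smaller m = s≤s (s≤s (ℕₚ.m≤m*n m 2))

halve-zero : ∀ c .{{_ : ℤ.NonZero c}} x → x *ᶻ c ≡ + 0 → x ≡ + 0
halve-zero c x p = ℤₚ.*-cancelʳ-≡ x (+ 0) c (trans p (sym (ℤₚ.*-zeroˡ c)))

-- The pair (φ², ψ²) is determined by these two equations, as in the arithmetic-geometric mean.
module AGM {L y P Y : Series} (L-split : L ≈ d2 L +ˢ X *ˢ d2 (const (+ 4) *ˢ d2 y)) (P-split : P ≈ d2 P +ˢ X *ˢ d2 (const (+ 4) *ˢ d2 Y))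
  (y² : y *ˢ y ≈ L *ˢ d2 y) (Y² : Y *ˢ Y ≈ P *ˢ d2 Y) (L0 : L 0 ≡ + 1) (P0 : P 0 ≡ + 1) (y0 : y 0 ≡ + 1) (Y0 : Y 0 ≡ + 1) where

  Δ Γ : Series
  Δ = y -ˢ Y
  Γ = L -ˢ P

  Γ-split : Γ ≈ d2 Γ +ˢ X *ˢ d2 (const (+ 4) *ˢ d2 Δ)
  Γ-split = ≈-trans (+ˢ-cong L-split (-ˢ-cong P-split)) (≈-trans
    (solve 5 (λ x a b c d → a :+ x :* b :- (c :+ x :* d) := a :- c :+ x :* (b :- d)) ≈-refl X (d2 L) (d2 (const (+ 4) *ˢ d2 y)) (d2 P) (d2 (const (+ 4) *ˢ d2 Y)))
    (+ˢ-cong (≈-sym (d2-minus L P)) (*ˢ-cong {X} ≈-refl (≈-trans (≈-sym (d2-minus (const (+ 4) *ˢ d2 y) (const (+ 4) *ˢ d2 Y)))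
      (d2-cong (≈-trans (solve 2 (λ a b → con (+ 4) :* a :- con (+ 4) :* b := con (+ 4) :* (a :- b)) ≈-refl (d2 y) (d2 Y)) (*ˢ-cong {const (+ 4)} ≈-refl (≈-sym (d2-minus y Y)))))))))
    where
    d2-minus : ∀ f g → d2 (f -ˢ g) ≈ d2 f -ˢ d2 g
    d2-minus f g = ≈-trans (d2-+ f (-ˢ g)) (+ˢ-cong {d2 f} ≈-refl (d2-neg g))

  Δ-equation : Δ *ˢ (y +ˢ Y) ≈ Γ *ˢ d2 y +ˢ d2 Δ *ˢ P
  Δ-equation = begin
    (y -ˢ Y) *ˢ (y +ˢ Y)                                          ≈⟨ solve 2 (λ a b → (a :- b) :* (a :+ b) := a :* a :- b :* b) ≈-refl y Y ⟩
    y *ˢ y -ˢ Y *ˢ Y                                              ≈⟨ +ˢ-cong y² (-ˢ-cong Y²) ⟩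
    L *ˢ d2 y -ˢ P *ˢ d2 Y                                        ≈⟨ solve 4 (λ l a p b → l :* a :- p :* b := (l :- p) :* a :+ (a :- b) :* p) ≈-refl L (d2 y) P (d2 Y) ⟩
    Γ *ˢ d2 y +ˢ (d2 y -ˢ d2 Y) *ˢ P                              ≈⟨ +ˢ-cong {Γ *ˢ d2 y} ≈-refl (*ˢ-cong (≈-trans (+ˢ-cong {d2 y} ≈-refl (≈-sym (d2-neg Y))) (≈-sym (d2-+ y (-ˢ Y)))) ≈-refl) ⟩
    Γ *ˢ d2 y +ˢ d2 Δ *ˢ P                                        ∎
    where open ≈-Reasoning

  vanishing : ∀ n → Δ n ≡ + 0 × Γ n ≡ + 0
  vanishing = <-rec _ step
    where
    step : ∀ n → (∀ {k} → k < n → Δ k ≡ + 0 × Γ k ≡ + 0) → Δ n ≡ + 0 × Γ n ≡ + 0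
    step zero    rec = cong₂ _-ᶻ_ y0 Y0 , cong₂ _-ᶻ_ L0 P0
    step (suc n) rec = Δ-zero , Γ-zero
      where
      d2Δ-below : ∀ k → k ≤ n → d2 Δ k ≡ + 0
      d2Δ-below k k≤n with parityℕ k
      ... | inj₁ (m , refl) = trans (d2-even m Δ) (proj₁ (rec (s≤s (ℕₚ.≤-trans (ℕₚ.m≤m*n m 2) k≤n))))
      ... | inj₂ (j , refl) = d2-odd j Δ
      d2Δ-at : d2 Δ (suc n) ≡ + 0
      d2Δ-at with parityℕ (suc n)
      ... | inj₁ (suc m , p) = trans (cong (d2 Δ) p) (trans (d2-even (suc m) Δ) (proj₁ (rec (subst (suc m <_) (sym p) (half-smaller m)))))
      ... | inj₂ (j , p)     = trans (cong (d2 Δ) p) (d2-odd j Δ)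
      Γ-zero : Γ (suc n) ≡ + 0
      Γ-zero with parityℕ (suc n)
      ... | inj₁ (suc m , p) = trans (cong Γ p) (trans (at Γ-split (suc m * 2)) (trans (parity-even Γ (const (+ 4) *ˢ d2 Δ) (suc m))
              (proj₂ (rec (subst (suc m <_) (sym p) (half-smaller m))))))
      ... | inj₂ (j , p)     = trans (cong Γ p) (trans (at Γ-split (1 + j * 2)) (trans (parity-odd Γ (const (+ 4) *ˢ d2 Δ) j)
              (trans (const-*ˢ-at j (+ 4) (d2 Δ)) (cong (+ 4 *ᶻ_) (d2Δ-below j (subst (j ≤_) (sym (ℕₚ.suc-injective p)) (ℕₚ.m≤m*n j 2)))))))
      -- In `Δ-equation` the lowest possible degree reads 2 · Δ on the left, as y 0 + Y 0 = 2. On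
      -- the right `Γ` vanishes there by its recursion to lower degrees, and `d2 Δ` because it looks
      -- at half the degree.
      Δ-zero : Δ (suc n) ≡ + 0
      Δ-zero = halve-zero (+ 2) (Δ (suc n)) (begin
        Δ (suc n) *ᶻ + 2                       ≡⟨ cong₂ (λ a b → Δ (suc n) *ᶻ (a +ᶻ b)) y0 Y0 ⟨
        Δ (suc n) *ᶻ (y 0 +ᶻ Y 0)              ≡⟨ Below-*ˢ-at (suc n) (y +ˢ Y) (λ k<n → proj₁ (rec k<n)) ⟨
        (Δ *ˢ (y +ˢ Y)) (suc n)                ≡⟨ at Δ-equation (suc n) ⟩
        (Γ *ˢ d2 y) (suc n) +ᶻ (d2 Δ *ˢ P) (suc n)
          ≡⟨ cong₂ _+ᶻ_ (Below-*ˢ-at (suc n) (d2 y) (λ k<n → proj₂ (rec k<n))) (Below-*ˢ-at (suc n) P (λ {k} k<n → d2Δ-below k (ℕₚ.≤-pred k<n))) ⟩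
        Γ (suc n) *ᶻ y 0 +ᶻ d2 Δ (suc n) *ᶻ P 0 ≡⟨ cong₂ (λ a b → a *ᶻ y 0 +ᶻ b *ᶻ P 0) Γ-zero d2Δ-at ⟩
        + 0 *ᶻ y 0 +ᶻ + 0 *ᶻ P 0               ≡⟨ cong₂ _+ᶻ_ (ℤₚ.*-zeroˡ (y 0)) (ℤₚ.*-zeroˡ (P 0)) ⟩
        + 0                                    ∎)
        where open ≡-Reasoning

  L≈P : L ≈ P
  L≈P = pointwise λ n → ℤₚ.i-j≡0⇒i≡j (L n) (P n) (proj₂ (vanishing n))

φ²-lambert : L₄ ≈ φ *ˢ φ
φ²-lambert = AGM.L≈P L₄-split φ²-split (pointwise λ t → trans (ℓ₄¹²-σ t) (sym (L₄ℓ₄¹-σ t))) Y² refl refl refl refl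
  where
  open ≈-Reasoning
  Y² : ψ *ˢ ψ *ˢ (ψ *ˢ ψ) ≈ φ *ˢ φ *ˢ d2 (ψ *ˢ ψ)
  Y² = begin
    ψ *ˢ ψ *ˢ (ψ *ˢ ψ)                 ≈⟨ *ˢ-cong ψ² ψ² ⟩
    φ *ˢ d2 ψ *ˢ (φ *ˢ d2 ψ)           ≈⟨ solve 2 (λ a b → a :* b :* (a :* b) := a :* a :* (b :* b)) ≈-refl φ (d2 ψ) ⟩
    φ *ˢ φ *ˢ (d2 ψ *ˢ d2 ψ)           ≈⟨ *ˢ-cong {φ *ˢ φ} ≈-refl (d2-* ψ ψ) ⟨
    φ *ˢ φ *ˢ d2 (ψ *ˢ ψ)              ∎

-- Even coefficients are inherited from half the degree. In odd degree, L² - P² = (L - P)(L + P)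
-- shows the first possible difference of L and P multiplied by L 0 + P 0 = 2.
U₂-unique : ∀ L P → (∀ m → L (m * 2) ≡ L m) → (∀ m → P (m * 2) ≡ P m) → L 0 ≡ + 1 → P 0 ≡ + 1 →
  (∀ j → (L *ˢ L) (1 + j * 2) ≡ (P *ˢ P) (1 + j * 2)) → L ≈ P
U₂-unique L P LU PU L0 P0 squares = pointwise λ n → ℤₚ.i-j≡0⇒i≡j (L n) (P n) (vanish-all {Δ} step n)
  where
  Δ = L -ˢ P
  step : ∀ {n} → Below n Δ → Δ n ≡ + 0
  step {n} b with parityℕ n
  ... | inj₁ (zero , refl)  = cong₂ _-ᶻ_ L0 P0
  ... | inj₁ (suc m , refl) = trans (cong₂ _-ᶻ_ (LU (suc m)) (PU (suc m))) (b (half-smaller m))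
  ... | inj₂ (j , refl)     = halve-zero (+ 2) (Δ k) (begin
    Δ k *ᶻ + 2                      ≡⟨ cong₂ (λ u v → Δ k *ᶻ (u +ᶻ v)) L0 P0 ⟨
    Δ k *ᶻ (L 0 +ᶻ P 0)             ≡⟨ Below-*ˢ-at k (L +ˢ P) b ⟨
    (Δ *ˢ (L +ˢ P)) k               ≡⟨ at (solve 2 (λ a b → (a :- b) :* (a :+ b) := a :* a :- b :* b) ≈-refl L P) k ⟩
    (L *ˢ L) k -ᶻ (P *ˢ P) k        ≡⟨ cong (_-ᶻ (P *ˢ P) k) (squares j) ⟩
    (P *ˢ P) k -ᶻ (P *ˢ P) k        ≡⟨ ℤₚ.+-inverseʳ ((P *ˢ P) k) ⟩
    + 0                             ∎)
    where
    open ≡-Reasoning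
    k = 1 + j * 2

φ-odd : Series
φ-odd = const (+ 2) *ˢ d2 (d2 ψ)

φ-split : φ ≈ d2 (d2 φ) +ˢ X *ˢ d2 φ-odd
φ-split = ≈-trans φ-by-parity (+ˢ-cong {d2 (d2 φ)} ≈-refl (*ˢ-cong {X} ≈-refl (≈-sym (d2-2* (d2 (d2 ψ))))))

φd2-split : ∀ f → φ *ˢ d2 f ≈ d2 (d2 φ *ˢ f) +ˢ X *ˢ d2 (φ-odd *ˢ f)
φd2-split f = ≈-trans (*ˢ-cong φ-split (≈-refl {d2 f})) (≈-trans
  (solve 4 (λ a x b f → (a :+ x :* b) :* f := a :* f :+ x :* (b :* f)) ≈-refl (d2 (d2 φ)) X (d2 φ-odd) (d2 f))
  (+ˢ-cong (≈-sym (d2-* (d2 φ) f)) (*ˢ-cong {X} ≈-refl (≈-sym (d2-* φ-odd f)))))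

-- Both series keep their coefficients under n ↦ 2n, so their squares in odd degrees decide. There
-- both are 4σ: for `L₈` by Liouville's identity, and for the theta functions because φ(q)²φ(q²)² =
-- L₄(q)L₄(q²) has the odd part 4qℓ₄¹(q⁴)L₄(q²).
φφ₂-lambert : L₈ ≈ φ *ˢ d2 φ
φφ₂-lambert = U₂-unique L₈ (φ *ˢ d2 φ)
  (λ m → trans (1+const*-at (+ 2) ℓ₈ (m * 2)) (trans (cong₂ (λ a b → a +ᶻ + 2 *ᶻ b) (1ˢ-double m) (ℓ₈-double m)) (sym (1+const*-at (+ 2) ℓ₈ m))))
  (λ m → trans (at (φd2-split φ) (m * 2)) (trans (parity-even (d2 φ *ˢ φ) (φ-odd *ˢ φ) m) (*ˢ-comm-at m (d2 φ) φ)))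
  refl refl squares
  where
  squares : ∀ j → (L₈ *ˢ L₈) (1 + j * 2) ≡ (φ *ˢ d2 φ *ˢ (φ *ˢ d2 φ)) (1 + j * 2)
  squares j = begin
    (L₈ *ˢ L₈) n                              ≡⟨ at (solve 1 (λ l → (con (+ 1) :+ con (+ 2) :* l) :* (con (+ 1) :+ con (+ 2) :* l) := con (+ 1) :+ con (+ 4) :* (l :+ l :* l)) ≈-refl ℓ₈) n ⟩
    + 0 +ᶻ (const (+ 4) *ˢ (ℓ₈ +ˢ ℓ₈ *ˢ ℓ₈)) n ≡⟨ trans (ℤₚ.+-identityˡ ((const (+ 4) *ˢ (ℓ₈ +ˢ ℓ₈ *ˢ ℓ₈)) n)) (const-*ˢ-at n (+ 4) (ℓ₈ +ˢ ℓ₈ *ˢ ℓ₈)) ⟩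
    + 4 *ᶻ (ℓ₈ n +ᶻ (ℓ₈ *ˢ ℓ₈) n)             ≡⟨ cong (+ 4 *ᶻ_) (trans (cong (ℓ₈ n +ᶻ_) (ℓ₈²-odd j)) (lemma (ℓ₈ n) (σ n))) ⟩
    + 4 *ᶻ σ n                                ≡⟨ cong (+ 4 *ᶻ_) (L₄ℓ₄¹-σ j) ⟨
    + 4 *ᶻ (L₄ *ˢ d2 ℓ₄¹) j                     ≡⟨ const-*ˢ-at j (+ 4) (L₄ *ˢ d2 ℓ₄¹) ⟨
    (const (+ 4) *ˢ (L₄ *ˢ d2 ℓ₄¹)) j           ≡⟨ at (solve 2 (λ l z → con (+ 4) :* (l :* z) := con (+ 4) :* z :* l) ≈-refl L₄ (d2 ℓ₄¹)) j ⟩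
    (4d2ℓ₄¹ *ˢ L₄) j                            ≡⟨ parity-odd (L₄ *ˢ L₄) (4d2ℓ₄¹ *ˢ L₄) j ⟨
    (d2 (L₄ *ˢ L₄) +ˢ X *ˢ d2 (4d2ℓ₄¹ *ˢ L₄)) n ≡⟨ at product n ⟨
    (φ *ˢ d2 φ *ˢ (φ *ˢ d2 φ)) n              ∎
    where
    open ≡-Reasoning
    n = 1 + j * 2
    lemma : ∀ l s → l +ᶻ (s -ᶻ l) ≡ s
    lemma = ℤ-ring
    product : φ *ˢ d2 φ *ˢ (φ *ˢ d2 φ) ≈ d2 (L₄ *ˢ L₄) +ˢ X *ˢ d2 (4d2ℓ₄¹ *ˢ L₄)
    product = ≈-trans (solve 2 (λ a b → a :* b :* (a :* b) := a :* a :* (b :* b)) ≈-refl φ (d2 φ))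
      (≈-trans (*ˢ-cong (≈-trans (≈-sym φ²-lambert) L₄-split) (≈-trans (≈-sym (d2-* φ φ)) (d2-cong (≈-sym φ²-lambert))))
      (≈-trans (solve 4 (λ a x b f → (a :+ x :* b) :* f := a :* f :+ x :* (b :* f)) ≈-refl (d2 L₄) X (d2 4d2ℓ₄¹) (d2 L₄))
        (+ˢ-cong (≈-sym (d2-* L₄ L₄)) (*ˢ-cong {X} ≈-refl (≈-sym (d2-* 4d2ℓ₄¹ L₄))))))

-- The number of representations of 8n + 1 as x² + 8(y² + z² + w²), x > 0

φ³ : Series
φ³ = φ *ˢ φ *ˢ φ

-- A sum of three squares is divisible by 4 only if all three are even, odd squares being 1 modulo
-- 4. The two successive parity splittings of φ³ express this.
φ³-quarter : ∀ n → φ³ (n * 2 * 2) ≡ φ³ n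
φ³-quarter n = trans (at first (n * 2 * 2)) (trans (parity-even u₁ v₁ (n * 2)) (trans (at second (n * 2)) (parity-even φ³ v₂ n)))
  where
  u = d2 φ
  φ-odd′ = const (+ 2) *ˢ d2 ψ
  u₁ = u *ˢ u *ˢ u +ˢ X *ˢ (const (+ 3) *ˢ (u *ˢ (φ-odd *ˢ φ-odd)))
  v₁ = const (+ 3) *ˢ (u *ˢ u *ˢ φ-odd) +ˢ X *ˢ (φ-odd *ˢ φ-odd *ˢ φ-odd)
  v₂ = const (+ 3) *ˢ (φ *ˢ (φ-odd′ *ˢ φ-odd′))
  d2-*³ : ∀ f g k → d2 (f *ˢ g *ˢ k) ≈ d2 f *ˢ d2 g *ˢ d2 k
  d2-*³ f g k = ≈-trans (d2-* (f *ˢ g) k) (*ˢ-cong (d2-* f g) (≈-refl {d2 k}))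
  d2-3* : ∀ f → d2 (const (+ 3) *ˢ f) ≈ const (+ 3) *ˢ d2 f
  d2-3* f = ≈-trans (d2-* (const (+ 3)) f) (*ˢ-cong (d2-const (+ 3)) (≈-refl {d2 f}))
  d2-X* : ∀ f → d2 (X *ˢ f) ≈ X *ˢ X *ˢ d2 f
  d2-X* f = ≈-trans (d2-* X f) (*ˢ-cong d2-X (≈-refl {d2 f}))
  d2-uhh : ∀ f g → d2 (f *ˢ (g *ˢ g)) ≈ d2 f *ˢ (d2 g *ˢ d2 g)
  d2-uhh f g = ≈-trans (d2-* f (g *ˢ g)) (*ˢ-cong {d2 f} ≈-refl (d2-* g g))
  first : φ³ ≈ d2 u₁ +ˢ X *ˢ d2 v₁
  first = ≈-trans (*ˢ-cong (*ˢ-cong φ-split φ-split) φ-split) (≈-trans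
    (solve 3 (λ u x h → (u :+ x :* h) :* (u :+ x :* h) :* (u :+ x :* h) :=
       u :* u :* u :+ x :* x :* (con (+ 3) :* (u :* (h :* h))) :+ x :* (con (+ 3) :* (u :* u :* h) :+ x :* x :* (h :* h :* h))) ≈-refl (d2 u) X (d2 φ-odd))
    (≈-sym (+ˢ-cong
      (≈-trans (d2-+ (u *ˢ u *ˢ u) (X *ˢ (const (+ 3) *ˢ (u *ˢ (φ-odd *ˢ φ-odd))))) (+ˢ-cong (d2-*³ u u u)
        (≈-trans (d2-X* (const (+ 3) *ˢ (u *ˢ (φ-odd *ˢ φ-odd)))) (*ˢ-cong {X *ˢ X} ≈-refl (≈-trans (d2-3* (u *ˢ (φ-odd *ˢ φ-odd))) (*ˢ-cong {const (+ 3)} ≈-refl (d2-uhh u φ-odd)))))))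
      (*ˢ-cong {X} ≈-refl (≈-trans (d2-+ (const (+ 3) *ˢ (u *ˢ u *ˢ φ-odd)) (X *ˢ (φ-odd *ˢ φ-odd *ˢ φ-odd))) (+ˢ-cong
        (≈-trans (d2-3* (u *ˢ u *ˢ φ-odd)) (*ˢ-cong {const (+ 3)} ≈-refl (d2-*³ u u φ-odd)))
        (≈-trans (d2-X* (φ-odd *ˢ φ-odd *ˢ φ-odd)) (*ˢ-cong {X *ˢ X} ≈-refl (d2-*³ φ-odd φ-odd φ-odd)))))))))
  second : u₁ ≈ d2 φ³ +ˢ X *ˢ d2 v₂
  second = ≈-sym (+ˢ-cong (d2-*³ φ φ φ) (*ˢ-cong {X} ≈-refl (≈-trans (d2-3* (φ *ˢ (φ-odd′ *ˢ φ-odd′))) (*ˢ-cong {const (+ 3)} ≈-refl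
    (≈-trans (d2-uhh φ φ-odd′) (*ˢ-cong {u} ≈-refl (*ˢ-cong (d2-2* (d2 ψ)) (d2-2* (d2 ψ)))))))))

-- Consider N = 8n + 1 = x² + 2(y² + z² + w²). Then x is odd and y² + z² + w² = 4(n - T) with T
-- triangular, where `φ³-quarter` removes the 4. The factor 2 comes from the sign of x, and the
-- generating function is φ(q)φ(q²) · φ(q²)².
ψφ³-σχ₈ : ∀ n → (ψ *ˢ φ³) n ≡ σχ₈ (1 + n * 8)
ψφ³-σχ₈ n = ℤₚ.*-cancelˡ-≡ (+ 2) ((ψ *ˢ φ³) n) (σχ₈ (1 + n * 8)) (begin
  + 2 *ᶻ (ψ *ˢ φ³) n
    -- `φ³-quarter` replaces φ³ by its section at the multiples of 4, which two uses of `d2-*-sec`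
    -- read as multiplication by ψ(q⁴).
    ≡⟨ cong (+ 2 *ᶻ_) (trans (*ˢ-cong-at n (λ _ → refl) (λ k → sym (φ³-quarter k))) (trans (sym (d2-*-sec 0 (s≤s z≤n) n ψ (sec 2 0 φ³))) (sym (d2-*-sec 0 (s≤s z≤n) (n * 2) (d2 ψ) φ³)))) ⟩
  + 2 *ᶻ (d2 (d2 ψ) *ˢ φ³) (n * 2 * 2)
    ≡⟨ const-*ˢ-at (n * 2 * 2) (+ 2) (d2 (d2 ψ) *ˢ φ³) ⟨
  (const (+ 2) *ˢ (d2 (d2 ψ) *ˢ φ³)) (n * 2 * 2)
    ≡⟨ at (SR.*-assoc (const (+ 2)) (d2 (d2 ψ)) φ³) (n * 2 * 2) ⟨
  (φ-odd *ˢ φ³) (n * 2 * 2)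
    ≡⟨ parity-odd (d2 φ *ˢ φ³) (φ-odd *ˢ φ³) (n * 2 * 2) ⟨
  (d2 (d2 φ *ˢ φ³) +ˢ X *ˢ d2 (φ-odd *ˢ φ³)) (1 + n * 2 * 2 * 2)
    ≡⟨ at (φd2-split φ³) (1 + n * 2 * 2 * 2) ⟨
  (φ *ˢ d2 φ³) (1 + n * 2 * 2 * 2)
    ≡⟨ cong (φ *ˢ d2 φ³) (index n) ⟩
  (φ *ˢ d2 φ³) N
    ≡⟨ at product N ⟩
  (L₈ *ˢ d2 L₄) N
    ≡⟨ at expand N ⟩
  + 0 +ᶻ (const (+ 2) *ˢ ℓ₈) N +ᶻ (const (+ 4) *ˢ d2 ℓ₄) N +ᶻ (const (+ 8) *ˢ (ℓ₈ *ˢ d2 ℓ₄)) N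
    ≡⟨ cong₂ _+ᶻ_ (cong₂ (λ a b → + 0 +ᶻ a +ᶻ b) (const-*ˢ-at N (+ 2) ℓ₈) (trans (const-*ˢ-at N (+ 4) (d2 ℓ₄)) (cong (+ 4 *ᶻ_) odd-zero))) (trans (const-*ˢ-at N (+ 8) (ℓ₈ *ˢ d2 ℓ₄)) (ℤₚ.*-assoc (+ 2) (+ 4) ((ℓ₈ *ˢ d2 ℓ₄) N))) ⟩
  + 0 +ᶻ + 2 *ᶻ ℓ₈ N +ᶻ + 4 *ᶻ + 0 +ᶻ + 2 *ᶻ (+ 4 *ᶻ (ℓ₈ *ˢ d2 ℓ₄) N)
    ≡⟨ cong (λ u → + 0 +ᶻ + 2 *ᶻ ℓ₈ N +ᶻ + 4 *ᶻ + 0 +ᶻ + 2 *ᶻ u) (ℓ₈ℓ₄-1mod8 n) ⟩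
  + 0 +ᶻ + 2 *ᶻ ℓ₈ N +ᶻ + 4 *ᶻ + 0 +ᶻ + 2 *ᶻ (σχ₈ N -ᶻ ℓ₈ N)
    ≡⟨ lemma (ℓ₈ N) (σχ₈ N) ⟩
  + 2 *ᶻ σχ₈ N ∎)
  where
  open ≡-Reasoning
  N = 1 + n * 8
  index : ∀ n → 1 + n * 2 * 2 * 2 ≡ 1 + n * 8
  index = ℕ-ring
  lemma : ∀ l e → + 0 +ᶻ + 2 *ᶻ l +ᶻ + 4 *ᶻ + 0 +ᶻ + 2 *ᶻ (e -ᶻ l) ≡ + 2 *ᶻ e
  lemma = ℤ-ring
  odd-zero : d2 ℓ₄ N ≡ + 0
  odd-zero = trans (cong (d2 ℓ₄) (sym (index n))) (d2-odd (n * 2 * 2) ℓ₄)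
  product : φ *ˢ d2 φ³ ≈ L₈ *ˢ d2 L₄
  product = ≈-trans (*ˢ-cong {φ} ≈-refl (≈-trans (d2-* (φ *ˢ φ) φ) (*ˢ-cong (d2-cong (≈-sym φ²-lambert)) (≈-refl {d2 φ}))))
    (≈-trans (solve 3 (λ a b c → a :* (b :* c) := a :* c :* b) ≈-refl φ (d2 L₄) (d2 φ)) (*ˢ-cong (≈-sym φφ₂-lambert) (≈-refl {d2 L₄})))
  expand : L₈ *ˢ d2 L₄ ≈ 1ˢ +ˢ const (+ 2) *ˢ ℓ₈ +ˢ const (+ 4) *ˢ d2 ℓ₄ +ˢ const (+ 8) *ˢ (ℓ₈ *ˢ d2 ℓ₄)
  expand = ≈-trans (*ˢ-cong {L₈} ≈-refl (≈-trans (d2-+ 1ˢ (const (+ 4) *ˢ ℓ₄)) (+ˢ-cong (d2-const (+ 1)) (≈-trans (d2-* (const (+ 4)) ℓ₄) (*ˢ-cong (d2-const (+ 4)) (≈-refl {d2 ℓ₄}))))))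
    (solve 2 (λ a b → (con (+ 1) :+ con (+ 2) :* a) :* (con (+ 1) :+ con (+ 4) :* b) := con (+ 1) :+ con (+ 2) :* a :+ con (+ 4) :* b :+ con (+ 8) :* (a :* b)) ≈-refl ℓ₈ (d2 ℓ₄))

-- Divisibility of Σ_{As = N} χ₈(s) A

when : Bool → ℤ → ℤ
when b x = if b then x else + 0

when-split : ∀ b x → x ≡ when b x +ᶻ when (not b) x
when-split true  x = sym (ℤₚ.+-identityʳ x)
when-split false x = sym (ℤₚ.+-identityˡ x)

-- As p does not divide m, exactly one of two cofactors of m · p is divisible by p, and p is removed
-- from that one.
lambert-prime : ∀ p′ → let p = suc p′ in Prime p → ∀ (w : ℕ → ℕ → ℤ) m → ¬ p ∣ m →
  lambert w (m * p) ≡ lambert (λ a s → w a (s * p)) m +ᶻ lambert (λ a s → w (a * p) s) m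
lambert-prime p′ isPrime w m p∤m = begin
  lambert w (m * p)                        ≡⟨ lambert-cong-at (m * p) (λ a s _ → when-split (does (p ∣? s)) (w a s)) ⟩
  lambert (λ a s → u a s +ᶻ v a s) (m * p) ≡⟨ lambert-+-at (m * p) u v ⟩
  lambert u (m * p) +ᶻ lambert v (m * p)   ≡⟨ cong₂ _+ᶻ_ u-part v-part ⟩
  lambert (λ a s → w a (s * p)) m +ᶻ lambert (λ a s → w (a * p) s) m ∎
  where
  open ≡-Reasoning
  p = suc p′
  u v : ℕ → ℕ → ℤ
  u a s = when (does (p ∣? s)) (w a s)
  v a s = when (not (does (p ∣? s))) (w a s)
  u-part : lambert u (m * p) ≡ lambert (λ a s → w a (s * p)) m
  u-part = trans (lambert-scale p′ u m multiple) (lambert-cong-at m (λ a s _ → cong (λ b → when b (w a (s * p))) (dec-true (p ∣? s * p) (n∣m*n s))))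
    where
    multiple : ∀ a s → a * s ≡ m * p → u a s ≢ + 0 → p ∣ s
    multiple a s _ nz with p ∣? s
    ... | yes d = d
    ... | no ¬d = contradiction (cong (λ b → when b (w a s)) (dec-false (p ∣? s) ¬d)) nz
  v-part : lambert v (m * p) ≡ lambert (λ a s → w (a * p) s) m
  v-part = trans (lambert-swap v (m * p)) (trans (lambert-scale p′ (λ a s → v s a) m multiple) (trans
    (lambert-cong-at m (λ a s q → cong (λ b → when (not b) (w (s * p) a)) (dec-false (p ∣? a) (λ d → p∤m (subst (p ∣_) q (∣m⇒∣m*n s d))))))
    (lambert-swap (λ a s → w (s * p) a) m)))
    where
    multiple : ∀ a s → a * s ≡ m * p → v s a ≢ + 0 → p ∣ s
    multiple a s q nz with p ∣? a
    ... | yes d = contradiction (cong (λ b → when (not b) (w s a)) (dec-true (p ∣? a) d)) nz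
    ... | no ¬d with euclidsLemma a s isPrime (subst (p ∣_) (sym q) (n∣m*n m))
    ...   | inj₁ d = contradiction d ¬d
    ...   | inj₂ d = d

-- A prime with χ₈(p) = -1 contributes -1 when it divides s and p when it divides a.
σχ₈-prime : ∀ p′ → let p = suc p′ in Prime p → (∀ s → χ₈ (s * p) ≡ -ᶻ χ₈ s) → ∀ m → ¬ p ∣ m → σχ₈ (m * p) ≡ (+ p -ᶻ + 1) *ᶻ σχ₈ m
σχ₈-prime p′ isPrime twist m p∤m = trans (lambert-prime p′ isPrime (λ a s → + a *ᶻ χ₈ s) m p∤m) (trans
  (cong₂ _+ᶻ_ (trans (lambert-cong-at m (λ a s _ → trans (cong (+ a *ᶻ_) (twist s)) (negate (+ a) (χ₈ s)))) (lambert-neg-at m (λ a s → + a *ᶻ χ₈ s)))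
    (trans (lambert-cong-at m (λ a s _ → trans (cong (_*ᶻ χ₈ s) (ℤₚ.pos-* a p)) (factor (+ a) (+ p) (χ₈ s)))) (lambert-*-at m (+ p) (λ a s → + a *ᶻ χ₈ s))))
  (collect (σχ₈ m) (+ p)))
  where
  p = suc p′
  negate : ∀ a c → a *ᶻ -ᶻ c ≡ -[1+ 0 ] *ᶻ (a *ᶻ c)
  negate = ℤ-ring
  factor : ∀ a p c → a *ᶻ p *ᶻ c ≡ p *ᶻ (a *ᶻ c)
  factor = ℤ-ring
  collect : ∀ e p → -ᶻ e +ᶻ p *ᶻ e ≡ (p -ᶻ + 1) *ᶻ e
  collect = ℤ-ring

σχ₈-3 : ∀ m → ¬ 3 ∣ m → σχ₈ (m * 3) ≡ + 2 *ᶻ σχ₈ m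
σχ₈-3 = σχ₈-prime 2 (from-yes (prime? 3)) (check (λ s → χ₈ (s * 3)) (λ s → -ᶻ χ₈ s) (λ _ → refl) (λ _ → refl))

σχ₈-5 : ∀ m → ¬ 5 ∣ m → σχ₈ (m * 5) ≡ + 4 *ᶻ σχ₈ m
σχ₈-5 = σχ₈-prime 4 (from-yes (prime? 5)) (check (λ s → χ₈ (s * 5)) (λ s → -ᶻ χ₈ s) (λ _ → refl) (λ _ → refl))

residue is7 : ℕ → ℤ
residue n = + (n % 8)
is7 n = when (n % 8 ≡ᵇ 7) (+ 1)

-- Every unit modulo 8 is its own inverse, so a · s ≡ -1 forces s ≡ -a.
sum-of-cofactors : ∀ a s k → a * s ≡ 7 + k * 8 → a + s ≡ (a + s) / 8 * 8
sum-of-cofactors a s k p = trans (m≡m%n+[m/n]*n (a + s) 8) (cong (_+ (a + s) / 8 * 8) (ℤₚ.+-injective zero-residue))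
  where
  shift″ : ∀ a s → a * (8 + s) ≡ a * 8 + a * s
  shift″ = ℕ-ring
  shift′ : ∀ a s → (8 + a) * s ≡ s * 8 + a * s
  shift′ = ℕ-ring
  move : ∀ a s → a + (8 + s) ≡ 8 + (a + s)
  move = ℕ-ring
  -- The implication is written as the vanishing of a product, which makes it an identity between
  -- functions periodic in both variables.
  products : ∀ a s → is7 (a * s) *ᶻ residue (a + s) ≡ + 0
  products = check₂ (λ a s → is7 (a * s) *ᶻ residue (a + s)) (λ _ _ → + 0)
    (λ a s → cong (_*ᶻ residue (a + s)) (trans (cong is7 (shift′ a s)) (climb-period is7 (λ _ → refl) s (a * s))))
    (λ a s → cong₂ _*ᶻ_ (trans (cong is7 (shift″ a s)) (climb-period is7 (λ _ → refl) a (a * s))) (cong residue (move a s)))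
    (λ _ _ → refl) (λ _ _ → refl)
  is7-value : is7 (a * s) ≡ + 1
  is7-value = trans (cong is7 (trans p (ℕₚ.+-comm 7 (k * 8)))) (climb-period is7 (λ _ → refl) k 7)
  zero-residue : + ((a + s) % 8) ≡ + 0
  zero-residue = trans (sym (ℤₚ.*-identityˡ (residue (a + s)))) (trans (cong (_*ᶻ residue (a + s)) (sym is7-value)) (products a s))

χ₄-7 : ∀ k → χ₄ (7 + k * 8) ≡ -[1+ 0 ]
χ₄-7 = check (λ k → χ₄ (7 + k * 8)) (λ _ → -[1+ 0 ]) (λ _ → refl) (λ _ → refl)

χ₈-7 : ∀ k → χ₈ (7 + k * 8) ≡ + 1
χ₈-7 = check (λ k → χ₈ (7 + k * 8)) (λ _ → + 1) (λ _ → refl) (λ _ → refl)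

-- Divisors pair off as a < s, with χ₈ a = χ₈ s and 8 ∣ a + s.
8∣σχ₈ : ∀ k → ∃ λ T → σχ₈ (7 + k * 8) ≡ + 8 *ᶻ T
8∣σχ₈ k = lambert t M , (begin
  σχ₈ M                                          ≡⟨ lambert-cong-at M split ⟩
  lambert (λ a s → u a s +ᶻ v a s) M           ≡⟨ lambert-+-at M u v ⟩
  lambert u M +ᶻ lambert v M                   ≡⟨ cong (lambert u M +ᶻ_) (lambert-swap v M) ⟩
  lambert u M +ᶻ lambert (λ a s → v s a) M     ≡⟨ lambert-+-at M u (λ a s → v s a) ⟨
  lambert (λ a s → u a s +ᶻ v s a) M           ≡⟨ lambert-cong-at M paired ⟩
  lambert (λ a s → + 8 *ᶻ t a s) M             ≡⟨ lambert-*-at M (+ 8) t ⟩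
  + 8 *ᶻ lambert t M                           ∎)
  where
  open ≡-Reasoning
  M = 7 + k * 8
  u v t : ℕ → ℕ → ℤ
  u a s = when (does (a <? s)) (+ a *ᶻ χ₈ s)
  v a s = when (does (s <? a)) (+ a *ᶻ χ₈ s)
  t a s = when (does (a <? s)) (+ ((a + s) / 8) *ᶻ χ₈ s)
  oddM : M ≡ 1 + (3 + k * 4) * 2
  oddM = index k
    where
    index : ∀ k → 7 + k * 8 ≡ 1 + (3 + k * 4) * 2
    index = ℕ-ring
  not-square : ∀ a → a * a ≢ M
  not-square a p = let i , q = odd-factor a a (3 + k * 4) (trans p oddM)
                       sq1 = trans (cong (λ s → χ₄ s *ᶻ χ₄ s) q) (χ₄-square i)
                       z = self-negative (χ₄ a) (trans (cofactor χ₄ (λ _ → refl) a a -[1+ 0 ] sq1 (trans (cong χ₄ p) (χ₄-7 k))) (ℤₚ.-1*i≡-i (χ₄ a)))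
    in contradiction (trans (sym (cong (λ c → c *ᶻ c) z)) sq1) λ ()
  split : ∀ a s → a * s ≡ M → + a *ᶻ χ₈ s ≡ u a s +ᶻ v a s
  split a s p with ℕₚ.<-cmp a s
  ... | tri< a<s _ s≮a rewrite dec-true (a <? s) a<s | dec-false (s <? a) s≮a = sym (ℤₚ.+-identityʳ (+ a *ᶻ χ₈ s))
  ... | tri> a≮s _ s<a rewrite dec-false (a <? s) a≮s | dec-true (s <? a) s<a = sym (ℤₚ.+-identityˡ (+ a *ᶻ χ₈ s))
  ... | tri≈ _ refl _ = contradiction p (not-square a)
  paired : ∀ a s → a * s ≡ M → u a s +ᶻ v s a ≡ + 8 *ᶻ t a s
  paired a s p with does (a <? s)
  ... | false = refl
  ... | true  = trans (cong (λ c → + a *ᶻ χ₈ s +ᶻ + s *ᶻ c) (trans (χ₈-cofactor a s M (+ 1) (χ₈-7 k) (3 + k * 4 , oddM) p) (ℤₚ.*-identityˡ (χ₈ s))))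
    (trans (sym (ℤₚ.*-distribʳ-+ (χ₈ s) (+ a) (+ s))) (trans (cong (λ n → + n *ᶻ χ₈ s) (sum-of-cofactors a s k p))
      (trans (cong (_*ᶻ χ₈ s) (trans (ℤₚ.pos-* ((a + s) / 8) 8) (ℤₚ.*-comm (+ ((a + s) / 8)) (+ 8)))) (ℤₚ.*-assoc (+ 8) (+ ((a + s) / 8)) (χ₈ s)))))

64∣σχ₈ : ∀ k → ¬ 5 ∣ 7 + k * 8 → ¬ 3 ∣ (7 + k * 8) * 5 → ∃ λ T → σχ₈ ((7 + k * 8) * 5 * 3) ≡ + 64 *ᶻ T
64∣σχ₈ k 5∤ 3∤ = let T , p = 8∣σχ₈ k in T , trans (σχ₈-3 ((7 + k * 8) * 5) 3∤) (trans (cong (+ 2 *ᶻ_) (trans (σχ₈-5 (7 + k * 8) 5∤) (cong (+ 4 *ᶻ_) p)))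
  (lemma T))
  where
  lemma : ∀ T → + 2 *ᶻ (+ 4 *ᶻ (+ 8 *ᶻ T)) ≡ + 64 *ᶻ T
  lemma = ℤ-ring

-- Residues of triangular numbers plus multiples of squares

tri-+ : ∀ m n → tri (m + n) ≡ tri m + tri n + m * n
tri-+ zero    n = sym (ℕₚ.+-identityʳ (tri n))
tri-+ (suc m) n = trans (cong (λ t → suc (m + n) + t) (tri-+ m n)) (lemma m n (tri m) (tri n))
  where
  lemma : ∀ m n a b → suc (m + n) + (a + b + m * n) ≡ suc m + a + b + suc m * n
  lemma = ℕ-ring

-- Triangular numbers have period p modulo p once p divides `tri p`, which q certifies. Whether
-- residues of T + c · i² are allowed is then a finite check.
module Residues (p : ℕ) .{{_ : NonZero p}} (c q : ℕ) (tri-p : tri p ≡ q * p) (allowed : ℕ → Bool)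
  {t : True (Finₚ.all? (λ (r : Fin p) → Finₚ.all? (λ (s : Fin p) → allowed ((tri (toℕ r) + sq (toℕ s) * c) % p) ≟ᵇ true)))} where

  value : ℕ → ℕ → Bool
  value j i = allowed ((tri j + sq i * c) % p)

  stepⱼ : ∀ j i → value (p + j) i ≡ value j i
  stepⱼ j i = cong allowed (trans (cong (_% p) (trans (cong (_+ sq i * c) (trans (tri-+ p j) (cong (λ x → x + tri j + p * j) tri-p))) (lemma q p (tri j) j (sq i * c))))
    ([m+kn]%n≡m%n (tri j + sq i * c) (q + j) p))
    where
    lemma : ∀ q p t j s → q * p + t + p * j + s ≡ t + s + (q + j) * p
    lemma = ℕ-ring

  stepᵢ : ∀ j i → value j (p + i) ≡ value j i
  stepᵢ j i = cong allowed (trans (cong (_% p) (lemma (tri j) i p c)) ([m+kn]%n≡m%n (tri j + sq i * c) ((p + 2 * i) * c) p))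
    where
    lemma : ∀ t i p c → t + (p + i) * (p + i) * c ≡ t + i * i * c + (p + 2 * i) * c * p
    lemma = ℕ-ring

  always-allowed : ∀ j i → value j i ≡ true
  always-allowed j i = by-residue p (λ j → value j i ≡ true) (λ j e → trans (stepⱼ j i) e)
    (λ r → by-residue p (λ i → value (toℕ r) i ≡ true) (λ i e → trans (stepᵢ (toℕ r) i) e) (λ s → toWitness t r s) i) j

  unrepresented : ∀ n → allowed (n % p) ≡ false → ∀ j i → tri j + sq i * c ≢ n
  unrepresented n f j i e with trans (sym f) (trans (cong (λ m → allowed (m % p)) (sym e)) (always-allowed j i))
  ... | ()

-- Excludes 8T + 1 ≡ 3 (mod 9), where 3 is an exact divisor.
not7 : ℕ → Bool
not7 r = not (r ≡ᵇ 7)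

-- Excludes 8T + 1 divisible by 5 but not by 25.
not3mod5 : ℕ → Bool
not3mod5 r = not ((r % 5 ≡ᵇ 3) ∧ not (r ≡ᵇ 3))

-- With f = 1 + 2g, the number of representations by ψf is that by ψ plus twice the coefficient of
-- ψg. Both of the former vanish.
ψ-convolution-zero : ∀ n F {f g} → gf F ≈ f → f ≈ 1ˢ +ˢ const (+ 2) *ˢ g → (∀ j x → tri j + size F x ≢ n) → ψ n ≡ + 0 → (ψ *ˢ g) n ≡ + 0
ψ-convolution-zero n F {f} {g} p q none ψn = halve-zero (+ 2) ((ψ *ˢ g) n) (begin
  (ψ *ˢ g) n *ᶻ + 2                      ≡⟨ ℤₚ.*-comm ((ψ *ˢ g) n) (+ 2) ⟩
  + 2 *ᶻ (ψ *ˢ g) n                      ≡⟨ const-*ˢ-at n (+ 2) (ψ *ˢ g) ⟨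
  (const (+ 2) *ˢ (ψ *ˢ g)) n            ≡⟨ ℤₚ.+-identityˡ _ ⟨
  + 0 +ᶻ (const (+ 2) *ˢ (ψ *ˢ g)) n     ≡⟨ cong (_+ᶻ (const (+ 2) *ˢ (ψ *ˢ g)) n) ψn ⟨
  ψ n +ᶻ (const (+ 2) *ˢ (ψ *ˢ g)) n     ≡⟨ at (solve 2 (λ a b → a :+ con (+ 2) :* (a :* b) := a :* (con (+ 1) :+ con (+ 2) :* b)) ≈-refl ψ g) n ⟩
  (ψ *ˢ (1ˢ +ˢ const (+ 2) *ˢ g)) n      ≡⟨ at (≈-trans (gf-⊗ Triangles⁺ F) (*ˢ-cong (≈-refl {ψ}) (≈-trans p q))) n ⟨
  gf (Triangles⁺ ⊗ F) n                  ≡⟨ gen-empty (Triangles⁺ ⊗ F) (λ _ → + 1) n (λ (j , x) → none j x) ⟩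
  + 0                                    ∎)
  where open ≡-Reasoning

-- Excluded quadratic forms and reduction to ψφ³

module _ (D : Series) (Dφ≈ψ : D *ˢ φ ≈ ψ) (n : ℕ) (mod9 : not7 (n % 9) ≡ false) (mod25 : not3mod5 (n % 25) ≡ false) where

  private
    -- In x² + 8ci², the number -8c is -2 up to squares for c = 1, 4, a non-residue modulo 5, and -1
    -- up to squares for c = 2, 8, a non-residue modulo 3. Hence the moduli 25 and 9; the constants
    -- 13 and 5 are `tri 25` / 25 and `tri 9` / 9.
    module Sq₁ = Residues 25 1 13 refl not3mod5
    module Sq₂ = Residues 9 2 5 refl not7
    module Sq₄ = Residues 25 4 13 refl not3mod5
    module Sq₈ = Residues 9 8 5 refl not7
    Squares₂ Squares₄ Squares₈ : Family
    Squares₂ = dilate2 Squares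
    Squares₄ = dilate2 Squares₂
    Squares₈ = dilate2 Squares₄
    ψ-zero : ψ n ≡ + 0
    ψ-zero = gen-empty Triangles⁺ (λ _ → + 1) n (λ j e → Sq₁.unrepresented n mod25 j 0 (trans (ℕₚ.+-identityʳ (tri j)) e))
    gf₂ : gf Squares₂ ≈ d2 φ
    gf₂ = gf-dilate2 Squares
    gf₄ : gf Squares₄ ≈ d2 (d2 φ)
    gf₄ = ≈-trans (gf-dilate2 Squares₂) (d2-cong gf₂)
    gf₈ : gf Squares₈ ≈ d2 (d2 (d2 φ))
    gf₈ = ≈-trans (gf-dilate2 Squares₄) (d2-cong gf₄)
    ψS : (ψ *ˢ S) n ≡ + 0
    ψS = ψ-convolution-zero n Squares ≈-refl φ≈1+2S (λ j x e → Sq₁.unrepresented n mod25 j ℤ.∣ x ∣ (trans (cong (λ m → tri j + m) (ℕₚ.*-identityʳ (sqℤ x))) e)) ψ-zero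
    ψS₂ : (ψ *ˢ S₂) n ≡ + 0
    ψS₂ = ψ-convolution-zero n Squares₂ gf₂ d2φ (λ j x e → Sq₂.unrepresented n mod9 j ℤ.∣ x ∣ e) ψ-zero
    ψS₄ : (ψ *ˢ S₄) n ≡ + 0
    ψS₄ = ψ-convolution-zero n Squares₄ gf₄ d4φ (λ j x e → Sq₄.unrepresented n mod25 j ℤ.∣ x ∣ (trans (cong (λ m → tri j + m) (sym (ℕₚ.*-assoc (sqℤ x) 2 2))) e)) ψ-zero
    ψS₈ : (ψ *ˢ S₈) n ≡ + 0
    ψS₈ = ψ-convolution-zero n Squares₈ gf₈ d8φ (λ j x e → Sq₈.unrepresented n mod9 j ℤ.∣ x ∣ (trans (cong (λ m → tri j + m) (trans (sym (ℕₚ.*-assoc (sqℤ x) 4 2)) (cong (_* 2) (sym (ℕₚ.*-assoc (sqℤ x) 2 2))))) e)) ψ-zero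
    ψφ-zero : (ψ *ˢ φ) n ≡ + 0
    ψφ-zero = trans (at (≈-trans (*ˢ-cong (≈-refl {ψ}) φ≈1+2S) (solve 2 (λ a b → a :* (con (+ 1) :+ con (+ 2) :* b) := a :+ con (+ 2) :* (a :* b)) ≈-refl ψ S)) n)
      (cong₂ _+ᶻ_ ψ-zero (trans (const-*ˢ-at n (+ 2) (ψ *ˢ S)) (cong (+ 2 *ᶻ_) ψS)))

  reduction : ∃ λ c → D n ≡ -ᶻ (ψ *ˢ φ³) n +ᶻ + 64 *ᶻ c
  reduction = H n , (begin
    D n
      ≡⟨ at (congruence mod64) n ⟩
    (const (+ 2) *ˢ (ψ *ˢ φ)) n -ᶻ (ψ *ˢ φ³) n +ᶻ (const (+ 16) *ˢ (ψ *ˢ S₂ +ˢ ψ *ˢ S₄ +ˢ const (+ 2) *ˢ (ψ *ˢ S₈))) n +ᶻ (const (+ 64) *ˢ H) n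
      ≡⟨ cong₂ _+ᶻ_ (cong₂ (λ a b → a -ᶻ (ψ *ˢ φ³) n +ᶻ b)
           (trans (const-*ˢ-at n (+ 2) (ψ *ˢ φ)) (cong (+ 2 *ᶻ_) ψφ-zero))
           (trans (const-*ˢ-at n (+ 16) (ψ *ˢ S₂ +ˢ ψ *ˢ S₄ +ˢ const (+ 2) *ˢ (ψ *ˢ S₈))) (cong (+ 16 *ᶻ_)
             (cong₂ _+ᶻ_ (cong₂ _+ᶻ_ ψS₂ ψS₄) (trans (const-*ˢ-at n (+ 2) (ψ *ˢ S₈)) (cong (+ 2 *ᶻ_) ψS₈))))))
         (const-*ˢ-at n (+ 64) H) ⟩
    + 0 -ᶻ (ψ *ˢ φ³) n +ᶻ + 0 +ᶻ + 64 *ᶻ H n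
      ≡⟨ cong (_+ᶻ + 64 *ᶻ H n) (trans (ℤₚ.+-identityʳ (+ 0 -ᶻ (ψ *ˢ φ³) n)) (ℤₚ.+-identityˡ (-ᶻ (ψ *ˢ φ³) n))) ⟩
    -ᶻ (ψ *ˢ φ³) n +ᶻ + 64 *ᶻ H n ∎)
    where
    open ≡-Reasoning
    mod64 = Quotient₆₄.quotient-mod-64 D Dφ≈ψ
    H = quotient mod64

-- The form n = 7 + 9u serves twice: for divisibility by 3, and for excluding x² + 16y² and x² +
-- 64y². The condition modulo 25 excludes the other two forms, and the remaining hypotheses feed the
-- divisor sum.
192∣ped : ∀ n u k → n ≡ 7 + u * 9 → 1 + n * 8 ≡ (7 + k * 8) * 5 * 3 →
  ¬ 5 ∣ 7 + k * 8 → ¬ 3 ∣ (7 + k * 8) * 5 → not3mod5 (n % 25) ≡ false → 192 ∣ ped n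
192∣ped n u k n≡ N≡ 5∤ 3∤ mod25 = lcm-least {64} {3} 64∣ 3∣
  where
  unsign : ∀ m c → signedPed n ≡ + m *ᶻ c → m ∣ ped n
  unsign m c p with Signed.∣⇒∣ᵤ (Signed.divides c (trans p (ℤₚ.*-comm (+ m) c))) | twist-sign n (λ n → + ped n)
  ... | d | inj₁ e = subst (m ∣_) (cong ℤ.∣_∣ e) d
  ... | d | inj₂ e = subst (m ∣_) (trans (cong ℤ.∣_∣ e) (ℤₚ.∣-i∣≡∣i∣ (+ ped n))) d
  3∣ : 3 ∣ ped n
  3∣ = let c , p = Quotient₃.quotient-9n+7 signedPed signedPed-recurrence u in unsign 3 c (trans (cong signedPed n≡) p)
  mod9 : not7 (n % 9) ≡ false
  mod9 = cong not7 (trans (cong (_% 9) n≡) ([m+kn]%n≡m%n 7 u 9))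
  64∣ : 64 ∣ ped n
  64∣ = let c , p = reduction signedPed signedPed-recurrence n mod9 mod25
            T , q = 64∣σχ₈ k 5∤ 3∤
    in unsign 64 (-ᶻ T +ᶻ c) (trans p (trans (cong (λ e → -ᶻ e +ᶻ + 64 *ᶻ c) (trans (ψφ³-σχ₈ n) (trans (cong σχ₈ N≡) q))) (collect T c)))
    where
    collect : ∀ T c → -ᶻ (+ 64 *ᶻ T) +ᶻ + 64 *ᶻ c ≡ + 64 *ᶻ (-ᶻ T +ᶻ c)
    collect = ℤ-ring

∤-residue : ∀ p .{{_ : NonZero p}} m r q → m ≡ r + q * p → r % p ≢ 0 → ¬ p ∣ m
∤-residue p m r q e nz d = nz (trans (sym ([m+kn]%n≡m%n r q p)) (trans (cong (_% p) (sym e)) (n∣m⇒m%n≡0 m p d)))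

theorem1p2 : (n : ℕ) →
    192 ∣ ped (225 * n + 43)
    × 192 ∣ ped (225 * n + 88)
    × 192 ∣ ped (225 * n + 133)
    × 192 ∣ ped (225 * n + 223)
theorem1p2 n =
    -- For 225n + r the witnesses have the constants (r - 7)/9 and ((8r + 1)/15 - 7)/8, here 4 and
    -- 2. The class r = 178, which is also 43 modulo 45, is absent because 25 divides 8 · 178 + 1 =
    -- 1425.
    192∣ped (225 * n + 43) (n * 25 + 4) (n * 15 + 2) (a₁ n) (b₁ n)
      (∤-residue 5 (7 + (n * 15 + 2) * 8) 23 (n * 24) (c₁ n) λ ()) (∤-residue 3 ((7 + (n * 15 + 2) * 8) * 5) 115 (n * 200) (d₁ n) λ ())
      (cong not3mod5 (trans (cong (_% 25) (e₁ n)) ([m+kn]%n≡m%n 43 (n * 9) 25)))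
  , 192∣ped (225 * n + 88) (n * 25 + 9) (n * 15 + 5) (a₂ n) (b₂ n)
      (∤-residue 5 (7 + (n * 15 + 5) * 8) 47 (n * 24) (c₂ n) λ ()) (∤-residue 3 ((7 + (n * 15 + 5) * 8) * 5) 235 (n * 200) (d₂ n) λ ())
      (cong not3mod5 (trans (cong (_% 25) (e₂ n)) ([m+kn]%n≡m%n 88 (n * 9) 25)))
  , 192∣ped (225 * n + 133) (n * 25 + 14) (n * 15 + 8) (a₃ n) (b₃ n)
      (∤-residue 5 (7 + (n * 15 + 8) * 8) 71 (n * 24) (c₃ n) λ ()) (∤-residue 3 ((7 + (n * 15 + 8) * 8) * 5) 355 (n * 200) (d₃ n) λ ())
      (cong not3mod5 (trans (cong (_% 25) (e₃ n)) ([m+kn]%n≡m%n 133 (n * 9) 25)))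
  , 192∣ped (225 * n + 223) (n * 25 + 24) (n * 15 + 14) (a₄ n) (b₄ n)
      (∤-residue 5 (7 + (n * 15 + 14) * 8) 119 (n * 24) (c₄ n) λ ()) (∤-residue 3 ((7 + (n * 15 + 14) * 8) * 5) 595 (n * 200) (d₄ n) λ ())
      (cong not3mod5 (trans (cong (_% 25) (e₄ n)) ([m+kn]%n≡m%n 223 (n * 9) 25)))
  where
  a₁ : ∀ n → 225 * n + 43 ≡ 7 + (n * 25 + 4) * 9
  a₁ = ℕ-ring
  b₁ : ∀ n → 1 + (225 * n + 43) * 8 ≡ (7 + (n * 15 + 2) * 8) * 5 * 3
  b₁ = ℕ-ring
  c₁ : ∀ n → 7 + (n * 15 + 2) * 8 ≡ 23 + n * 24 * 5
  c₁ = ℕ-ring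
  d₁ : ∀ n → (7 + (n * 15 + 2) * 8) * 5 ≡ 115 + n * 200 * 3
  d₁ = ℕ-ring
  e₁ : ∀ n → 225 * n + 43 ≡ 43 + n * 9 * 25
  e₁ = ℕ-ring
  a₂ : ∀ n → 225 * n + 88 ≡ 7 + (n * 25 + 9) * 9
  a₂ = ℕ-ring
  b₂ : ∀ n → 1 + (225 * n + 88) * 8 ≡ (7 + (n * 15 + 5) * 8) * 5 * 3
  b₂ = ℕ-ring
  c₂ : ∀ n → 7 + (n * 15 + 5) * 8 ≡ 47 + n * 24 * 5
  c₂ = ℕ-ring
  d₂ : ∀ n → (7 + (n * 15 + 5) * 8) * 5 ≡ 235 + n * 200 * 3
  d₂ = ℕ-ring
  e₂ : ∀ n → 225 * n + 88 ≡ 88 + n * 9 * 25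
  e₂ = ℕ-ring
  a₃ : ∀ n → 225 * n + 133 ≡ 7 + (n * 25 + 14) * 9
  a₃ = ℕ-ring
  b₃ : ∀ n → 1 + (225 * n + 133) * 8 ≡ (7 + (n * 15 + 8) * 8) * 5 * 3
  b₃ = ℕ-ring
  c₃ : ∀ n → 7 + (n * 15 + 8) * 8 ≡ 71 + n * 24 * 5
  c₃ = ℕ-ring
  d₃ : ∀ n → (7 + (n * 15 + 8) * 8) * 5 ≡ 355 + n * 200 * 3
  d₃ = ℕ-ring
  e₃ : ∀ n → 225 * n + 133 ≡ 133 + n * 9 * 25
  e₃ = ℕ-ring
  a₄ : ∀ n → 225 * n + 223 ≡ 7 + (n * 25 + 24) * 9
  a₄ = ℕ-ring
  b₄ : ∀ n → 1 + (225 * n + 223) * 8 ≡ (7 + (n * 15 + 14) * 8) * 5 * 3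
  b₄ = ℕ-ring
  c₄ : ∀ n → 7 + (n * 15 + 14) * 8 ≡ 119 + n * 24 * 5
  c₄ = ℕ-ring
  d₄ : ∀ n → (7 + (n * 15 + 14) * 8) * 5 ≡ 595 + n * 200 * 3
  d₄ = ℕ-ring
  e₄ : ∀ n → 225 * n + 223 ≡ 223 + n * 9 * 25
  e₄ = ℕ-ring
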